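{- Let $n\geq 1$. For a finite simple connected graph $G$ let $s(G)$ be its sibling number and $t(G)$ its tuft number. Then the generating polynomial \[ \sum_{G} x^{s(G)}\,y^{t(G)}, \] where the sum is over all isomorphism classes (unlabeled graphs) $G$ of simple connected graphs with $n$ vertices, is symmetric in $x$ and $y$. Equivalently, the sibling number and the tuft number have joint symmetric distribution on unlabeled connected graphs with $n$ vertices.
   Context: All graphs are finite and simple. For a vertex $v$ of a graph $G$, its neighborhood is $N(v)=\{u : u \text{ adjacent to } v\}$ and its closed neighborhood is $N[v]=\{v\}\cup N(v)$. A leaf is a vertex of degree one. The tuft number $t(G)$ is the maximal number of leaves adjacent to a single vertex (it is $0$ if $G$ has no leaves). The sibling number is $s(G)=\max_{v\in V(G)}\lvert\{u\in V(G): N[u]=N[v]\}\rvert-1$. -}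

module Defs where

open import Data.Bool.Base using (Bool; true; false; T; if_then_else_; _∧_)
import Data.Bool.Properties as Bool
open import Data.Fin.Base using (Fin; zero; suc; toℕ; fromℕ<; punchIn)
open import Data.Fin.Patterns using (0F)
open import Data.Fin.Permutation
  using (Permutation′; _⟨$⟩ʳ_; _⟨$⟩ˡ_; _∘ₚ_; insert; remove; insert-remove; inverseʳ)
  renaming (id to idₚ; flip to flipₚ; _≈_ to _≈ₚ_)
open import Data.Fin.Properties as Fin
  using (all?; toℕ<n; toℕ-fromℕ<; toℕ-injective)
open import Data.Fin.Subset using (Subset; ∣_∣; ⁅_⁆; _∪_; inside; outside)
open import Data.List.Base
  using (List; []; _∷_; map; allFin; filter; deduplicate; cartesianProductWith)
open import Data.List.Extrema.Nat using (max)
open import Data.List.Membership.Propositional using (_∈_; find; lose)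
open import Data.List.Membership.Propositional.Properties
  using (∈-allFin; ∈-cartesianProductWith⁺; ∈-filter⁺)
open import Data.List.Relation.Unary.All using (All)
import Data.List.Relation.Unary.All.Properties as All
open import Data.List.Relation.Unary.AllPairs using (AllPairs)
open import Data.List.Relation.Unary.Any as Any
  using (Any; here; there; any?; satisfied)
import Data.List.Relation.Unary.Any.Properties as Any
import Data.List.Relation.Unary.Unique.DecSetoid.Properties as Unique
open import Data.Nat.Base using (ℕ; zero; suc; _∸_; _≤_; _<_; z≤n; s≤s)
open import Data.Nat.ListAction using (sum)
open import Data.Nat.Properties as ℕ using (_≟_)
open import Data.Product.Base using (∃; _×_; _,_)
open import Data.Sum.Base using (_⊎_; inj₁; inj₂)
open import Data.Vec.Base using ([]; _∷_; lookup; tabulate)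
open import Data.Vec.Properties using (≡-dec; lookup∘tabulate)
open import Function.Base using (_∘_)
open import Level using (Level; 0ℓ)
open import Relation.Binary.Bundles using (DecSetoid)
open import Relation.Binary.Construct.Closure.ReflexiveTransitive
  using (Star; ε; _◅_; _◅◅_; gmap)
open import Relation.Binary.PropositionalEquality
  using (_≡_; refl; sym; trans; cong; cong₂; subst; subst₂)
open import Relation.Nullary using (¬_; Dec; does; yes; no)
open import Relation.Nullary.Decidable using (map′; _×-dec_; _⊎-dec_)
open import Relation.Unary using (Pred; Decidable)

private
  variable
    n : ℕ
    ℓ : Level

------------------------------------------------------------------------
-- Graphs

record Graph (n : ℕ) : Set where
  field
    adj        : Fin n → Fin n → Bool
    adj-sym    : ∀ u v → adj u v ≡ adj v u
    adj-irrefl : ∀ v → adj v v ≡ false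

open Graph public

Adjacent : Graph n → Fin n → Fin n → Set
Adjacent G u v = T (adj G u v)

adjacent? : ∀ (G : Graph n) u v → Dec (Adjacent G u v)
adjacent? G u v = Bool.T? (adj G u v)

-- The graph on zero vertices is connected in this sense; for n ≥ 1 this is
-- the usual notion.
Connected : Graph n → Set
Connected G = ∀ u v → Star (Adjacent G) u v

infix 4 _≅_

_≅_ : Graph n → Graph n → Set
_≅_ {n} G H = ∃ λ (π : Permutation′ n) →
  ∀ u v → adj G u v ≡ adj H (π ⟨$⟩ʳ u) (π ⟨$⟩ʳ v)

------------------------------------------------------------------------
-- Sibling number and tuft number

⟪_⟫ : {P : Pred (Fin n) ℓ} → Decidable P → Subset n
⟪ P? ⟫ = tabulate (does ∘ P?)

N : Graph n → Fin n → Subset n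
N G v = ⟪ adjacent? G v ⟫

N[_] : Graph n → Fin n → Subset n
N[ G ] v = ⁅ v ⁆ ∪ N G v

degree : Graph n → Fin n → ℕ
degree G v = ∣ N G v ∣

Leaf : Graph n → Fin n → Set
Leaf G v = degree G v ≡ 1

leaf? : (G : Graph n) → Decidable (Leaf G)
leaf? G v = degree G v ≟ 1

maximum : (Fin n → ℕ) → ℕ
maximum {n} f = max 0 (map f (allFin n))

-- The truncated subtraction is exact for n ≥ 1, as every vertex v belongs to
-- its own sibling class.
siblingNumber : Graph n → ℕ
siblingNumber G =
  maximum (λ v → ∣ ⟪ (λ u → ≡-dec Bool._≟_ (N[ G ] u) (N[ G ] v)) ⟫ ∣) ∸ 1

tuftNumber : Graph n → ℕ
tuftNumber G = maximum (λ v → ∣ ⟪ (λ u → leaf? G u ×-dec adjacent? G v u) ⟫ ∣)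

------------------------------------------------------------------------
-- Decidability of connectedness, by the Floyd–Warshall recursion

module _ (G : Graph n) where

  -- Reach k u v: there is a walk from u to v whose interior vertices all have
  -- index below k.
  Reach : ∀ k → k ≤ n → Fin n → Fin n → Set
  Reach zero    _   u v = u ≡ v ⊎ Adjacent G u v
  Reach (suc k) k<n u v =
    Reach k k≤n u v ⊎ (Reach k k≤n u w × Reach k k≤n w v)
    where
    w   = fromℕ< k<n
    k≤n = ℕ.<⇒≤ k<n

  reach? : ∀ k k≤n u v → Dec (Reach k k≤n u v)
  reach? zero    _   u v = (u Fin.≟ v) ⊎-dec adjacent? G u v
  reach? (suc k) k<n u v =
    reach? k _ u v ⊎-dec (reach? k _ u _ ×-dec reach? k _ _ v)

  reach-sound : ∀ k k≤n {u v} → Reach k k≤n u v → Star (Adjacent G) u v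
  reach-sound zero    _   (inj₁ refl)    = ε
  reach-sound zero    _   (inj₂ e)       = e ◅ ε
  reach-sound (suc k) k<n (inj₁ p)       = reach-sound k _ p
  reach-sound (suc k) k<n (inj₂ (p , q)) = reach-sound k _ p ◅◅ reach-sound k _ q

  reach-base : ∀ k k≤n {u v} → Reach zero z≤n u v → Reach k k≤n u v
  reach-base zero    z≤n p = p
  reach-base (suc k) k<n p = inj₁ (reach-base k _ p)

  reach-trans : ∀ k k≤n {u w v} → toℕ w < k →
                Reach k k≤n u w → Reach k k≤n w v → Reach k k≤n u v
  reach-trans (suc k) k<n {u} {w} {v} (s≤s w≤k) = go (ℕ.m≤n⇒m<n∨m≡n w≤k)
    where
    x = fromℕ< k<n

    R = Reach k (ℕ.<⇒≤ k<n)

    go : toℕ w < k ⊎ toℕ w ≡ k →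
         Reach (suc k) k<n u w → Reach (suc k) k<n w v → Reach (suc k) k<n u v
    go (inj₁ w<k) (inj₁ p)       (inj₁ q)       = inj₁ (reach-trans k _ w<k p q)
    go (inj₁ w<k) (inj₁ p)       (inj₂ (q , r)) = inj₂ (reach-trans k _ w<k p q , r)
    go (inj₁ w<k) (inj₂ (p , q)) (inj₁ r)       = inj₂ (p , reach-trans k _ w<k q r)
    go (inj₁ w<k) (inj₂ (p , q)) (inj₂ (r , o)) = inj₂ (p , o)
    go (inj₂ w≡k) p q = inj₂ (to p , from q)
      where
      w≡x : w ≡ x
      w≡x = toℕ-injective (trans w≡k (sym (toℕ-fromℕ< k<n)))

      to : Reach (suc k) k<n u w → R u x
      to (inj₁ p)       = subst (R u) w≡x p
      to (inj₂ (p , _)) = p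

      from : Reach (suc k) k<n w v → R x v
      from (inj₁ p)       = subst (λ y → R y v) w≡x p
      from (inj₂ (_ , p)) = p

  reach-complete : ∀ {u v} → Star (Adjacent G) u v → Reach n ℕ.≤-refl u v
  reach-complete ε = reach-base n _ (inj₁ refl)
  reach-complete (_◅_ {j = w} e p) =
    reach-trans n _ (toℕ<n w) (reach-base n _ (inj₂ e)) (reach-complete p)

  connected? : Dec (Connected G)
  connected? = all? λ u → all? λ v →
    map′ (reach-sound n _) reach-complete (reach? n ℕ.≤-refl u v)

------------------------------------------------------------------------
-- Isomorphism is a decidable equivalence

permutations : ∀ n → List (Permutation′ n)
permutations zero    = idₚ ∷ []
permutations (suc n) =
  cartesianProductWith (insert 0F) (allFin (suc n)) (permutations n)

insert-cong : ∀ i j {π ρ : Permutation′ n} → π ≈ₚ ρ → insert i j π ≈ₚ insert i j ρ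
insert-cong i j π≈ρ k with i Fin.≟ k
... | yes _ = refl
... | no  _ = cong (punchIn j) (π≈ρ _)

permutations-complete : (π : Permutation′ n) → Any (_≈ₚ π) (permutations n)
permutations-complete {zero}  π = here λ ()
permutations-complete {suc n} π
  with find (permutations-complete (remove 0F π))
... | ρ , ρ∈ , ρ≈ = lose
  (∈-cartesianProductWith⁺ (insert 0F) (∈-allFin (π ⟨$⟩ʳ 0F)) ρ∈)
  (λ k → trans (insert-cong 0F _ {ρ} {remove 0F π} ρ≈ k) (insert-remove 0F π k))

_≅?_ : (G H : Graph n) → Dec (G ≅ H)
_≅?_ {n} G H = map′ satisfied complete (any? iso? (permutations n))
  where
  Iso : Permutation′ n → Set
  Iso π = ∀ u v → adj G u v ≡ adj H (π ⟨$⟩ʳ u) (π ⟨$⟩ʳ v)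

  iso? : ∀ π → Dec (Iso π)
  iso? π = all? λ u → all? λ v → adj G u v Bool.≟ _

  complete : G ≅ H → Any Iso (permutations n)
  complete (π , f) = Any.map
    (λ ρ≈π u v → trans (f u v) (cong₂ (adj H) (sym (ρ≈π u)) (sym (ρ≈π v))))
    (permutations-complete π)

≅-refl : {G : Graph n} → G ≅ G
≅-refl = idₚ , λ _ _ → refl

≅-sym : {G H : Graph n} → G ≅ H → H ≅ G
≅-sym {H = H} (π , f) = flipₚ π , λ u v →
  trans (cong₂ (adj H) (sym (inverseʳ π)) (sym (inverseʳ π))) (sym (f _ _))

≅-trans : {G H K : Graph n} → G ≅ H → H ≅ K → G ≅ K
≅-trans (π , f) (ρ , g) = π ∘ₚ ρ , λ u v → trans (f u v) (g _ _)

≅-decSetoid : ℕ → DecSetoid 0ℓ 0ℓ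
≅-decSetoid n = record
  { Carrier          = Graph n
  ; _≈_              = _≅_
  ; isDecEquivalence = record
    { isEquivalence = record
      { refl  = λ {G} → ≅-refl {G = G}
      ; sym   = λ {G} {H} → ≅-sym {G = G} {H}
      ; trans = λ {G} {H} {K} → ≅-trans {G = G} {H} {K}
      }
    ; _≟_ = _≅?_
    }
  }

≅-connected : {G H : Graph n} → G ≅ H → Connected G → Connected H
≅-connected {G = G} {H} (π , f) c u v =
  subst₂ (Star (Adjacent H)) (inverseʳ π) (inverseʳ π)
    (gmap (π ⟨$⟩ʳ_) (λ {a} {b} → subst T (f a b)) (c (π ⟨$⟩ˡ u) (π ⟨$⟩ˡ v)))

------------------------------------------------------------------------
-- Unlabeled connected graphs

-- Adds a new vertex 0 with neighborhood S.
extend : Subset n → Graph n → Graph (suc n)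
extend {n} S G = record { adj = a ; adj-sym = a-sym ; adj-irrefl = a-irrefl }
  where
  a : Fin (suc n) → Fin (suc n) → Bool
  a zero    zero    = false
  a zero    (suc v) = lookup S v
  a (suc u) zero    = lookup S u
  a (suc u) (suc v) = adj G u v

  a-sym : ∀ u v → a u v ≡ a v u
  a-sym zero    zero    = refl
  a-sym zero    (suc v) = refl
  a-sym (suc u) zero    = refl
  a-sym (suc u) (suc v) = adj-sym G u v

  a-irrefl : ∀ v → a v v ≡ false
  a-irrefl zero    = refl
  a-irrefl (suc v) = adj-irrefl G v

subsets : ∀ n → List (Subset n)
subsets zero    = [] ∷ []
subsets (suc n) = cartesianProductWith _∷_ (outside ∷ inside ∷ []) (subsets n)

labeledGraphs : ∀ n → List (Graph n)
labeledGraphs zero    =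
  record { adj = λ () ; adj-sym = λ () ; adj-irrefl = λ () } ∷ []
labeledGraphs (suc n) = cartesianProductWith extend (subsets n) (labeledGraphs n)

-- One representative of each isomorphism class; see the three lemmas below.
unlabeledConnectedGraphs : ∀ n → List (Graph n)
unlabeledConnectedGraphs n =
  deduplicate _≅?_ (filter connected? (labeledGraphs n))

∈-subsets : (S : Subset n) → S ∈ subsets n
∈-subsets []          = here refl
∈-subsets (false ∷ S) =
  ∈-cartesianProductWith⁺ _∷_ {xs = outside ∷ inside ∷ []} (here refl) (∈-subsets S)
∈-subsets (true  ∷ S) =
  ∈-cartesianProductWith⁺ _∷_ {xs = outside ∷ inside ∷ []} (there (here refl)) (∈-subsets S)

labeledGraphs-complete : (G : Graph n) →
  Any (λ H → ∀ u v → adj G u v ≡ adj H u v) (labeledGraphs n)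
labeledGraphs-complete {zero}  G = here λ ()
labeledGraphs-complete {suc n} G with find (labeledGraphs-complete G⁻)
  where
  G⁻ : Graph n
  G⁻ = record
    { adj        = λ u v → adj G (suc u) (suc v)
    ; adj-sym    = λ u v → adj-sym G (suc u) (suc v)
    ; adj-irrefl = λ v → adj-irrefl G (suc v)
    }
... | H , H∈ , G⁻≗H =
  lose (∈-cartesianProductWith⁺ extend (∈-subsets S) H∈) G≗
  where
  S = tabulate λ v → adj G zero (suc v)

  G≗ : ∀ u v → adj G u v ≡ adj (extend S H) u v
  G≗ zero    zero    = adj-irrefl G zero
  G≗ zero    (suc v) = sym (lookup∘tabulate _ v)
  G≗ (suc u) zero    = trans (adj-sym G (suc u) zero) (sym (lookup∘tabulate _ u))
  G≗ (suc u) (suc v) = G⁻≗H u v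

unlabeledConnectedGraphs-connected : ∀ n → All Connected (unlabeledConnectedGraphs n)
unlabeledConnectedGraphs-connected n =
  All.deduplicate⁺ _≅?_ (All.all-filter connected? (labeledGraphs n))

unlabeledConnectedGraphs-distinct : ∀ n →
  AllPairs (λ G H → ¬ G ≅ H) (unlabeledConnectedGraphs n)
unlabeledConnectedGraphs-distinct n = Unique.deduplicate-! (≅-decSetoid n) _

unlabeledConnectedGraphs-complete : (G : Graph n) → Connected G →
  Any (G ≅_) (unlabeledConnectedGraphs n)
unlabeledConnectedGraphs-complete G c with find (labeledGraphs-complete G)
... | H , H∈ , G≗H = Any.deduplicate⁺ _≅?_
  (λ {K} {L} L≅K G≅K → ≅-trans {G = G} {K} {L} G≅K (≅-sym {G = L} {K} L≅K))
  (lose (∈-filter⁺ connected? H∈ (≅-connected {G = G} {H} G≅H c)) G≅H)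
  where
  G≅H : G ≅ H
  G≅H = idₚ , G≗H

------------------------------------------------------------------------
-- The generating polynomial

-- A polynomial in x and y with coefficients in ℕ is represented by its
-- coefficients: p i j is the coefficient of xⁱ yʲ.
Polynomial : Set
Polynomial = ℕ → ℕ → ℕ

monomial : ℕ → ℕ → Polynomial
monomial a b i j = if does (a ≟ i) ∧ does (b ≟ j) then 1 else 0

∑ : List Polynomial → Polynomial
∑ ps i j = sum (map (λ p → p i j) ps)

SymmetricPolynomial : Polynomial → Set
SymmetricPolynomial p = ∀ i j → p i j ≡ p j i

generatingPolynomial : ℕ → Polynomial
generatingPolynomial n =
  ∑ (map (λ G → monomial (siblingNumber G) (tuftNumber G)) (unlabeledConnectedGraphs n))

{-# OPTIONS --safe #-}

-- It suffices that the number of graphs with s < i and t < j ("good" graphs) is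
-- symmetric in i, j ≥ 1; taking differences yields the coefficients. A bad graph
-- has i + 1 mutual siblings or a vertex with j leaves. Collapse such blocks, as
-- often as possible: i + 1 siblings to one vertex marked "twin", a vertex with j
-- leaves to that vertex marked "tuft". Only unmarked vertices take part in further
-- collapses. The result is a good graph with marks, unique up to isomorphism,
-- and expanding the marks recovers the original graph. So bad graphs for (i, j)
-- correspond to good graphs for (i, j) with at least one mark and prescribed
-- weight, a twin weighing i + 1 and a tuft j + 1. By induction on the number of
-- unmarked vertices "good for (i, j)" may be replaced by "good for (j, i)" in
-- this count, and exchanging the two marks then gives the count of the bad graphs
-- for (j, i). For the induction, inert colours of earlier marks must be carried
-- along, and K₂, where siblings and leaves coincide, must be excluded.

module Submission where

open import Data.Bool.Base using (Bool; true; false; T; if_then_else_; _∧_)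
open import Data.Bool.Properties as Bool using (T?)
open import Data.Empty using (⊥; ⊥-elim)
open import Data.Fin.Base as Fin using (Fin; zero; suc; punchIn)
open import Data.Fin.Patterns using (0F; 1F; 2F)
open import Data.Fin.Permutation as Perm
  using (Permutation′; _⟨$⟩ʳ_; _⟨$⟩ˡ_; insert; insert-punchIn; inverseʳ; inverseˡ; _∘ₚ_)
open import Data.Fin.Properties as Fin using (punchInᵢ≢i; all?)
open import Data.Fin.Subset using (∣_∣; ⁅_⁆) renaming (_∈_ to _∈ˢ_)
open import Data.Fin.Subset.Properties using (⊆-antisym; x∈p∪q⁻; x∈p∪q⁺; x∈⁅x⁆; x∈⁅y⁆⇒x≡y)
open import Data.List.Base
  using (List; []; _∷_; length; map; filter; deduplicate; cartesianProductWith; allFin; lookup)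
open import Data.List.Extrema.Nat using (max≤v⁺; xs≤max)
open import Data.List.Membership.Propositional using (_∈_; find; lose)
open import Data.List.Membership.Propositional.Properties
  using (∈-allFin; ∈-cartesianProductWith⁺; ∈-filter⁺; ∈-filter⁻; ∈-lookup)
open import Data.List.Properties using (filter-none)
open import Data.List.Relation.Unary.All as All using (All)
import Data.List.Relation.Unary.All.Properties as All
open import Data.List.Relation.Unary.AllPairs using (AllPairs; _∷_)
import Data.List.Relation.Unary.AllPairs.Properties as AllPairs
open import Data.List.Relation.Unary.Any as Any using (Any; here; any?; satisfied)
import Data.List.Relation.Unary.Any.Properties as Any
import Data.List.Relation.Unary.Unique.DecSetoid.Properties as Unique
open import Data.Maybe.Base as Maybe using (Maybe; just; nothing)
import Data.Maybe.Properties as Maybe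
open import Data.Nat.Base hiding (equal)
open import Data.Nat.Induction using (<-wellFounded)
open import Data.Nat.Properties as ℕ hiding (_≟_)
open import Algebra.Properties.Semiring.Sum +-*-semiring
  using (sum; sum-cong-≗; sum-replicate-zero; sum-remove; ∑-distrib-+; ∑-comm; sum-permute; *-distribˡ-sum)
open import Data.Product.Base using (∃; ∃₂; _×_; _,_; proj₁; proj₂)
import Data.Product.Properties as Product
open import Data.Sum.Base using (_⊎_; inj₁; inj₂; [_,_]′)
import Data.Sum.Properties as Sum
open import Data.Unit.Base using (⊤; tt)
open import Data.Vec.Base as Vec using (Vec; []; _∷_; tabulate)
open import Data.Vec.Properties using (≡-dec; lookup∘tabulate; []=⇒lookup; lookup⇒[]=; tabulate-cong)
open import Function.Base using (_∘_; id; case_of_)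
open import Function.Bundles using (Equivalence)
open import Induction.WellFounded using (Acc; acc)
open import Level using (0ℓ)
open import Relation.Binary.Bundles using (DecSetoid)
open import Relation.Binary.Construct.Closure.ReflexiveTransitive using (Star; ε; _◅_; _◅◅_; gmap)
open import Relation.Binary.Core using (Rel)
open import Relation.Binary.Definitions using (DecidableEquality; Symmetric; tri<; tri≈; tri>)
open import Relation.Binary.PropositionalEquality
open import Relation.Nullary using (¬_; Dec; does; yes; no; contradiction)
open import Relation.Nullary.Decidable
  using (_×-dec_; _⊎-dec_; _→-dec_; ¬?; dec-true; dec-false; map′; from-yes)
open import Relation.Unary using (Pred; Decidable)
open import Defs

-- Which siblings or leaves of a vertex disappear in a collapse is a matter of choice, so no
-- condensation is canonical and uniqueness holds only up to isomorphism. It is not obtained from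
-- confluence of single collapses: `Condenses` relates the original graph directly to the final
-- result, and two results are compared by counting. The vertices fall into classes of
-- interchangeable ones; in a class of siblings the number of twins is a quotient by `i + 1`, and
-- the tufts of a good condensation are exactly the plain vertices with at least `j` plain leaves.
-- The two kinds of block cannot interfere, since outside K₂ neither a plain leaf nor its plain
-- centre has a sibling besides itself.
--
-- Two things are exchanged separately in the induction. Goodness looks at plain vertices only, so
-- exchanging the marks preserves it and changes only which mark has which weight. The two bounds in
-- goodness are then exchanged by the induction hypothesis for graphs with marks. All comparisons
-- are inequalities between numbers of isomorphism classes; exchanging `i` and `j` gives the reverse
-- ones.

private
  variable
    i j k l m n : ℕ
    A B : Set
    P Q R : Pred (Fin n) 0ℓ

-- Counting

ind : Dec A → ℕ
ind a? = if does a? then 1 else 0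

count : {P : Pred (Fin n) 0ℓ} → Decidable P → ℕ
count P? = sum (λ v → ind (P? v))

∣⟪⟫∣≡count : {P : Pred (Fin n) 0ℓ} (P? : Decidable P) → ∣ ⟪ P? ⟫ ∣ ≡ count P?
∣⟪⟫∣≡count {n = zero}  P? = refl
∣⟪⟫∣≡count {n = suc n} P? with does (P? zero)
... | true  = cong suc (∣⟪⟫∣≡count (P? ∘ suc))
... | false = ∣⟪⟫∣≡count (P? ∘ suc)

ind-yes : (a? : Dec A) → A → ind a? ≡ 1
ind-yes a? a rewrite dec-true a? a = refl

ind-no : (a? : Dec A) → ¬ A → ind a? ≡ 0
ind-no a? ¬a rewrite dec-false a? ¬a = refl

ind-mono : (a? : Dec A) (b? : Dec B) → (A → B) → ind a? ≤ ind b?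
ind-mono (yes a) b? f = ≤-reflexive (sym (ind-yes b? (f a)))
ind-mono (no _)  b? f = z≤n

ind-cong : (a? : Dec A) (b? : Dec B) → (A → B) → (B → A) → ind a? ≡ ind b?
ind-cong a? b? f g = ≤-antisym (ind-mono a? b? f) (ind-mono b? a? g)

ind-× : (a? : Dec A) (b? : Dec B) → ind (a? ×-dec b?) ≡ ind a? * ind b?
ind-× (yes _) b? = sym (*-identityˡ (ind b?))
ind-× (no _)  b? = refl

sum-mono : {f g : Fin n → ℕ} → (∀ v → f v ≤ g v) → sum f ≤ sum g
sum-mono {n = zero}  f≤g = z≤n
sum-mono {n = suc n} f≤g = +-mono-≤ (f≤g zero) (sum-mono (f≤g ∘ suc))

sum-zero : {f : Fin n → ℕ} → (∀ v → f v ≡ 0) → sum f ≡ 0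
sum-zero {n} f≡0 = trans (sum-cong-≗ f≡0) (sum-replicate-zero n)

sum-single : (f : Fin n → ℕ) (u : Fin n) → (∀ v → v ≢ u → f v ≡ 0) → sum f ≡ f u
sum-single {suc n} f u f≡0 = trans (sum-remove {i = u} f) (trans
  (cong (f u +_) (sum-zero (λ v → f≡0 _ (punchInᵢ≢i u v))))
  (+-identityʳ (f u)))

≤sum : (f : Fin n → ℕ) (u : Fin n) → f u ≤ sum f
≤sum {suc n} f u = ≤-trans (m≤m+n _ _) (≤-reflexive (sym (sum-remove {i = u} f)))

0<sum : (f : Fin n → ℕ) → 0 < sum f → ∃ λ v → 0 < f v
0<sum {suc n} f 0<s with f zero in eq
... | suc _ = zero , subst (0 <_) (sym eq) z<s
... | zero with 0<sum (f ∘ suc) 0<s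
...   | v , 0<fv = suc v , 0<fv

count-mono : (P? : Decidable P) (Q? : Decidable Q) → (∀ v → P v → Q v) → count P? ≤ count Q?
count-mono P? Q? f = sum-mono (λ v → ind-mono (P? v) (Q? v) (f v))

count-cong : (P? : Decidable P) (Q? : Decidable Q) →
             (∀ v → P v → Q v) → (∀ v → Q v → P v) → count P? ≡ count Q?
count-cong P? Q? f g = sum-cong-≗ (λ v → ind-cong (P? v) (Q? v) (f v) (g v))

count-none : (P? : Decidable P) → (∀ v → ¬ P v) → count P? ≡ 0
count-none P? ¬p = sum-zero (λ v → ind-no (P? v) (¬p v))

0<count : (P? : Decidable P) → 0 < count P? → ∃ P
0<count P? 0<c with 0<sum (λ v → ind (P? v)) 0<c
... | v , 0<i with P? v
...   | yes p = v , p

count-positive : {P : Pred (Fin n) 0ℓ} (P? : Decidable P) {v : Fin n} → P v → 0 < count P?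
count-positive {n = suc n} P? {v} p = subst (0 <_) (sym (sum-remove {i = v} (λ w → ind (P? w))))
  (<-≤-trans (subst (0 <_) (sym (ind-yes (P? v) p)) z<s) (m≤m+n _ _))

count-⊎ : (P? : Decidable P) (Q? : Decidable Q) (R? : Decidable R) →
          (∀ v → P v → Q v ⊎ R v) → (∀ v → Q v → P v) → (∀ v → R v → P v) →
          (∀ v → Q v → R v → ⊥) → count P? ≡ count Q? + count R?
count-⊎ P? Q? R? f q r disj = trans (sum-cong-≗ split) (∑-distrib-+ (λ v → ind (Q? v)) (λ v → ind (R? v)))
  where
  split : ∀ v → ind (P? v) ≡ ind (Q? v) + ind (R? v)
  split v with P? v
  ... | no ¬p = sym (cong₂ _+_ (ind-no (Q? v) (¬p ∘ q v)) (ind-no (R? v) (¬p ∘ r v)))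
  ... | yes p with f v p
  ...   | inj₁ qv = sym (cong₂ _+_ (ind-yes (Q? v) qv) (ind-no (R? v) (disj v qv)))
  ...   | inj₂ rv = sym (cong₂ _+_ (ind-no (Q? v) (λ qv → disj v qv rv)) (ind-yes (R? v) rv))

count-permute : {P : Pred (Fin n) 0ℓ} (π : Permutation′ n) (P? : Decidable P) → count P? ≡
    count (λ v → P? (π ⟨$⟩ʳ v))
count-permute π P? = sum-permute (λ v → ind (P? v)) π

count-singleton : (u : Fin n) → count (λ v → v Fin.≟ u) ≡ 1
count-singleton u = trans (sum-single (λ v → ind (v Fin.≟ u)) u (λ v v≢u → ind-no (v Fin.≟ u) v≢u))
    (ind-yes (u Fin.≟ u) refl)

-- Selects the vertices that a new block removes: there may be more candidates than the mark
-- demands, and the surplus has to stay.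
subset-of-size : {P : Pred (Fin n) 0ℓ} (P? : Decidable P) → m ≤ count P? →
  ∃ λ (S : Fin n → Bool) → (∀ v → T (S v) → P v) × count (T? ∘ S) ≡ m
subset-of-size {n = zero} P? z≤n = (λ ()) , (λ ()) , refl
subset-of-size {n = suc n} {m = m} P? m≤ with P? zero
... | no _ with subset-of-size (P? ∘ suc) m≤
...   | S , S⊆P , eq = (λ { zero → false ; (suc v) → S v })
                     , (λ { (suc v) s → S⊆P v s }) , eq
subset-of-size {n = suc n} {m = zero} P? m≤ | yes _ =
  (λ _ → false) , (λ _ ()) , sum-zero {suc n} (λ _ → refl)
subset-of-size {n = suc n} {m = suc m} P? m≤ | yes p
  with subset-of-size (P? ∘ suc) (s≤s⁻¹ m≤)
...   | S , S⊆P , eq = (λ { zero → true ; (suc v) → S v })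
                     , (λ { zero _ → p ; (suc v) s → S⊆P v s }) , cong suc eq

_≟ᴹ_ : DecidableEquality (Maybe (Fin n))
_≟ᴹ_ = Maybe.≡-dec Fin._≟_

remove-one : (D : Fin n → ℕ) → sum D ≡ suc m →
  ∃₂ λ w (D′ : Fin n → ℕ) → (∀ u → D u ≡ ind (u Fin.≟ w) + D′ u) × sum D′ ≡ m
remove-one {n} D s≡ with 0<sum D (subst (0 <_) (sym s≡) z<s)
... | w , 0<Dw = w , D′ , D≡ , suc-injective (trans (sym (trans (sum-cong-≗ D≡)
    (trans (∑-distrib-+ (λ u → ind (u Fin.≟ w)) D′) (cong (_+ sum D′) (count-singleton w))))) s≡)
  where
  D′ : Fin n → ℕ
  D′ u = D u ∸ ind (u Fin.≟ w)

  D≡ : ∀ u → D u ≡ ind (u Fin.≟ w) + D′ u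
  D≡ u with u Fin.≟ w
  ... | no _     = refl
  ... | yes refl = sym (m+[n∸m]≡n 0<Dw)

-- Greedy recursion over the points: each point of `P` serves some `u` whose demand is still
-- positive. In the expansion it hands dead placeholders to the marks.
distribute : {P : Pred (Fin n) 0ℓ} (P? : Decidable P) (D : Fin m → ℕ) → sum D ≤ count P? →
  ∃ λ (ρ : Fin n → Maybe (Fin m)) →
    (∀ {v u} → ρ v ≡ just u → P v) × (∀ u → count (λ v → ρ v ≟ᴹ just u) ≡ D u)
distribute {n = zero} P? D s≤0 =
  (λ ()) , (λ { {()} }) , λ u → sym (n≤0⇒n≡0 (≤-trans (≤sum D u) s≤0))
distribute {n = suc n} P? D s≤ with P? zero
... | no _ with distribute (P? ∘ suc) D s≤
...   | ρ , ρ⊆P , eq = (λ { zero → nothing ; (suc v) → ρ v })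
                     , (λ { {suc v} e → ρ⊆P e }) , eq
distribute {n = suc n} P? D s≤ | yes p with sum D in s≡
... | zero = (λ _ → nothing) , (λ ()) , λ u → trans
  (sum-zero {n = suc n} (λ _ → refl))
  (sym (n≤0⇒n≡0 (≤-trans (≤sum D u) (≤-reflexive s≡))))
... | suc s with remove-one D s≡
...   | w , D′ , D≡ , s≡′ with distribute (P? ∘ suc) D′ (≤-trans (≤-reflexive s≡′) (s≤s⁻¹ s≤))
...     | ρ , ρ⊆P , eq =
  (λ { zero → just w ; (suc v) → ρ v }) ,
  (λ { {zero} _ → p ; {suc v} e → ρ⊆P e }) ,
  λ u → trans
    (cong₂ _+_ (ind-cong (just w ≟ᴹ just u) (u Fin.≟ w) (λ { refl → refl }) (λ { refl → refl })) (eq u))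
    (sym (D≡ u))

module _ {A : Set} (_≟_ : DecidableEquality A) where

  -- Point 0 is sent to any point with the same value; removing both keeps all fibres equinumerous.
  -- Every isomorphism between condensations or between expansions is obtained in this way, from an
  -- equality of counts.
  matching : (p q : Fin n → A) →
    (∀ a → count (λ v → p v ≟ a) ≡ count (λ v → q v ≟ a)) →
    ∃ λ (π : Permutation′ n) → ∀ v → q (π ⟨$⟩ʳ v) ≡ p v
  matching {n = zero}  p q eq = Perm.id , λ ()
  matching {n = suc n} p q eq
    with 0<count (λ v → q v ≟ p zero)
           (subst (0 <_) (eq (p zero)) (count-positive (λ v → p v ≟ p zero) {zero} refl))
  ... | w , qw≡ with matching (p ∘ suc) (q ∘ punchIn w) eq′
    where
    eq′ : ∀ a → count (λ v → p (suc v) ≟ a) ≡ count (λ v → q (punchIn w v) ≟ a)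
    eq′ a = +-cancelˡ-≡ (ind (p zero ≟ a)) _ _ (trans (eq a) (trans
      (sum-remove {i = w} (λ v → ind (q v ≟ a)))
      (cong (λ x → ind (x ≟ a) + count (λ v → q (punchIn w v) ≟ a)) qw≡)))
  ...   | π , π-ok = insert zero w π , λ
    { zero    → qw≡
    ; (suc v) → trans (cong q (insert-punchIn zero w π v)) (π-ok v)
    }

Killed : (Fin n → Maybe (Fin n)) → Pred (Fin n) 0ℓ
Killed ρ v = ∃ λ u → ρ v ≡ just u

killed? : (ρ : Fin n → Maybe (Fin n)) → Decidable (Killed ρ)
killed? ρ v with ρ v
... | just u  = yes (u , refl)
... | nothing = no λ ()

-- Double counting of the pairs `(v , u)` with `ρ v ≡ just u`: each killed `v` lies in one such
-- pair, and `P` at `v` amounts to `Q` at `u`.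
count-killed : {P Q : Pred (Fin n) 0ℓ} (ρ : Fin n → Maybe (Fin n)) (P? : Decidable P) (Q? : Decidable Q) →
  (∀ {v u} → ρ v ≡ just u → P v → Q u) → (∀ {v u} → ρ v ≡ just u → Q u → P v) →
  count (λ v → P? v ×-dec killed? ρ v) ≡
  sum (λ u → ind (Q? u) * count (λ v → ρ v ≟ᴹ just u))
count-killed ρ P? Q? f g = trans (sum-cong-≗ pointwise) (trans
  (∑-comm (λ v u → ind (Q? u) * ind (ρ v ≟ᴹ just u)))
  (sum-cong-≗ λ u → sym (*-distribˡ-sum (ind (Q? u)) (λ v → ind (ρ v ≟ᴹ just u)))))
  where
  pointwise : ∀ v → ind (P? v ×-dec killed? ρ v) ≡ sum (λ u → ind (Q? u) * ind (ρ v ≟ᴹ just u))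
  pointwise v with killed? ρ v
  ... | no ¬k = trans
    (trans (ind-× (P? v) (no ¬k)) (*-zeroʳ (ind (P? v))))
    (sym (sum-zero λ u → trans
      (cong (ind (Q? u) *_) (ind-no (ρ v ≟ᴹ just u) (λ e → ¬k (u , e))))
      (*-zeroʳ (ind (Q? u)))))
  ... | yes k@(w , ρv) = trans
    (ind-cong (P? v ×-dec yes k) (Q? w) (f ρv ∘ proj₁) (λ q → g ρv q , k))
    (sym (trans
      (sum-single (λ u → ind (Q? u) * ind (ρ v ≟ᴹ just u)) w λ u u≢w → trans
        (cong (ind (Q? u) *_) (ind-no (ρ v ≟ᴹ just u) (λ e → u≢w (Maybe.just-injective (trans (sym e) ρv)))))
        (*-zeroʳ (ind (Q? u))))
      (trans (cong (ind (Q? w) *_) (ind-yes (ρ v ≟ᴹ just w) ρv)) (*-identityʳ (ind (Q? w))))))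

-- Isomorphism classes

lookup-AllPairs : {R : Rel A 0ℓ} {xs : List A} → AllPairs R xs →
                  ∀ {i j} → i Fin.< j → R (lookup xs i) (lookup xs j)
lookup-AllPairs (rs ∷ _)  {zero}  {suc j} _         = All.lookup rs (∈-lookup j)
lookup-AllPairs (_  ∷ ps) {suc i} {suc j} (s≤s i<j) = lookup-AllPairs ps i<j

-- A relation takes the place of a map because condensing and expanding are determined only up to
-- isomorphism. The position of the first related entry of `ys` then gives an injection of
-- positions.
length-≤ : {_≈_ : Rel A 0ℓ} → Symmetric _≈_ → (R : A → B → Set) {xs : List A} {ys : List B} →
           AllPairs (λ x y → ¬ x ≈ y) xs →
           (∀ {x} → x ∈ xs → Any (R x) ys) →
           (∀ {x x′ y} → R x y → R x′ y → x ≈ x′) →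
           length xs ≤ length ys
length-≤ ≈-sym R {xs} {ys} distinct total injective = Fin.injective⇒≤ f-injective
  where
  f : Fin (length xs) → Fin (length ys)
  f i = Any.index (total (∈-lookup i))

  R-f : ∀ i → R (lookup xs i) (lookup ys (f i))
  R-f i = Any.lookup-index (total (∈-lookup i))

  f-injective : ∀ {i j} → f i ≡ f j → i ≡ j
  f-injective {i} {j} eq with Fin.<-cmp i j
  ... | tri≈ _ i≡j _ = i≡j
  ... | tri< i<j _ _ = contradiction
    (injective (R-f i) (subst (R _ ∘ lookup ys) (sym eq) (R-f j))) (lookup-AllPairs distinct i<j)
  ... | tri> _ _ j<i = contradiction
    (injective (R-f j) (subst (R _ ∘ lookup ys) eq (R-f i))) (lookup-AllPairs distinct j<i)

length-filter-split : {P Q R : Pred A 0ℓ} (P? : Decidable P) (Q? : Decidable Q) (R? : Decidable R) →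
  (∀ {x} → P x → Q x ⊎ R x) → (∀ {x} → Q x → P x) → (∀ {x} → R x → P x) → (∀ {x} → Q x → ¬ R x) →
  (xs : List A) → length (filter P? xs) ≡ length (filter Q? xs) + length (filter R? xs)
length-filter-split P? Q? R? f q r disj [] = refl
length-filter-split P? Q? R? f q r disj (x ∷ xs)
  with ih ← length-filter-split P? Q? R? f q r disj xs | P? x | Q? x | R? x
... | yes _ | yes _  | no _   = cong suc ih
... | yes _ | no _   | yes _  = trans (cong suc ih) (sym (+-suc _ _))
... | no _  | no _   | no _   = ih
... | _     | yes qx | yes rx = contradiction rx (disj qx)
... | no ¬p | yes qx | no _   = contradiction (q qx) ¬p
... | no ¬p | no _   | yes rx = contradiction (r rx) ¬p
... | yes p | no ¬q  | no ¬r  with f p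
...   | inj₁ qx = contradiction qx ¬q
...   | inj₂ rx = contradiction rx ¬r

-- Colour 0 (dead) marks isolated placeholders that do not belong to the graph,
-- colour 1 (plain) the ordinary vertices; so graphs of all orders up to n live
-- on Fin n. The remaining k colours are inert.
record Coloured (n k : ℕ) : Set where
  constructor _▷_
  field
    graph  : Graph n
    colour : Fin n → Fin (2 + k)

open Coloured public

infix 4 _≃_

_≃_ : Coloured n k → Coloured n k → Set
_≃_ {n} X Y = ∃ λ (π : Permutation′ n) →
  (∀ u v → adj (graph X) u v ≡ adj (graph Y) (π ⟨$⟩ʳ u) (π ⟨$⟩ʳ v)) ×
  (∀ v → colour X v ≡ colour Y (π ⟨$⟩ʳ v))

≃-refl : {X : Coloured n k} → X ≃ X
≃-refl = Perm.id , (λ _ _ → refl) , (λ _ → refl)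

≃-sym : {X Y : Coloured n k} → X ≃ Y → Y ≃ X
≃-sym {X = X} {Y} (π , f , g) = Perm.flip π ,
  (λ u v → trans (cong₂ (adj (graph Y)) (sym (inverseʳ π)) (sym (inverseʳ π))) (sym (f _ _))) ,
  (λ v → trans (cong (colour Y) (sym (inverseʳ π))) (sym (g _)))

≃-trans : {X Y Z : Coloured n k} → X ≃ Y → Y ≃ Z → X ≃ Z
≃-trans (π , f , g) (ρ , f′ , g′) =
  π ∘ₚ ρ , (λ u v → trans (f u v) (f′ _ _)) , (λ v → trans (g v) (g′ _))

_≃?_ : (X Y : Coloured n k) → Dec (X ≃ Y)
_≃?_ {n} X Y = map′ satisfied complete (any? iso? (permutations n))
  where
  Iso : Permutation′ n → Set
  Iso π = (∀ u v → adj (graph X) u v ≡ adj (graph Y) (π ⟨$⟩ʳ u) (π ⟨$⟩ʳ v)) ×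
          (∀ v → colour X v ≡ colour Y (π ⟨$⟩ʳ v))

  iso? : ∀ π → Dec (Iso π)
  iso? π = (all? λ u → all? λ v → adj (graph X) u v Bool.≟ _) ×-dec
           (all? λ v → colour X v Fin.≟ _)

  complete : X ≃ Y → Any Iso (permutations n)
  complete (π , f , g) = Any.map
    (λ ρ≈π → (λ u v → trans (f u v) (cong₂ (adj (graph Y)) (sym (ρ≈π u)) (sym (ρ≈π v)))) ,
             (λ v → trans (g v) (cong (colour Y) (sym (ρ≈π v)))))
    (permutations-complete π)

≃-decSetoid : ℕ → ℕ → DecSetoid 0ℓ 0ℓ
≃-decSetoid n k = record
  { Carrier          = Coloured n k
  ; _≈_              = _≃_
  ; isDecEquivalence = record
    { isEquivalence = record
      { refl  = λ {X} → ≃-refl {X = X}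
      ; sym   = λ {X} {Y} → ≃-sym {X = X} {Y}
      ; trans = λ {X} {Y} {Z} → ≃-trans {X = X} {Y} {Z}
      }
    ; _≟_ = _≃?_
    }
  }

extendColouring : Fin k → (Fin n → Fin k) → Fin (suc n) → Fin k
extendColouring c f zero    = c
extendColouring c f (suc v) = f v

colourings : ∀ n k → List (Fin n → Fin k)
colourings zero    k = (λ ()) ∷ []
colourings (suc n) k = cartesianProductWith extendColouring (allFin k) (colourings n k)

colourings-complete : (f : Fin n → Fin k) → Any (f ≗_) (colourings n k)
colourings-complete {zero}  f = here λ ()
colourings-complete {suc n} f with find (colourings-complete (f ∘ suc))
... | g , g∈ , f≗g = lose
  (∈-cartesianProductWith⁺ extendColouring (∈-allFin (f zero)) g∈)
  λ { zero → refl ; (suc v) → f≗g v }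

classes : ∀ n k → List (Coloured n k)
classes n k = deduplicate _≃?_ (cartesianProductWith _▷_ (labeledGraphs n) (colourings n (2 + k)))

classes-distinct : ∀ n k → AllPairs (λ X Y → ¬ X ≃ Y) (classes n k)
classes-distinct n k = Unique.deduplicate-! (≃-decSetoid n k) _

classes-complete : (X : Coloured n k) → Any (X ≃_) (classes n k)
classes-complete X
  with find (labeledGraphs-complete (graph X)) | find (colourings-complete (colour X))
... | G , G∈ , X≗G | f , f∈ , X≗f = Any.deduplicate⁺ _≃?_
  (λ {K} {L} L≃K X≃K → ≃-trans {X = X} {K} {L} X≃K (≃-sym {X = L} {K} L≃K))
  (lose (∈-cartesianProductWith⁺ _▷_ G∈ f∈) (Perm.id , X≗G , X≗f))

Invariant : Pred (Coloured n k) 0ℓ → Set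
Invariant P = ∀ {X Y} → X ≃ Y → P X → P Y

card : {P : Pred (Coloured n k) 0ℓ} → Decidable P → ℕ
card {n} {k} P? = length (filter P? (classes n k))

-- The graph `Y` produced from `X` need not be one of the listed representatives. Invariance of `Q`
-- allows passing to the representative `Z` of its class, and injectivity is tested up to
-- isomorphism of the `Y`.
card-≤ : {P : Pred (Coloured n k) 0ℓ} {Q : Pred (Coloured n l) 0ℓ} (P? : Decidable P) (Q? : Decidable Q) →
         Invariant Q → (R : Coloured n k → Coloured n l → Set) →
         (∀ X → P X → ∃ λ Y → Q Y × R X Y) →
         (∀ {X X′ Y Y′} → P X → P X′ → Q Y → Q Y′ → R X Y → R X′ Y′ → Y ≃ Y′ → X ≃ X′) →
         card P? ≤ card Q?
card-≤ {n} {k} {l} {P} {Q} P? Q? inv R total injective = length-≤ (λ {X} {Y} → ≃-sym {X = X} {Y})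
  (λ X Z → P X × ∃ λ Y → Q Y × R X Y × Y ≃ Z)
  (AllPairs.filter⁺ P? (classes-distinct n k))
  total′
  (λ { {y = Z} (p , Y , q , r , Y≃Z) (p′ , Y′ , q′ , r′ , Y′≃Z) →
       injective p p′ q q′ r r′ (≃-trans {X = Y} {Z} {Y′} Y≃Z (≃-sym {X = Y′} {Z} Y′≃Z)) })
  where
  total′ : ∀ {X} → X ∈ filter P? (classes n k) →
           Any (λ Z → P X × ∃ λ Y → Q Y × R X Y × Y ≃ Z) (filter Q? (classes n l))
  total′ {X} X∈ with ∈-filter⁻ P? {xs = classes n k} X∈
  ... | _ , p with total X p
  ...   | Y , q , r with find (classes-complete Y)
  ...     | Z , Z∈ , Y≃Z = lose (∈-filter⁺ Q? Z∈ (inv Y≃Z q)) (p , Y , q , r , Y≃Z)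

-- Siblings, leaves and invariants of coloured graphs

T⇒≡ : ∀ {b} → T b → b ≡ true
T⇒≡ = Equivalence.to Bool.T-≡

≡⇒T : ∀ {b} → b ≡ true → T b
≡⇒T = Equivalence.from Bool.T-≡

T-ext : ∀ {b c} → (T b → T c) → (T c → T b) → b ≡ c
T-ext {false} {false} f g = refl
T-ext {false} {true}  f g = ⊥-elim (g _)
T-ext {true}  {false} f g = ⊥-elim (f _)
T-ext {true}  {true}  f g = refl

module _ (G : Graph n) where

  Adjacent-sym : ∀ {u v} → Adjacent G u v → Adjacent G v u
  Adjacent-sym {u} {v} = subst T (adj-sym G u v)

  Adjacent-irrefl : ∀ {v} → ¬ Adjacent G v v
  Adjacent-irrefl {v} = subst T (adj-irrefl G v)

  Near : Fin n → Fin n → Set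
  Near u w = w ≡ u ⊎ Adjacent G u w

  near⁺ : ∀ {u w} → Near u w → w ∈ˢ N[ G ] u
  near⁺ {u} (inj₁ refl) = x∈p∪q⁺ (inj₁ (x∈⁅x⁆ u))
  near⁺ {u} {w} (inj₂ e) = x∈p∪q⁺ {p = ⁅ u ⁆}
      (inj₂ (lookup⇒[]= w (N G u) (trans (lookup∘tabulate _ w) (T⇒≡ e))))

  near⁻ : ∀ {u w} → w ∈ˢ N[ G ] u → Near u w
  near⁻ {u} {w} w∈ with x∈p∪q⁻ _ (N G u) w∈
  ... | inj₁ p = inj₁ (x∈⁅y⁆⇒x≡y u p)
  ... | inj₂ p = inj₂ (≡⇒T (trans (sym (lookup∘tabulate _ w)) ([]=⇒lookup p)))

  Sibling : Fin n → Fin n → Set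
  Sibling u v = N[ G ] u ≡ N[ G ] v

  sibling? : ∀ u v → Dec (Sibling u v)
  sibling? u v = ≡-dec Bool._≟_ (N[ G ] u) (N[ G ] v)

  sibling⁺ : ∀ {u v} → (∀ {w} → Near u w → Near v w) → (∀ {w} → Near v w → Near u w) → Sibling u v
  sibling⁺ f g = ⊆-antisym (λ p → near⁺ (f (near⁻ p))) (λ p → near⁺ (g (near⁻ p)))

  sibling⁻ : ∀ {u v} → Sibling u v → ∀ {w} → Near u w → Near v w
  sibling⁻ s p = near⁻ (subst (_ ∈ˢ_) s (near⁺ p))

  sibling-adjacent : ∀ {u v} → Sibling u v → u ≢ v → Adjacent G u v
  sibling-adjacent s u≢v with sibling⁻ (sym s) (inj₁ refl)
  ... | inj₁ v≡u = contradiction (sym v≡u) u≢v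
  ... | inj₂ e   = e

  -- Expresses a leaf by its only neighbour rather than by its degree, which is easier to follow
  -- through a condensation. The two descriptions are matched by `leaf⇔leafAt` and `leafAt⇒leaf`.
  LeafAt : Fin n → Fin n → Set
  LeafAt v u = Adjacent G v u × (∀ w → Adjacent G u w → w ≡ v)

  leafAt? : ∀ v u → Dec (LeafAt v u)
  leafAt? v u = adjacent? G v u ×-dec all? λ w → adjacent? G u w →-dec (w Fin.≟ v)

pattern dead    = zero
pattern plain   = suc zero
pattern twin    = suc (suc zero)
pattern tuft    = suc (suc (suc zero))
pattern inert c = suc (suc (suc (suc c)))

Alive : Coloured n k → Fin n → Set
Alive X v = colour X v ≢ dead

Plain : Coloured n k → Fin n → Set
Plain X v = colour X v ≡ plain

plain? : (X : Coloured n k) → Decidable (Plain X)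
plain? X v = colour X v Fin.≟ plain

record Valid (X : Coloured n k) : Set where
  field
    isolated  : ∀ {u v} → Adjacent (graph X) u v → Alive X u
    connected : ∀ u v → Alive X u → Alive X v → Star (Adjacent (graph X)) u v

open Valid public

valid? : (X : Coloured n k) → Dec (Valid X)
valid? {n} X = map′
  (λ { (i , c) → record { isolated = i _ _ ; connected =
      λ u v a b → reach-sound (graph X) n _ (c u v a b) } })
  (λ X-ok → (λ u v → isolated X-ok) , (λ u v a b → reach-complete (graph X) (connected X-ok u v a b)))
  ((all? λ u → all? λ v → adjacent? (graph X) u v →-dec ¬? (colour X u Fin.≟ dead)) ×-dec
   (all? λ u → all? λ v → ¬? (colour X u Fin.≟ dead) →-dec (¬? (colour X v Fin.≟ dead) →-dec
     reach? (graph X) n ≤-refl u v)))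

plainSiblings : Coloured n k → Fin n → ℕ
plainSiblings X v = count (λ u → plain? X u ×-dec sibling? (graph X) u v)

plainLeaves : Coloured n k → Fin n → ℕ
plainLeaves X v = count (λ u → plain? X u ×-dec leafAt? (graph X) v u)

-- `plainSiblings` counts `v` itself and `plainLeaves` does not. Hence for positive `i` and `j` both
-- conditions say that fewer than `i`, respectively `j`, further vertices are available for a block
-- at `v`.
Good : ℕ → ℕ → Coloured n k → Set
Good i j X = ∀ v → Plain X v → plainSiblings X v ≤ i × plainLeaves X v < j

good? : ∀ i j (X : Coloured n k) → Dec (Good i j X)
good? i j X = all? λ v → plain? X v →-dec ((plainSiblings X v ≤? i) ×-dec (plainLeaves X v <? j))

content : Coloured n k → Vec ℕ (2 + k)
content X = tabulate λ c → count (λ v → colour X v Fin.≟ c)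

module _ {X Y : Coloured n k} (iso : X ≃ Y) where

  private
    π = proj₁ iso

    adj≡ : ∀ u v → adj (graph X) u v ≡ adj (graph Y) (π ⟨$⟩ʳ u) (π ⟨$⟩ʳ v)
    adj≡ = proj₁ (proj₂ iso)

    col≡ : ∀ v → colour X v ≡ colour Y (π ⟨$⟩ʳ v)
    col≡ = proj₂ (proj₂ iso)

    π-injective : ∀ {u v} → π ⟨$⟩ʳ u ≡ π ⟨$⟩ʳ v → u ≡ v
    π-injective e = trans (sym (inverseˡ π)) (trans (cong (π ⟨$⟩ˡ_) e) (inverseˡ π))

    onto : (P : Pred (Fin n) 0ℓ) → (∀ v → P (π ⟨$⟩ʳ v)) → ∀ v → P v
    onto P f v = subst P (inverseʳ π) (f (π ⟨$⟩ˡ v))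

    adj⁺ : ∀ {u v} → Adjacent (graph X) u v → Adjacent (graph Y) (π ⟨$⟩ʳ u) (π ⟨$⟩ʳ v)
    adj⁺ = subst T (adj≡ _ _)

    adj⁻ : ∀ {u v} → Adjacent (graph Y) (π ⟨$⟩ʳ u) (π ⟨$⟩ʳ v) → Adjacent (graph X) u v
    adj⁻ = subst T (sym (adj≡ _ _))

    near-π⁺ : ∀ {u v} → Near (graph X) u v → Near (graph Y) (π ⟨$⟩ʳ u) (π ⟨$⟩ʳ v)
    near-π⁺ (inj₁ e) = inj₁ (cong (π ⟨$⟩ʳ_) e)
    near-π⁺ (inj₂ e) = inj₂ (adj⁺ e)

    near-π⁻ : ∀ {u v} → Near (graph Y) (π ⟨$⟩ʳ u) (π ⟨$⟩ʳ v) → Near (graph X) u v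
    near-π⁻ (inj₁ e) = inj₁ (π-injective e)
    near-π⁻ (inj₂ e) = inj₂ (adj⁻ e)

  sibling-≃ : ∀ {u v} → Sibling (graph Y) (π ⟨$⟩ʳ u) (π ⟨$⟩ʳ v) → Sibling (graph X) u v
  sibling-≃ s = sibling⁺ (graph X)
    (λ p → near-π⁻ (sibling⁻ (graph Y) s (near-π⁺ p)))
    (λ p → near-π⁻ (sibling⁻ (graph Y) (sym s) (near-π⁺ p)))

  leafAt-≃ : ∀ {v u} → LeafAt (graph Y) (π ⟨$⟩ʳ v) (π ⟨$⟩ʳ u) → LeafAt (graph X) v u
  leafAt-≃ (e , f) = adj⁻ e , λ w a → π-injective (f _ (adj⁺ a))

  Valid-≃ : Valid X → Valid Y
  isolated (Valid-≃ X-ok) {u} {v} = onto (λ u → ∀ v → Adjacent (graph Y) u v → Alive Y u)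
    (λ u → onto _ λ v a → subst (_≢ dead) (col≡ u) (isolated X-ok (adj⁻ a))) u v
  connected (Valid-≃ X-ok) = onto _ λ u → onto _ λ v a b →
    gmap (π ⟨$⟩ʳ_) adj⁺ (connected X-ok u v (a ∘ trans (sym (col≡ u))) (b ∘ trans (sym (col≡ v))))

  Good-≃ : Good i j X → Good i j Y
  Good-≃ good = onto _ λ v p → let q , r = good v (trans (col≡ v) p) in
    ≤-trans (≤-trans (≤-reflexive (count-permute π λ u → plain? Y u ×-dec sibling? (graph Y) u (π ⟨$⟩ʳ v)))
      (count-mono (λ u → plain? Y (π ⟨$⟩ʳ u) ×-dec sibling? (graph Y) (π ⟨$⟩ʳ u) (π ⟨$⟩ʳ v))
                  (λ u → plain? X u ×-dec sibling? (graph X) u v)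
                  λ u (a , s) → trans (col≡ u) a , sibling-≃ s)) q ,
    ≤-<-trans (≤-trans (≤-reflexive (count-permute π λ u → plain? Y u ×-dec leafAt? (graph Y) (π ⟨$⟩ʳ v) u))
      (count-mono (λ u → plain? Y (π ⟨$⟩ʳ u) ×-dec leafAt? (graph Y) (π ⟨$⟩ʳ v) (π ⟨$⟩ʳ u))
                  (λ u → plain? X u ×-dec leafAt? (graph X) v u)
                  λ u (a , s) → trans (col≡ u) a , leafAt-≃ s)) r

  content-≃ : content X ≡ content Y
  content-≃ = tabulate-cong λ c → trans
    (count-cong (λ v → colour X v Fin.≟ c) (λ v → colour Y (π ⟨$⟩ʳ v) Fin.≟ c)
      (λ v → trans (sym (col≡ v))) (λ v → trans (col≡ v)))
    (sym (count-permute π λ v → colour Y v Fin.≟ c))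

-- Condensation

unmark : Fin (4 + k) → Fin (2 + k)
unmark dead      = dead
unmark plain     = plain
unmark twin      = plain
unmark tuft      = plain
unmark (inert c) = suc (suc c)

unmark-dead : {c : Fin (4 + k)} → unmark c ≡ dead → c ≡ dead
unmark-dead {c = dead}    _  = refl
unmark-dead {c = plain}   ()
unmark-dead {c = twin}    ()
unmark-dead {c = tuft}    ()
unmark-dead {c = inert _} ()

-- The root of a block survives, so a block of weight `i + 1` or `j + 1` removes only `i` or `j`
-- vertices.
demand : ℕ → ℕ → Fin (4 + k) → ℕ
demand i j twin = i
demand i j tuft = j
demand i j _    = 0

alive : Fin (suc k) → Bool
alive dead    = false
alive (suc _) = true

alive⁺ : {c : Fin (suc k)} → c ≢ dead → T (alive c)
alive⁺ {c = dead}  c≢ = c≢ refl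
alive⁺ {c = suc _} _  = _

alive⁻ : {c : Fin (suc k)} → T (alive c) → c ≢ dead
alive⁻ {c = suc _} _ ()

-- Y arises from X by collapsing blocks: a vertex u coloured twin replaces u
-- together with i plain siblings, and one coloured tuft replaces u together with
-- j plain leaves at u. The removed vertices become dead, and root sends them to u.
Block : Coloured n k → Coloured n (2 + k) → Fin n → Fin n → Set
Block X Y u v = (colour Y u ≡ twin × Sibling (graph X) v u)
              ⊎ (colour Y u ≡ tuft × LeafAt (graph X) u v)

record Condenses (i j : ℕ) (X : Coloured n k) (Y : Coloured n (2 + k)) : Set where
  field
    root     : Fin n → Maybe (Fin n)
    -- `nothing` covers the surviving vertices and also the placeholders that were dead in `X`
    -- already; for the latter the equation forces colour dead in `Y`.
    kept     : ∀ {v} → root v ≡ nothing → unmark (colour Y v) ≡ colour X v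
    killed   : ∀ {v u} → root v ≡ just u → colour Y v ≡ dead × Plain X v
    block    : ∀ {v u} → root v ≡ just u → Block X Y u v
    sizes    : ∀ u → count (λ v → root v ≟ᴹ just u) ≡ demand i j (colour Y u)
    restrict : ∀ u v → adj (graph Y) u v ≡ alive (colour Y u) ∧ alive (colour Y v) ∧ adj (graph X) u v

  adjacent⁺ : ∀ {u v} → Alive Y u → Alive Y v → Adjacent (graph X) u v → Adjacent (graph Y) u v
  adjacent⁺ {u} {v} a b e = subst T (sym (restrict u v))
    (Equivalence.from Bool.T-∧ (alive⁺ a , Equivalence.from Bool.T-∧ (alive⁺ b , e)))

  adjacent⁻ : ∀ {u v} → Adjacent (graph Y) u v → Alive Y u × Alive Y v × Adjacent (graph X) u v
  adjacent⁻ {u} {v} e with Equivalence.to (Bool.T-∧ {alive (colour Y u)}) (subst T (restrict u v) e)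
  ... | a , e′ with Equivalence.to (Bool.T-∧ {alive (colour Y v)}) e′
  ...   | b , e″ = alive⁻ a , alive⁻ b , e″

  root-alive : ∀ {v u} → root v ≡ just u → Alive Y u
  root-alive r with block r
  ... | inj₁ (e , _) = λ d → case trans (sym e) d of λ ()
  ... | inj₂ (e , _) = λ d → case trans (sym e) d of λ ()

  kept-alive : ∀ {v} → root v ≡ nothing → Alive X v → Alive Y v
  kept-alive r a d = a (trans (sym (kept r)) (cong unmark d))

  alive-kept : ∀ {v} → Alive Y v → root v ≡ nothing
  alive-kept {v} a with root v in eq
  ... | nothing = refl
  ... | just u  = contradiction (proj₁ (killed eq)) a

  alive-alive : ∀ {v} → Alive Y v → Alive X v
  alive-alive a d = a (unmark-dead (trans (kept (alive-kept a)) d))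

  root-plain : ∀ {v u} → root v ≡ just u → Plain X u
  root-plain r with block r
  ... | inj₁ (e , _) = trans (sym (kept (alive-kept (root-alive r)))) (cong unmark e)
  ... | inj₂ (e , _) = trans (sym (kept (alive-kept (root-alive r)))) (cong unmark e)

  root-adjacent : ∀ {v u} → root v ≡ just u → Adjacent (graph X) u v
  root-adjacent r with block r
  ... | inj₁ (e , s) = sibling-adjacent (graph X) (sym s) λ { refl → root-alive r (proj₁ (killed r)) }
  ... | inj₂ (e , a , _) = a

  killed≢root : ∀ {v u} → root v ≡ just u → v ≢ u
  killed≢root r refl = root-alive r (proj₁ (killed r))

  leafAt-restrict : ∀ {v ℓ} → Alive Y v → Alive Y ℓ → LeafAt (graph X) v ℓ → LeafAt (graph Y) v ℓ
  leafAt-restrict a b (e , only) = adjacent⁺ a b e , λ w e′ → only w (proj₂ (proj₂ (adjacent⁻ e′)))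

  near-restrict : ∀ {u w} → Alive Y u → Alive Y w → Near (graph X) u w → Near (graph Y) u w
  near-restrict a b (inj₁ p) = inj₁ p
  near-restrict a b (inj₂ e) = inj₂ (adjacent⁺ a b e)

  near-alive : ∀ {u w} → Alive Y u → Near (graph Y) u w → Alive Y w × Near (graph X) u w
  near-alive a (inj₁ refl) = a , inj₁ refl
  near-alive a (inj₂ e) with adjacent⁻ e
  ... | _ , b , e′ = b , inj₂ e′

  sibling-restrict : ∀ {u v} → Alive Y u → Alive Y v → Sibling (graph X) u v → Sibling (graph Y) u v
  sibling-restrict a b s = sibling⁺ (graph Y)
    (λ p → let c , q = near-alive a p in near-restrict b c (sibling⁻ (graph X) s q))
    (λ p → let c , q = near-alive b p in near-restrict a c (sibling⁻ (graph X) (sym s) q))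

-- Uniqueness of expansions

module _ {X X′ : Coloured n k} {Y Y′ : Coloured n (2 + k)}
         (C : Condenses i j X Y) (C′ : Condenses i j X′ Y′)
         (X-ok : Valid X) (π : Fin n → Fin n)
         (adj-π : ∀ {u v} → Adjacent (graph Y) u v → Adjacent (graph Y′) (π u) (π v))
         (col-π : ∀ v → colour Y v ≡ colour Y′ (π v)) where
  private
    module C  = Condenses C
    module C′ = Condenses C′

  data Match (v v′ : Fin n) : Set where
    both-dead   : colour X v ≡ dead → Match v v′
    both-kept   : Alive Y v → v′ ≡ π v → Match v v′
    both-killed : ∀ {u} → C.root v ≡ just u → C′.root v′ ≡ just (π u) → Match v v′

  private
    near-kept : ∀ {u w} → Alive Y u → Alive Y w → Near (graph X) u w → Near (graph X′) (π u) (π w)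
    near-kept a b (inj₁ e) = inj₁ (cong π e)
    near-kept a b (inj₂ e) = inj₂ (proj₂ (proj₂ (C′.adjacent⁻ (adj-π (C.adjacent⁺ a b e)))))

    same-block : ∀ {v v′ u} → C.root v ≡ just u → C′.root v′ ≡ just (π u) →
      (Sibling (graph X) v u × Sibling (graph X′) v′ (π u)) ⊎
      (colour Y u ≡ tuft × LeafAt (graph X) u v × LeafAt (graph X′) (π u) v′)
    same-block {u = u} r r′ with C.block r | C′.block r′
    ... | inj₁ (_ , s) | inj₁ (_ , s′) = inj₁ (s , s′)
    ... | inj₂ (e , p) | inj₂ (_ , p′) = inj₂ (e , p , p′)
    ... | inj₁ (e , _) | inj₂ (e′ , _) = case trans (sym e) (trans (col-π u) e′) of λ ()
    ... | inj₂ (e , _) | inj₁ (e′ , _) = case trans (sym e) (trans (col-π u) e′) of λ ()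

    as-adjacent : ∀ {v′ w′} → v′ ≢ w′ → Near (graph X′) v′ w′ → Adjacent (graph X′) v′ w′
    as-adjacent v≢w (inj₁ e) = contradiction (sym e) v≢w
    as-adjacent v≢w (inj₂ e) = e

    killed-kept : ∀ {v v′ u w} → C.root v ≡ just u → C′.root v′ ≡ just (π u) → Alive Y w → v′ ≢ π w →
                  Adjacent (graph X) v w → Adjacent (graph X′) v′ (π w)
    killed-kept r r′ b v≢w e with same-block r r′
    ... | inj₁ (s , s′) = as-adjacent v≢w (sibling⁻ (graph X′) (sym s′)
            (near-kept (C.root-alive r) b (sibling⁻ (graph X) s (inj₂ e))))
    ... | inj₂ (_ , (_ , only) , (e′ , _)) rewrite only _ e = Adjacent-sym (graph X′) e′

  -- Adjacency in `X` can be read off from `Y` and the roots: a removed sibling has the closed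
  -- neighbourhood of its root, a removed leaf has its root as only neighbour. Closed neighbourhoods
  -- only yield `Near`, hence the demand that the images differ.
  match-adjacent : ∀ {v v′ w w′} → Match v v′ → Match w w′ → v′ ≢ w′ →
                   Adjacent (graph X) v w → Adjacent (graph X′) v′ w′
  match-adjacent (both-dead d) _ _ e = contradiction d (isolated X-ok e)
  match-adjacent _ (both-dead d) _ e = contradiction d (isolated X-ok (Adjacent-sym (graph X) e))
  match-adjacent (both-kept a refl) (both-kept b refl) v≢w e = as-adjacent v≢w (near-kept a b (inj₂ e))
  match-adjacent (both-killed r r′) (both-kept b refl) v≢w e = killed-kept r r′ b v≢w e
  match-adjacent (both-kept a refl) (both-killed r r′) v≢w e =
    Adjacent-sym (graph X′) (killed-kept r r′ a (≢-sym v≢w) (Adjacent-sym (graph X) e))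
  match-adjacent {w = w} (both-killed r r′) (both-killed s s′) v≢w e with same-block r r′
  ... | inj₂ (_ , (_ , only) , _) =
    contradiction (proj₁ (C.killed s)) (subst (Alive Y) (sym (only w e)) (C.root-alive r))
  -- Both endpoints are removed and the first is a sibling of its root. It is moved to that root,
  -- the edge to the second endpoint is transported by `killed-kept`, and the first endpoint is
  -- moved back.
  ... | inj₁ (t , t′) with sibling⁻ (graph X) t (inj₂ e)
  ...   | inj₁ refl = contradiction (proj₁ (C.killed s)) (C.root-alive r)
  ...   | inj₂ e′ = as-adjacent v≢w (sibling⁻ (graph X′) (sym t′) (inj₂ (Adjacent-sym (graph X′)
          (killed-kept s s′ (C.root-alive r)
            (λ { refl → C′.root-alive r′ (proj₁ (C′.killed s′)) })
            (Adjacent-sym (graph X) e′)))))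

-- What the condensation knows of a vertex of `X`: a placeholder (`nothing`), a survivor (`inj₁`),
-- or removed with a given root (`inj₂`). The vertices named are images under `f`, so that the
-- labels of two condensations become comparable.
Label : ℕ → Set
Label n = Maybe (Fin n ⊎ Fin n)

_≟ᴸ_ : DecidableEquality (Label n)
_≟ᴸ_ = Maybe.≡-dec (Sum.≡-dec Fin._≟_ Fin._≟_)

module _ {X : Coloured n k} {Y : Coloured n (2 + k)} (C : Condenses i j X Y) (f : Fin n → Fin n) where
  open Condenses C

  label : Fin n → Label n
  label v with root v
  ... | just u  = just (inj₂ (f u))
  ... | nothing with colour X v
  ...   | dead  = nothing
  ...   | suc _ = just (inj₁ (f v))

  data LabelView (v : Fin n) : Label n → Set where
    gone : colour X v ≡ dead → LabelView v nothing
    stay : Alive Y v → LabelView v (just (inj₁ (f v)))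
    lost : ∀ {u} → root v ≡ just u → LabelView v (just (inj₂ (f u)))

  label-view : ∀ v → LabelView v (label v)
  label-view v with root v in r
  ... | just u  = lost r
  ... | nothing with colour X v in c
  ...   | dead  = gone c
  ...   | suc _ = stay (kept-alive r λ d → case trans (sym c) d of λ ())

  label-gone : ∀ {v} → label v ≡ nothing → colour X v ≡ dead
  label-gone {v} e with label v | label-view v
  ... | _ | gone d = d

  label-stay : ∀ {v w} → label v ≡ just (inj₁ w) → Alive Y v × f v ≡ w
  label-stay {v} e with label v | label-view v
  label-stay refl | _ | stay a = a , refl

  label-lost : ∀ {v w} → label v ≡ just (inj₂ w) → ∃ λ u → root v ≡ just u × f u ≡ w
  label-lost {v} e with label v | label-view v
  label-lost refl | _ | lost r = _ , r , refl

  gone-label : ∀ {v} → colour X v ≡ dead → label v ≡ nothing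
  gone-label {v} d with label v | label-view v
  ... | _ | gone _ = refl
  ... | _ | stay a = contradiction d (alive-alive a)
  ... | _ | lost r = case trans (sym d) (proj₂ (killed r)) of λ ()

  stay-label : ∀ {v} → Alive Y v → label v ≡ just (inj₁ (f v))
  stay-label {v} a with label v | label-view v
  ... | _ | gone d = contradiction d (alive-alive a)
  ... | _ | stay _ = refl
  ... | _ | lost r = contradiction (proj₁ (killed r)) a

  lost-label : ∀ {v u} → root v ≡ just u → label v ≡ just (inj₂ (f u))
  lost-label {v} r with label v | label-view v
  ... | _ | gone d = case trans (sym d) (proj₂ (killed r)) of λ ()
  ... | _ | stay a = contradiction (proj₁ (killed r)) a
  ... | _ | lost s = cong (just ∘ inj₂ ∘ f) (Maybe.just-injective (trans (sym s) r))

count-gone : {X : Coloured n k} {Y : Coloured n (2 + k)} (C : Condenses i j X Y) (f : Fin n → Fin n) →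
  count (λ v → label C f v ≟ᴸ nothing) ≡ count (λ v → colour X v Fin.≟ dead)
count-gone {X = X} C f = count-cong (λ v → label C f v ≟ᴸ nothing) (λ v → colour X v Fin.≟ dead)
  (λ _ → label-gone C f) (λ _ → gone-label C f)

module _ {X : Coloured n k} {Y : Coloured n (2 + k)} (C : Condenses i j X Y) (π : Permutation′ n) where

  count-stay : ∀ w → count (λ v → label C (π ⟨$⟩ʳ_) v ≟ᴸ just (inj₁ (π ⟨$⟩ʳ w))) ≡
      ind (¬? (colour Y w Fin.≟ dead))
  count-stay w = trans
    (sum-single (λ v → ind (label C (π ⟨$⟩ʳ_) v ≟ᴸ just (inj₁ (π ⟨$⟩ʳ w)))) w
      λ v v≢w → ind-no (label C (π ⟨$⟩ʳ_) v ≟ᴸ just (inj₁ (π ⟨$⟩ʳ w))) λ e → v≢w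
        (trans (sym (inverseˡ π)) (trans (cong (π ⟨$⟩ˡ_) (proj₂ (label-stay C _ e))) (inverseˡ π))))
    (ind-cong (label C (π ⟨$⟩ʳ_) w ≟ᴸ just (inj₁ (π ⟨$⟩ʳ w))) (¬? (colour Y w Fin.≟ dead))
      (λ e → proj₁ (label-stay C _ e)) (stay-label C _))

  count-lost : ∀ w → count (λ v → label C (π ⟨$⟩ʳ_) v ≟ᴸ just (inj₂ (π ⟨$⟩ʳ w))) ≡ demand i j (colour Y w)
  count-lost w = trans
    (count-cong (λ v → label C (π ⟨$⟩ʳ_) v ≟ᴸ just (inj₂ (π ⟨$⟩ʳ w))) (λ v → root v ≟ᴹ just w)
      (λ v e → let u , r , πu≡πw = label-lost C _ e in trans r (cong just
        (trans (sym (inverseˡ π)) (trans (cong (π ⟨$⟩ˡ_) πu≡πw) (inverseˡ π)))))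
      (λ v → lost-label C _))
    (sizes w)
    where open Condenses C

-- Survivors must follow `π`, and removed vertices must go to removed vertices with corresponding
-- roots. Such a bijection exists because all label fibres have equal sizes, and `match-adjacent` in
-- both directions makes it an isomorphism.
expansion-unique : {X X′ : Coloured n k} {Y Y′ : Coloured n (2 + k)} →
  Condenses i j X Y → Condenses i j X′ Y′ → Valid X → Valid X′ →
  content X ≡ content X′ → Y ≃ Y′ → X ≃ X′
expansion-unique {n} {X = X} {X′} {Y} {Y′} C C′ X-ok X′-ok content≡ (π , adj≡ , col≡) =
  σ , (λ u v → T-ext (forth u v) (back u v)) , λ v → same-colour v
  where
  ℓ  = label C (π ⟨$⟩ʳ_)
  ℓ′ = label C′ (Perm.id ⟨$⟩ʳ_)

  equal-fibres : ∀ a → count (λ v → ℓ v ≟ᴸ a) ≡ count (λ v → ℓ′ v ≟ᴸ a)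
  -- `Y` does not determine how many of its dead vertices were dead in `X`; the first entry of the
  -- content supplies this number.
  equal-fibres nothing = trans (count-gone C (π ⟨$⟩ʳ_))
    (trans (cong Vec.head content≡) (sym (count-gone C′ (Perm.id ⟨$⟩ʳ_))))
  equal-fibres (just (inj₁ w′)) = subst (λ w′ → count (λ v → ℓ v ≟ᴸ just (inj₁ w′)) ≡
      count (λ v → ℓ′ v ≟ᴸ just (inj₁ w′)))
    (inverseʳ π) (trans (count-stay C π w) (trans
      (cong (λ c → ind (¬? (c Fin.≟ dead))) (col≡ w)) (sym (count-stay C′ Perm.id (π ⟨$⟩ʳ w)))))
    where w = π ⟨$⟩ˡ w′
  equal-fibres (just (inj₂ w′)) = subst (λ w′ → count (λ v → ℓ v ≟ᴸ just (inj₂ w′)) ≡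
      count (λ v → ℓ′ v ≟ᴸ just (inj₂ w′)))
    (inverseʳ π) (trans (count-lost C π w) (trans
      (cong (demand _ _) (col≡ w)) (sym (count-lost C′ Perm.id (π ⟨$⟩ʳ w)))))
    where w = π ⟨$⟩ˡ w′

  σ : Permutation′ n
  σ = proj₁ (matching _≟ᴸ_ ℓ ℓ′ equal-fibres)

  ℓ-σ : ∀ v → ℓ′ (σ ⟨$⟩ʳ v) ≡ ℓ v
  ℓ-σ = proj₂ (matching _≟ᴸ_ ℓ ℓ′ equal-fibres)

  σ-injective : ∀ {u v} → σ ⟨$⟩ʳ u ≡ σ ⟨$⟩ʳ v → u ≡ v
  σ-injective e = trans (sym (inverseˡ σ)) (trans (cong (σ ⟨$⟩ˡ_) e) (inverseˡ σ))

  data Related (v v′ : Fin n) : Set where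
    gone : colour X v ≡ dead → colour X′ v′ ≡ dead → Related v v′
    stay : Alive Y v → v′ ≡ π ⟨$⟩ʳ v → Related v v′
    lost : ∀ {u} → Condenses.root C v ≡ just u → Condenses.root C′ v′ ≡ just (π ⟨$⟩ʳ u) → Related v v′

  related : ∀ v → Related v (σ ⟨$⟩ʳ v)
  related v with ℓ v | label-view C (π ⟨$⟩ʳ_) v | ℓ-σ v
  ... | _ | gone d | e = gone d (label-gone C′ _ e)
  ... | _ | stay a | e = stay a (proj₂ (label-stay C′ _ e))
  ... | _ | lost r | e with label-lost C′ _ e
  ...   | u , r′ , refl = lost r r′

  same-colour : ∀ v → colour X v ≡ colour X′ (σ ⟨$⟩ʳ v)
  same-colour v with σ ⟨$⟩ʳ v | related v
  ... | _ | gone d d′ = trans d (sym d′)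
  ... | _ | lost r r′ = trans (proj₂ (Condenses.killed C r)) (sym (proj₂ (Condenses.killed C′ r′)))
  ... | _ | stay a refl = trans (sym (Condenses.kept C (Condenses.alive-kept C a)))
    (trans (cong unmark (col≡ v)) (Condenses.kept C′ (Condenses.alive-kept C′ (a ∘ trans (col≡ v)))))

  forth : ∀ u v → Adjacent (graph X) u v → Adjacent (graph X′) (σ ⟨$⟩ʳ u) (σ ⟨$⟩ʳ v)
  forth u v e = match-adjacent C C′ X-ok (π ⟨$⟩ʳ_) (λ {u} {v} → subst T (adj≡ u v)) col≡ (match u) (match v)
    (λ σu≡σv → Adjacent-irrefl (graph X) (subst (Adjacent (graph X) u) (sym (σ-injective σu≡σv)) e)) e
    where
    match : ∀ v → Match C C′ X-ok (π ⟨$⟩ʳ_) (λ {u} {v} → subst T (adj≡ u v)) col≡ v (σ ⟨$⟩ʳ v)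
    match v with σ ⟨$⟩ʳ v | related v
    ... | _ | gone d _ = both-dead d
    ... | _ | stay a e = both-kept a e
    ... | _ | lost r s = both-killed r s

  back : ∀ u v → Adjacent (graph X′) (σ ⟨$⟩ʳ u) (σ ⟨$⟩ʳ v) → Adjacent (graph X) u v
  back u v e = match-adjacent C′ C X′-ok (π ⟨$⟩ˡ_) adj-π col-π (match u) (match v)
    (λ { refl → Adjacent-irrefl (graph X′) e }) e
    where
    adj-π : ∀ {u v} → Adjacent (graph Y′) u v → Adjacent (graph Y) (π ⟨$⟩ˡ u) (π ⟨$⟩ˡ v)
    adj-π {u} {v} = subst T (sym (trans (adj≡ _ _) (cong₂ (adj (graph Y′)) (inverseʳ π) (inverseʳ π))))
    col-π : ∀ v → colour Y′ v ≡ colour Y (π ⟨$⟩ˡ v)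
    col-π v = sym (trans (col≡ _) (cong (colour Y′) (inverseʳ π)))
    match : ∀ v → Match C′ C X′-ok (π ⟨$⟩ˡ_) adj-π col-π (σ ⟨$⟩ʳ v) v
    match v with σ ⟨$⟩ʳ v | related v
    ... | _ | gone _ d′ = both-dead d′
    ... | _ | stay a refl = both-kept (a ∘ trans (col≡ v)) (sym (inverseˡ π))
    ... | _ | lost r r′ = both-killed r′ (trans r (cong just (sym (inverseˡ π))))

-- Vertex counts in a condensation

demand-sum : {Q : Pred (Fin n) 0ℓ} (Q? : Decidable Q) (g : Fin n → Fin (4 + k)) →
  sum (λ u → ind (Q? u) * demand i j (g u)) ≡
  i * count (λ u → Q? u ×-dec (g u Fin.≟ twin)) + j * count (λ u → Q? u ×-dec (g u Fin.≟ tuft))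
demand-sum {i = i} {j} Q? g = trans
  (trans (sum-cong-≗ pointwise) (∑-distrib-+ (λ u → i * twins u) (λ u → j * tufts u)))
  (sym (cong₂ _+_ (*-distribˡ-sum i twins) (*-distribˡ-sum j tufts)))
  where
  twins = λ u → ind (Q? u ×-dec (g u Fin.≟ twin))
  tufts = λ u → ind (Q? u ×-dec (g u Fin.≟ tuft))

  by-colour : ∀ b c → (if b then 1 else 0) * demand i j c ≡
    i * (if b ∧ does (c Fin.≟ twin) then 1 else 0) + j * (if b ∧ does (c Fin.≟ tuft) then 1 else 0)
  by-colour false c        = sym (cong₂ _+_ (*-zeroʳ i) (*-zeroʳ j))
  by-colour true dead      = sym (cong₂ _+_ (*-zeroʳ i) (*-zeroʳ j))
  by-colour true plain     = sym (cong₂ _+_ (*-zeroʳ i) (*-zeroʳ j))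
  by-colour true twin      = trans (+-identityʳ i)
      (sym (trans (cong₂ _+_ (*-identityʳ i) (*-zeroʳ j)) (+-identityʳ i)))
  by-colour true tuft      = trans (+-identityʳ j) (sym (cong₂ _+_ (*-zeroʳ i) (*-identityʳ j)))
  by-colour true (inert c) = sym (cong₂ _+_ (*-zeroʳ i) (*-zeroʳ j))

  pointwise : ∀ u → ind (Q? u) * demand i j (g u) ≡ i * twins u + j * tufts u
  pointwise u = by-colour (does (Q? u)) (g u)

module _ {X : Coloured n k} {Y : Coloured n (2 + k)} (C : Condenses i j X Y) where
  open Condenses C

  count-killed-blocks : {P Q : Pred (Fin n) 0ℓ} (P? : Decidable P) (Q? : Decidable Q) →
    (∀ {v u} → root v ≡ just u → P v → Q u) → (∀ {v u} → root v ≡ just u → Q u → P v) →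
    count (λ v → P? v ×-dec killed? root v) ≡
    i * count (λ u → Q? u ×-dec (colour Y u Fin.≟ twin)) + j * count
        (λ u → Q? u ×-dec (colour Y u Fin.≟ tuft))
  count-killed-blocks P? Q? f g = trans (count-killed root P? Q? f g) (trans
    (sum-cong-≗ λ u → cong (ind (Q? u) *_) (sizes u)) (demand-sum Q? (colour Y)))

  kept-colour : ∀ {v c} → colour Y v ≡ suc c → colour X v ≡ unmark (suc c)
  kept-colour e = trans (sym (kept (alive-kept λ d → case trans (sym e) d of λ ()))) (cong unmark e)

  module _ {P : Pred (Fin n) 0ℓ} (P? : Decidable P) where

    countPlain countTwin countTuft countKilled : ℕ
    countPlain  = count λ v → P? v ×-dec (colour Y v Fin.≟ plain)
    countTwin   = count λ v → P? v ×-dec (colour Y v Fin.≟ twin)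
    countTuft   = count λ v → P? v ×-dec (colour Y v Fin.≟ tuft)
    countKilled = count λ v → P? v ×-dec killed? root v

    -- With `split-plain` and `split-inert` this balances the colours inside an arbitrary set `P`.
    -- The balance is applied to all vertices for the contents, and to single classes for the
    -- uniqueness of condensations.
    split-dead : count (λ v → P? v ×-dec (colour Y v Fin.≟ dead)) ≡
                 count (λ v → P? v ×-dec (colour X v Fin.≟ dead)) + countKilled
    split-dead = count-⊎ (λ v → P? v ×-dec (colour Y v Fin.≟ dead)) (λ v → P? v ×-dec (colour X v Fin.≟ dead))
      (λ v → P? v ×-dec killed? root v)
      (λ v (p , d) → case killed? root v of λ
        { (yes κ) → inj₂ (p , κ)
        ; (no ¬κ) → inj₁ (p , trans (sym (kept (not-just v ¬κ))) (cong unmark d)) })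
      (λ v (p , d) → p , unmark-dead (trans (kept
          (not-just v λ (_ , r) → case trans (sym d) (proj₂ (killed r)) of λ ())) d))
      (λ v (p , _ , r) → p , proj₁ (killed r))
      (λ v (_ , d) (_ , _ , r) → case trans (sym d) (proj₂ (killed r)) of λ ())
      where
      not-just : ∀ v → ¬ Killed root v → root v ≡ nothing
      not-just v ¬κ with root v
      ... | nothing = refl
      ... | just u  = contradiction (u , refl) ¬κ

    split-plain : count (λ v → P? v ×-dec plain? X v) ≡ countPlain + (countTwin + (countTuft + countKilled))
    split-plain = trans
      (count-⊎ (λ v → P? v ×-dec plain? X v) (λ v → P? v ×-dec (colour Y v Fin.≟ plain)) R₁?
        (λ v (p , c) → split₁ v p c)
        (λ v (p , c) → p , kept-colour c) r₁
        (λ { v (_ , c) (inj₁ (_ , c′)) → case trans (sym c) c′ of λ ()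
           ; v (_ , c) (inj₂ (inj₁ (_ , c′))) → case trans (sym c) c′ of λ ()
           ; v (_ , c) (inj₂ (inj₂ (_ , _ , r))) → case trans (sym c) (proj₁ (killed r)) of λ () }))
      (cong (countPlain +_) (trans
        (count-⊎ R₁? (λ v → P? v ×-dec (colour Y v Fin.≟ twin)) R₂?
          (λ _ → id) (λ _ → inj₁) (λ _ → inj₂)
          (λ { v (_ , c) (inj₁ (_ , c′)) → case trans (sym c) c′ of λ ()
             ; v (_ , c) (inj₂ (_ , _ , r)) → case trans (sym c) (proj₁ (killed r)) of λ () }))
        (cong (countTwin +_)
          (count-⊎ R₂? (λ v → P? v ×-dec (colour Y v Fin.≟ tuft)) (λ v → P? v ×-dec killed? root v)
            (λ _ → id) (λ _ → inj₁) (λ _ → inj₂)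
            (λ { v (_ , c) (_ , _ , r) → case trans (sym c) (proj₁ (killed r)) of λ () })))))
      where
      R₂? = λ v → (P? v ×-dec (colour Y v Fin.≟ tuft)) ⊎-dec (P? v ×-dec killed? root v)
      R₁? = λ v → (P? v ×-dec (colour Y v Fin.≟ twin)) ⊎-dec R₂? v

      split₁ : ∀ v → P v → Plain X v → (P v × colour Y v ≡ plain) ⊎ ((P v × colour Y v ≡ twin) ⊎
                     ((P v × colour Y v ≡ tuft) ⊎ (P v × Killed root v)))
      split₁ v p c with root v in r
      ... | just u = inj₂ (inj₂ (inj₂ (p , u , refl)))
      ... | nothing with colour Y v | kept r
      ...   | dead    | e = case trans e c of λ ()
      ...   | plain   | e = inj₁ (p , refl)
      ...   | twin    | e = inj₂ (inj₁ (p , refl))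
      ...   | tuft    | e = inj₂ (inj₂ (inj₁ (p , refl)))
      ...   | inert _ | e = case trans e c of λ ()

      r₁ : ∀ v → (P v × colour Y v ≡ twin) ⊎ ((P v × colour Y v ≡ tuft) ⊎ (P v × Killed root v)) →
           P v × Plain X v
      r₁ v (inj₁ (p , c)) = p , kept-colour c
      r₁ v (inj₂ (inj₁ (p , c))) = p , kept-colour c
      r₁ v (inj₂ (inj₂ (p , _ , r))) = p , proj₂ (killed r)

    split-inert : ∀ c → count (λ v → P? v ×-dec (colour Y v Fin.≟ inert c)) ≡
                        count (λ v → P? v ×-dec (colour X v Fin.≟ suc (suc c)))
    split-inert c = count-cong (λ v → P? v ×-dec (colour Y v Fin.≟ inert c))
        (λ v → P? v ×-dec (colour X v Fin.≟ suc (suc c)))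
      (λ v (p , e) → p , kept-colour e) (λ v (p , e) → p , inert⁻ v e)
      where
      inert⁻ : ∀ v → colour X v ≡ suc (suc c) → colour Y v ≡ inert c
      inert⁻ v e with root v in r
      ... | just u = case trans (sym e) (proj₂ (killed r)) of λ ()
      ... | nothing with colour Y v | kept r
      ...   | dead    | e′ = case trans e′ e of λ ()
      ...   | plain   | e′ = case trans e′ e of λ ()
      ...   | twin    | e′ = case trans e′ e of λ ()
      ...   | tuft    | e′ = case trans e′ e of λ ()
      ...   | inert d | e′ with trans e′ e
      ...     | refl = refl

-- The subtraction is only meaningful if there are enough dead vertices, which is
-- part of markedContents below.
expandContent : ℕ → ℕ → Vec ℕ (4 + k) → Vec ℕ (2 + k)
expandContent i j (d ∷ p ∷ s ∷ t ∷ cs) = (d ∸ (i * s + j * t)) ∷ (p + (s + (t + (i * s + j * t)))) ∷ cs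

module _ {X : Coloured n k} {Y : Coloured n (2 + k)} (C : Condenses i j X Y) where

  private
    any : Decidable {A = Fin n} (λ _ → ⊤)
    any _ = yes tt

    killed≡ : countKilled C any ≡ i * countTwin C any + j * countTuft C any
    killed≡ = count-killed-blocks C any any (λ _ _ → tt) (λ _ _ → tt)

    deadX = count (λ v → colour X v Fin.≟ dead)

  enough-dead : i * count (λ v → colour Y v Fin.≟ twin) + j * count (λ v → colour Y v Fin.≟ tuft)
                ≤ count (λ v → colour Y v Fin.≟ dead)
  enough-dead = ≤-trans (m≤n+m _ deadX) (≤-reflexive
      (sym (trans (split-dead C any) (cong (deadX +_) killed≡))))

  content-condenses : content X ≡ expandContent i j (content Y)
  content-condenses = cong₂ _∷_
    (sym (trans (cong₂ _∸_ (split-dead C any) (sym killed≡)) (m+n∸n≡m deadX (countKilled C any))))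
    (cong₂ _∷_
      (trans (split-plain C any) (cong (λ x → countPlain C any +
          (countTwin C any + (countTuft C any + x))) killed≡))
      (tabulate-cong λ c → sym (split-inert C any c)))

-- Uniqueness of condensations

remainder-< : ∀ {r r′ m m′} → r ≤ i → m < m′ → r + suc i * m < r′ + suc i * m′
remainder-< {i} {r} {r′} {m} {m′} r≤i m<m′ = begin-strict
  r + suc i * m      <⟨ +-monoˡ-< (suc i * m) (s≤s r≤i) ⟩
  suc i + suc i * m  ≡⟨ *-suc (suc i) m ⟨
  suc i * suc m      ≤⟨ *-monoʳ-≤ (suc i) m<m′ ⟩
  suc i * m′         ≤⟨ m≤n+m _ r′ ⟩
  r′ + suc i * m′    ∎
  where open ≤-Reasoning

-- A class of r + (1 + i) m plain siblings has m blocks and r ≤ i survivors.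
quotient-unique : ∀ {r r′ m m′} → r ≤ i → r′ ≤ i → r + suc i * m ≡ r′ + suc i * m′ → m ≡ m′
quotient-unique {r = r} {r′} {m} {m′} r≤i r′≤i e with ℕ.<-cmp m m′
... | tri≈ _ m≡m′ _ = m≡m′
... | tri< m<m′ _ _ = contradiction e (<⇒≢ (remainder-< {r = r} {r′} r≤i m<m′))
... | tri> _ _ m′<m = contradiction (sym e) (<⇒≢ (remainder-< {r = r′} {r} r′≤i m′<m))

-- Excludes K₂, whose two vertices are at once siblings and leaves of each other.
ThirdVertex : Coloured n k → Set
ThirdVertex X = ∀ u v → Plain X u → Plain X v → ∃ λ x → Alive X x × x ≢ u × x ≢ v

module _ {X : Coloured n k} (X-ok : Valid X) (third : ThirdVertex X) where

  private
    G = graph X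

  plain-alive : ∀ {v} → Plain X v → Alive X v
  plain-alive p d = case trans (sym p) d of λ ()

  -- A walk from `u` to the third vertex could never leave the two endpoints.
  no-isolated-edge : ∀ {u v} → Plain X u → Plain X v → LeafAt G u v → LeafAt G v u → ⊥
  no-isolated-edge {u} {v} pu pv (_ , only-u) (_ , only-v) with third u v pu pv
  ... | x , ax , x≢u , x≢v = stuck (inj₁ refl) (connected X-ok u x (plain-alive pu) ax)
    where
    stuck : ∀ {w} → w ≡ u ⊎ w ≡ v → Star (Adjacent G) w x → ⊥
    stuck (inj₁ refl) ε       = x≢u refl
    stuck (inj₂ refl) ε       = x≢v refl
    stuck (inj₁ refl) (e ◅ p) = stuck (inj₂ (only-v _ e)) p
    stuck (inj₂ refl) (e ◅ p) = stuck (inj₁ (only-u _ e)) p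

  -- A sibling `w` of `v` is near the leaf `ℓ`, so it is `v` or `ℓ`. In the latter case `v` and `ℓ`
  -- have the closed neighbourhood of an isolated edge. Together with `leaf-sibling` this keeps twin
  -- blocks away from tuft blocks.
  centre-sibling : ∀ {v ℓ w} → Plain X v → Plain X ℓ → LeafAt G v ℓ → Sibling G v w → w ≡ v
  centre-sibling {v} {ℓ} {w} pv pℓ leaf@(e , only) s with sibling⁻ G s (inj₂ e)
  ... | inj₂ e′   = only w (Adjacent-sym G e′)
  ... | inj₁ refl = ⊥-elim (no-isolated-edge pv pℓ leaf (Adjacent-sym G e , only′))
    where
    only′ : ∀ z → Adjacent G v z → z ≡ ℓ
    only′ z a with sibling⁻ G s (inj₂ a)
    ... | inj₁ z≡ℓ = z≡ℓ
    ... | inj₂ a′  = ⊥-elim (Adjacent-irrefl G (subst (Adjacent G v) (only z a′) a))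

  leaf-sibling : ∀ {v ℓ w} → Plain X v → Plain X ℓ → LeafAt G v ℓ → Sibling G ℓ w → w ≡ ℓ
  leaf-sibling {v} {ℓ} {w} pv pℓ leaf@(e , only) s with sibling⁻ G (sym s) (inj₁ refl)
  ... | inj₁ w≡ℓ = w≡ℓ
  ... | inj₂ e′ with only w e′
  ...   | refl = sym (centre-sibling pv pℓ leaf (sym s))

  -- Only the leaves that a tuft can absorb: the centre has to be plain too. A leaf at a marked or
  -- inert centre is classified by its closed neighbourhood like any other vertex.
  IsLeaf : Fin n → Set
  IsLeaf v = Plain X v × ∃ λ u → Plain X u × LeafAt G u v

  isLeaf? : Decidable IsLeaf
  isLeaf? v = plain? X v ×-dec Fin.any? λ u → plain? X u ×-dec leafAt? G u v

  -- Two vertices with the same class can be exchanged by an automorphism.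
  class : Fin n → Bool × Vec Bool n
  class v with isLeaf? v
  ... | yes _ = true , N G v
  ... | no _  = false , N[ G ] v

  data ClassView (v : Fin n) : Bool × Vec Bool n → Set where
    is-leaf  : IsLeaf v → ClassView v (true , N G v)
    not-leaf : ¬ IsLeaf v → ClassView v (false , N[ G ] v)

  class-view : ∀ v → ClassView v (class v)
  class-view v with isLeaf? v
  ... | yes l = is-leaf l
  ... | no ¬l = not-leaf ¬l

  leaf-class : ∀ {v} → IsLeaf v → class v ≡ (true , N G v)
  leaf-class {v} l with class v | class-view v
  ... | _ | is-leaf _     = refl
  ... | _ | not-leaf ¬l = contradiction l ¬l

  nonleaf-class : ∀ {v} → ¬ IsLeaf v → class v ≡ (false , N[ G ] v)
  nonleaf-class {v} ¬l with class v | class-view v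
  ... | _ | is-leaf l    = contradiction l ¬l
  ... | _ | not-leaf _ = refl

  N⁻ : ∀ {u v} → N G u ≡ N G v → ∀ {w} → Adjacent G u w → Adjacent G v w
  N⁻ {u} {v} e {w} = subst T (trans (sym (lookup∘tabulate _ w))
    (trans (cong (λ S → Vec.lookup S w) e) (lookup∘tabulate _ w)))

  data SameClass (u v : Fin n) : Set where
    leaves    : IsLeaf u → IsLeaf v → N G u ≡ N G v → SameClass u v
    nonleaves : ¬ IsLeaf u → ¬ IsLeaf v → Sibling G u v → SameClass u v

  same-class : ∀ {u v} → class u ≡ class v → SameClass u v
  same-class {u} {v} e with class u | class-view u | class v | class-view v
  ... | _ | is-leaf l     | _ | is-leaf l′     = leaves l l′ (cong proj₂ e)
  ... | _ | not-leaf l  | _ | not-leaf l′  = nonleaves l l′ (cong proj₂ e)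
  ... | _ | is-leaf _     | _ | not-leaf _   = case cong proj₁ e of λ ()
  ... | _ | not-leaf _  | _ | is-leaf _      = case cong proj₁ e of λ ()

  -- The endpoints are replaced one after the other. Leaves of a class share their neighbours,
  -- nonleaves their closed neighbourhoods. The replacement of `u` can coincide with `v` only if
  -- both are nonleaves, and then all four vertices are siblings of each other.
  exchange : ∀ {u u′ v v′} → class u ≡ class u′ → class v ≡ class v′ → u ≢ v → u′ ≢ v′ →
             Adjacent G u v → Adjacent G u′ v′
  exchange {u} {u′} {v} {v′} cu cv u≢v u′≢v′ e with same-class cu | same-class cv
  ... | leaves _ _ s    | leaves _ _ t     = Adjacent-sym G (N⁻ t (Adjacent-sym G (N⁻ s e)))
  ... | leaves l l′ s   | nonleaves nl nl′ t = near-adjacent (sibling⁻ G t (inj₂ (Adjacent-sym G (N⁻ s e))))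
    where
    near-adjacent : Near G v′ u′ → Adjacent G u′ v′
    near-adjacent (inj₁ p) = contradiction p u′≢v′
    near-adjacent (inj₂ a) = Adjacent-sym G a
  ... | nonleaves nl nl′ s | leaves l l′ t with sibling⁻ G s (inj₂ e)
  ...   | inj₁ refl = contradiction l nl′
  ...   | inj₂ a    = Adjacent-sym G (N⁻ t (Adjacent-sym G a))
  exchange {u} {u′} {v} {v′} cu cv u≢v u′≢v′ e | nonleaves nl nl′ s | nonleaves ml ml′ t
    with sibling⁻ G s (inj₂ e)
  ...   | inj₁ refl = near-adjacent (sibling⁻ G t (inj₁ refl))
    where
    near-adjacent : Near G v′ u′ → Adjacent G u′ v′
    near-adjacent (inj₁ p) = contradiction p u′≢v′
    near-adjacent (inj₂ a) = Adjacent-sym G a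
  ...   | inj₂ a with sibling⁻ G t (inj₂ (Adjacent-sym G a))
  ...     | inj₁ p = contradiction p u′≢v′
  ...     | inj₂ b = Adjacent-sym G b

  module Structure {i j} (1≤i : 1 ≤ i) (1≤j : 1 ≤ j) {Y : Coloured n (2 + k)}
           (C : Condenses i j X Y) where
    open Condenses C

    -- Uses `1 ≤ i`: a twin that replaces nothing but itself would leave no trace in `X`, and the
    -- marks could not be recovered.
    twin-killed : ∀ {u} → colour Y u ≡ twin → ∃ λ w → root w ≡ just u × Sibling G w u
    twin-killed {u} c with 0<count (λ v → root v ≟ᴹ just u)
      (≤-trans 1≤i (≤-reflexive (sym (trans (sizes u) (cong (demand i j) c)))))
    ... | w , r with block r
    ...   | inj₁ (_ , s)  = w , r , s
    ...   | inj₂ (c′ , _) = case trans (sym c) c′ of λ ()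

    tuft-killed : ∀ {u} → colour Y u ≡ tuft → ∃ λ w → root w ≡ just u × LeafAt G u w
    tuft-killed {u} c with 0<count (λ v → root v ≟ᴹ just u)
      (≤-trans 1≤j (≤-reflexive (sym (trans (sizes u) (cong (demand i j) c)))))
    ... | w , r with block r
    ...   | inj₁ (c′ , _) = case trans (sym c) c′ of λ ()
    ...   | inj₂ (_ , p)  = w , r , p

    -- Having no sibling but itself, the leaf can neither be removed by a twin nor become one. As a
    -- tuft it would have its centre as a leaf, which gives an isolated edge.
    leaf-fate : ∀ {v ℓ} → Plain X v → Plain X ℓ → LeafAt G v ℓ →
                colour Y ℓ ≡ plain ⊎ (root ℓ ≡ just v × colour Y v ≡ tuft)
    leaf-fate {v} {ℓ} pv pℓ leaf with root ℓ in r
    leaf-fate {v} {ℓ} pv pℓ leaf | just u with block r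
    ... | inj₁ (_ , s) = contradiction (sym (leaf-sibling pv pℓ leaf s)) (killed≢root r)
    ... | inj₂ (c , e , _) with proj₂ leaf u (Adjacent-sym G e)
    ...   | refl = inj₂ (refl , c)
    leaf-fate {v} {ℓ} pv pℓ leaf | nothing with colour Y ℓ in c | kept r
    ... | plain   | _ = inj₁ refl
    ... | dead    | e = case trans e pℓ of λ ()
    ... | inert _ | e = case trans e pℓ of λ ()
    ... | twin    | _ with twin-killed c
    ...   | w , r′ , s = contradiction (leaf-sibling pv pℓ leaf (sym s)) (killed≢root r′)
    leaf-fate {v} {ℓ} pv pℓ leaf | nothing | tuft | _ with tuft-killed c
    ...   | w , r′ , p with proj₂ leaf w (proj₁ p)
    ...     | refl = ⊥-elim (no-isolated-edge pv pℓ leaf p)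

    centre-fate : ∀ {v ℓ} → Plain X v → Plain X ℓ → LeafAt G v ℓ →
                  colour Y v ≡ plain ⊎ colour Y v ≡ tuft
    centre-fate {v} {ℓ} pv pℓ leaf with root v in r
    centre-fate {v} {ℓ} pv pℓ leaf | just u with block r
    ... | inj₁ (_ , s) = contradiction (sym (centre-sibling pv pℓ leaf s)) (killed≢root r)
    ... | inj₂ (_ , p) with proj₂ p ℓ (proj₁ leaf)
    ...   | refl = ⊥-elim (no-isolated-edge pv pℓ leaf p)
    centre-fate {v} {ℓ} pv pℓ leaf | nothing with colour Y v in c | kept r
    ... | plain   | _ = inj₁ refl
    ... | tuft    | _ = inj₂ refl
    ... | dead    | e = case trans e pv of λ ()
    ... | inert _ | e = case trans e pv of λ ()
    ... | twin    | _ with twin-killed c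
    ...   | w , r′ , s = contradiction (centre-sibling pv pℓ leaf (sym s)) (killed≢root r′)

    tuft⇒many-leaves : ∀ {v} → colour Y v ≡ tuft → Plain X v × j ≤ plainLeaves X v
    tuft⇒many-leaves {v} c =
      trans (sym (kept (alive-kept λ d → case trans (sym c) d of λ ()))) (cong unmark c) ,
      ≤-trans (≤-reflexive (sym (trans (sizes v) (cong (demand i j) c))))
        (count-mono (λ w → root w ≟ᴹ just v) (λ u → plain? X u ×-dec leafAt? G v u) λ w r →
          proj₂ (killed r) , [ (λ { (c′ , _) → case trans (sym c) c′ of λ () }) , proj₂ ]′ (block r))

    -- If `v` stayed plain, none of its plain leaves could have been removed or marked, so `Y` would
    -- still have `j` plain leaves at `v` and not be good. With `tuft⇒many-leaves` this
    -- characterises the tufts by `X` alone.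
    many-leaves⇒tuft : Good i j Y → ∀ {v} → Plain X v → j ≤ plainLeaves X v → colour Y v ≡ tuft
    many-leaves⇒tuft good {v} pv j≤ with 0<count (λ u → plain? X u ×-dec leafAt? G v u) (≤-trans 1≤j j≤)
    ... | ℓ , pℓ , leaf with centre-fate pv pℓ leaf
    ...   | inj₂ c = c
    ...   | inj₁ c = contradiction (≤-trans j≤ (count-mono
            (λ u → plain? X u ×-dec leafAt? G v u) (λ u → plain? Y u ×-dec leafAt? (graph Y) v u)
            λ u (pu , leaf′) → stays u pu leaf′)) (<⇒≱ (proj₂ (good v c)))
      where
      stays : ∀ u → Plain X u → LeafAt G v u → Plain Y u × LeafAt (graph Y) v u
      stays u pu leaf′ with leaf-fate pv pu leaf′
      ... | inj₂ (_ , c′) = case trans (sym c) c′ of λ ()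
      ... | inj₁ c′ = c′ , leafAt-restrict (λ d → case trans (sym c) d of λ ())
          (λ d → case trans (sym c′) d of λ ()) leaf′

    _≟ᶜ_ : DecidableEquality (Bool × Vec Bool n)
    _≟ᶜ_ = Product.≡-dec Bool._≟_ (≡-dec Bool._≟_)

    inClass? : ∀ a → Decidable (λ v → class v ≡ a)
    inClass? a v = class v ≟ᶜ a

    module LeafClass {u₀ v₀} (pu : Plain X u₀) (pv : Plain X v₀) (leaf₀ : LeafAt G u₀ v₀) where

      members : ∀ {v} → class v ≡ class v₀ → IsLeaf v × N G v ≡ N G v₀
      members e with same-class e
      ... | leaves l _ s      = l , s
      ... | nonleaves _ ¬l _  = contradiction (pv , u₀ , pu , leaf₀) ¬l

      plain-or-dead : ∀ {v} → class v ≡ class v₀ → colour Y v ≡ plain ⊎ colour Y v ≡ dead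
      plain-or-dead e with members e
      ... | (pv , u , pu , l) , _ with leaf-fate pu pv l
      ...   | inj₁ c       = inj₁ c
      ...   | inj₂ (r , _) = inj₂ (proj₁ (killed r))

      no-twins : countTwin C (inClass? (class v₀)) ≡ 0
      no-twins = count-none (λ v → inClass? (class v₀) v ×-dec (colour Y v Fin.≟ twin)) λ v (e , c) →
        [ (λ c′ → case trans (sym c) c′ of λ ()) , (λ c′ → case trans (sym c) c′ of λ ()) ]′ (plain-or-dead e)

      no-tufts : countTuft C (inClass? (class v₀)) ≡ 0
      no-tufts = count-none (λ v → inClass? (class v₀) v ×-dec (colour Y v Fin.≟ tuft)) λ v (e , c) →
        [ (λ c′ → case trans (sym c) c′ of λ ()) , (λ c′ → case trans (sym c) c′ of λ ()) ]′ (plain-or-dead e)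

      -- Every removed leaf at `u₀` lies in the block of `u₀`, and everything in that block is a
      -- leaf at `u₀`. The remaining count is 1 or 0 according to whether `u₀` is a tuft.
      killed-leaves : countKilled C (inClass? (class v₀)) ≡
                      j * count (λ u → (u Fin.≟ u₀) ×-dec (colour Y u Fin.≟ tuft))
      killed-leaves = trans
        (count-killed-blocks C (inClass? (class v₀)) (λ u → u Fin.≟ u₀) to from)
        (cong (_+ j * count (λ u → (u Fin.≟ u₀) ×-dec (colour Y u Fin.≟ tuft)))
          (trans (cong (i *_) (count-none (λ u → (u Fin.≟ u₀) ×-dec (colour Y u Fin.≟ twin)) u₀-not-twin))
              (*-zeroʳ i)))
        where
        u₀-not-twin : ∀ u → ¬ (u ≡ u₀ × colour Y u ≡ twin)
        u₀-not-twin u (refl , c) with centre-fate pu pv leaf₀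
        ... | inj₁ c′ = case trans (sym c) c′ of λ ()
        ... | inj₂ c′ = case trans (sym c) c′ of λ ()

        to : ∀ {v u} → root v ≡ just u → class v ≡ class v₀ → u ≡ u₀
        to r e = proj₂ leaf₀ _ (N⁻ (proj₂ (members e)) (Adjacent-sym G (root-adjacent r)))

        from : ∀ {v u} → root v ≡ just u → u ≡ u₀ → class v ≡ class v₀
        from {v} r refl with block r
        ... | inj₁ (_ , s) = contradiction (centre-sibling pu pv leaf₀ (sym s)) (killed≢root r)
        ... | inj₂ (_ , l) = trans (leaf-class (proj₂ (killed r) , u₀ , pu , l))
          (trans (cong (true ,_) (tabulate-cong λ w → T-ext
            (λ a → subst (Adjacent G v₀) (sym (proj₂ l w a)) (Adjacent-sym G (proj₁ leaf₀)))
            (λ a → subst (Adjacent G v) (sym (proj₂ leaf₀ w a)) (Adjacent-sym G (proj₁ l)))))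
          (sym (leaf-class (pv , u₀ , pu , leaf₀))))

    sibling-nonleaf : ∀ {v u} → Sibling G v u → v ≢ u → ¬ IsLeaf v
    sibling-nonleaf s v≢u (pv , w , pw , l) = v≢u (sym (leaf-sibling pw pv l s))

    -- Without tufts, blocks that meet the class are twin blocks contained in it. Classes with a
    -- tuft are singletons and are left to `tuft-census`.
    module NonleafClass {v₀} (¬leaf₀ : ¬ IsLeaf v₀)
           (no-tuft : ∀ v → class v ≡ class v₀ → colour Y v ≢ tuft) where

      members : ∀ {v} → class v ≡ class v₀ → ¬ IsLeaf v × Sibling G v v₀
      members e with same-class e
      ... | leaves _ l _       = contradiction l ¬leaf₀
      ... | nonleaves ¬l _ s   = ¬l , s

      no-tufts : countTuft C (inClass? (class v₀)) ≡ 0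
      no-tufts = count-none (λ v → inClass? (class v₀) v ×-dec (colour Y v Fin.≟ tuft)) λ v (e , c) →
          no-tuft v e c

      killed-siblings : countKilled C (inClass? (class v₀)) ≡ i * countTwin C (inClass? (class v₀))
      killed-siblings = trans
        (count-killed-blocks C (inClass? (class v₀)) (inClass? (class v₀)) to from)
        (trans (cong (λ x → i * countTwin C (inClass? (class v₀)) + j * x) no-tufts)
          (trans (cong (i * countTwin C (inClass? (class v₀)) +_) (*-zeroʳ j)) (+-identityʳ _)))
        where
        siblings-agree : ∀ {v u} → Sibling G v u → v ≢ u → class v ≡ class u
        siblings-agree s v≢u = trans (nonleaf-class (sibling-nonleaf s v≢u))
          (trans (cong (false ,_) s) (sym (nonleaf-class (sibling-nonleaf (sym s) (≢-sym v≢u)))))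

        to : ∀ {v u} → root v ≡ just u → class v ≡ class v₀ → class u ≡ class v₀
        to r e with block r
        ... | inj₁ (_ , s) = trans (sym (siblings-agree s (killed≢root r))) e
        ... | inj₂ (_ , l) = contradiction (proj₂ (killed r) , _ , root-plain r , l) (proj₁ (members e))

        from : ∀ {v u} → root v ≡ just u → class u ≡ class v₀ → class v ≡ class v₀
        from r e with block r
        ... | inj₁ (_ , s) = trans (siblings-agree s (killed≢root r)) e
        ... | inj₂ (c , _) = contradiction c (no-tuft _ e)

      -- The plain survivors of the class remain mutual siblings in `Y`, so goodness bounds their
      -- number. This is the bound on the remainder in `quotient-unique`.
      few-plain : Good i j Y → countPlain C (inClass? (class v₀)) ≤ i
      few-plain good with countPlain C (inClass? (class v₀)) ℕ.≟ 0
      ... | yes z = ≤-trans (≤-reflexive z) z≤n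
      ... | no ¬z with 0<count (λ v → inClass? (class v₀) v ×-dec (colour Y v Fin.≟ plain)) (n≢0⇒n>0 ¬z)
      ...   | v , e , c = ≤-trans
        (count-mono (λ u → inClass? (class v₀) u ×-dec (colour Y u Fin.≟ plain))
                    (λ u → plain? Y u ×-dec sibling? (graph Y) u v)
                    λ u (e′ , c′) → c′ , sibling-restrict
                      (λ d → case trans (sym c′) d of λ ()) (λ d → case trans (sym c) d of λ ())
                      (trans (proj₂ (members e′)) (sym (proj₂ (members e)))))
        (proj₁ (good v c))

  module Compare {i j} (1≤i : 1 ≤ i) (1≤j : 1 ≤ j) {Y Y′ : Coloured n (2 + k)}
         (C : Condenses i j X Y) (C′ : Condenses i j X Y′) (good : Good i j Y) (good′ : Good i j Y′) where
    module S  = Structure 1≤i 1≤j C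
    module S′ = Structure 1≤i 1≤j C′

    tuft→ : ∀ {v} → colour Y v ≡ tuft → colour Y′ v ≡ tuft
    tuft→ c = let p , q = S.tuft⇒many-leaves c in S′.many-leaves⇒tuft good′ p q

    tuft← : ∀ {v} → colour Y′ v ≡ tuft → colour Y v ≡ tuft
    tuft← c = let p , q = S′.tuft⇒many-leaves c in S.many-leaves⇒tuft good p q

    -- Two condensations may pick different vertices of a class, so only numbers per class and
    -- colour can be expected to agree. This is enough, because permutations that preserve classes
    -- are automorphisms of `G`.
    SameCensus : Bool × Vec Bool n → Set
    SameCensus a = ∀ c → count (λ v → S.inClass? a v ×-dec (colour Y v Fin.≟ c)) ≡
                         count (λ v → S.inClass? a v ×-dec (colour Y′ v Fin.≟ c))

    from-parts : ∀ a →
      countTwin C (S.inClass? a) ≡ countTwin C′ (S.inClass? a) →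
      countTuft C (S.inClass? a) ≡ countTuft C′ (S.inClass? a) →
      countKilled C (S.inClass? a) ≡ countKilled C′ (S.inClass? a) → SameCensus a
    from-parts a tw tu ki twin  = tw
    from-parts a tw tu ki tuft  = tu
    from-parts a tw tu ki dead  = trans (split-dead C (S.inClass? a))
      (trans (cong (_ +_) ki) (sym (split-dead C′ (S.inClass? a))))
    from-parts a tw tu ki (inert c) = trans (split-inert C (S.inClass? a) c)
        (sym (split-inert C′ (S.inClass? a) c))
    from-parts a tw tu ki plain = +-cancelʳ-≡ _ _ _ (trans
      (trans (sym (split-plain C (S.inClass? a))) (split-plain C′ (S.inClass? a)))
      (cong (countPlain C′ (S.inClass? a) +_) (sym (cong₂ _+_ tw (cong₂ _+_ tu ki)))))

    leaf-census : ∀ {u₀ v₀} → Plain X u₀ → Plain X v₀ → LeafAt G u₀ v₀ → SameCensus (class v₀)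
    leaf-census {u₀} {v₀} pu pv l = from-parts (class v₀)
      (trans L.no-twins (sym L′.no-twins))
      (trans L.no-tufts (sym L′.no-tufts))
      (trans L.killed-leaves (trans
        (cong (j *_) (count-cong (λ u → (u Fin.≟ u₀) ×-dec (colour Y u Fin.≟ tuft))
            (λ u → (u Fin.≟ u₀) ×-dec (colour Y′ u Fin.≟ tuft))
          (λ _ (e , c) → e , tuft→ c) (λ _ (e , c) → e , tuft← c)))
        (sym L′.killed-leaves)))
      where
      module L  = S.LeafClass pu pv l
      module L′ = S′.LeafClass pu pv l

    nonleaf-census : ∀ {v₀} → ¬ IsLeaf v₀ → (∀ v → class v ≡ class v₀ → colour Y v ≢ tuft) →
        SameCensus (class v₀)
    nonleaf-census {v₀} ¬l no-tuft = from-parts (class v₀) twins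
      (trans M.no-tufts (sym M′.no-tufts))
      (trans M.killed-siblings (trans (cong (i *_) twins) (sym M′.killed-siblings)))
      where
      module M  = S.NonleafClass ¬l no-tuft
      module M′ = S′.NonleafClass ¬l (λ v e → no-tuft v e ∘ tuft←)

      total : ∀ p {m t κ} → t ≡ 0 → κ ≡ i * m → p + (m + (t + κ)) ≡ p + suc i * m
      total p refl refl = refl

      twins : countTwin C (S.inClass? (class v₀)) ≡ countTwin C′ (S.inClass? (class v₀))
      twins = quotient-unique (M.few-plain good) (M′.few-plain good′)
        (trans (sym (total (countPlain C (S.inClass? (class v₀))) M.no-tufts M.killed-siblings)) (trans
          (trans (sym (split-plain C (S.inClass? (class v₀)))) (split-plain C′ (S.inClass? (class v₀))))
          (total (countPlain C′ (S.inClass? (class v₀))) M′.no-tufts M′.killed-siblings)))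

    -- The class consists of the tuft alone: its other members would be siblings of a plain centre
    -- of plain leaves.
    tuft-census : ∀ {v₀ v} → ¬ IsLeaf v₀ → class v ≡ class v₀ → colour Y v ≡ tuft → SameCensus (class v₀)
    tuft-census {v₀} {v} ¬l e c c″ = count-cong
      (λ w → S.inClass? (class v₀) w ×-dec (colour Y w Fin.≟ c″))
          (λ w → S.inClass? (class v₀) w ×-dec (colour Y′ w Fin.≟ c″))
      (λ w (e′ , d) → e′ , trans (trans (trans (cong (colour Y′) (only w e′)) (tuft→ c))
          (trans (sym c) (cong (colour Y) (sym (only w e′))))) d)
      (λ w (e′ , d) → e′ , trans (trans (trans (cong (colour Y) (only w e′)) c)
          (trans (sym (tuft→ c)) (cong (colour Y′) (sym (only w e′))))) d)
      where
      only : ∀ w → class w ≡ class v₀ → w ≡ v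
      only w e′ with S.tuft-killed c
      ... | ℓ , r , l with same-class (trans e (sym e′))
      ...   | leaves l′ _ _ = case same-class e of λ
              { (leaves _ l″ _) → contradiction l″ ¬l ; (nonleaves ¬l′ _ _) → contradiction l′ ¬l′ }
      ...   | nonleaves _ _ s = centre-sibling (Condenses.root-plain C r) (proj₂ (Condenses.killed C r)) l s

    same-census : ∀ a → SameCensus a
    same-census a c with Fin.any? (S.inClass? a)
    ... | no ¬∃ = trans
      (count-none (λ v → S.inClass? a v ×-dec (colour Y v Fin.≟ c)) λ v (e , _) → ¬∃ (v , e))
      (sym (count-none (λ v → S.inClass? a v ×-dec (colour Y′ v Fin.≟ c)) λ v (e , _) → ¬∃ (v , e)))
    ... | yes (v₀ , refl) = by-leaf (isLeaf? v₀) c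
      where
      by-tuft : ∀ {v₀} → ¬ IsLeaf v₀ → Dec (∃ λ v → class v ≡ class v₀ × colour Y v ≡ tuft) →
          SameCensus (class v₀)
      by-tuft ¬l (yes (v , e , c)) = tuft-census ¬l e c
      by-tuft ¬l (no ¬∃)           = nonleaf-census ¬l λ v e c → ¬∃ (v , e , c)

      by-leaf : ∀ {v₀} → Dec (IsLeaf v₀) → SameCensus (class v₀)
      by-leaf      (yes (pv , u , pu , l)) = leaf-census pu pv l
      by-leaf {v₀} (no ¬l) = by-tuft ¬l (Fin.any? λ v → S.inClass? (class v₀) v ×-dec (colour Y v Fin.≟ tuft))

    matched : ∃ λ (σ : Permutation′ n) → ∀ v → (class (σ ⟨$⟩ʳ v) , colour Y′ (σ ⟨$⟩ʳ v)) ≡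
        (class v , colour Y v)
    matched = matching (Product.≡-dec S._≟ᶜ_ Fin._≟_) (λ v → class v , colour Y v)
        (λ v → class v , colour Y′ v)
      λ (a , c) → trans (count-pair (colour Y) a c)
          (trans (same-census a c) (sym (count-pair (colour Y′) a c)))
      where
      count-pair : ∀ (g : Fin n → Fin (4 + k)) a c →
        count (λ v → Product.≡-dec S._≟ᶜ_ Fin._≟_ (class v , g v) (a , c)) ≡
        count (λ v → S.inClass? a v ×-dec (g v Fin.≟ c))
      count-pair g a c = count-cong (λ v → Product.≡-dec S._≟ᶜ_ Fin._≟_ (class v , g v) (a , c))
        (λ v → S.inClass? a v ×-dec (g v Fin.≟ c))
        (λ v e → cong proj₁ e , cong proj₂ e) (λ v (e , e′) → cong₂ _,_ e e′)

    -- The matching preserves classes, hence adjacency in `G` by `exchange`, and it preserves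
    -- colours. By `restrict` these two determine adjacency in the condensations.
    condensations-isomorphic : Y ≃ Y′
    condensations-isomorphic = σ , adj≡ , λ v → sym (cong proj₂ (σ-ok v))
      where
      σ = proj₁ matched
      σ-ok = proj₂ matched
      module C  = Condenses C
      module C′ = Condenses C′

      σ-injective : ∀ {u v} → σ ⟨$⟩ʳ u ≡ σ ⟨$⟩ʳ v → u ≡ v
      σ-injective e = trans (sym (inverseˡ σ)) (trans (cong (σ ⟨$⟩ˡ_) e) (inverseˡ σ))

      adjacent≡ : ∀ u v → adj G u v ≡ adj G (σ ⟨$⟩ʳ u) (σ ⟨$⟩ʳ v)
      adjacent≡ u v = T-ext
        (λ e → exchange (sym (cong proj₁ (σ-ok u))) (sym (cong proj₁ (σ-ok v)))
          (λ { refl → Adjacent-irrefl G e })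
          (λ σu≡σv → Adjacent-irrefl G (subst (Adjacent G u) (sym (σ-injective σu≡σv)) e)) e)
        (λ e → exchange (cong proj₁ (σ-ok u)) (cong proj₁ (σ-ok v))
          (λ σu≡σv → Adjacent-irrefl G (subst (Adjacent G (σ ⟨$⟩ʳ u)) (sym σu≡σv) e))
          (λ { refl → Adjacent-irrefl G e }) e)

      adj≡ : ∀ u v → adj (graph Y) u v ≡ adj (graph Y′) (σ ⟨$⟩ʳ u) (σ ⟨$⟩ʳ v)
      adj≡ u v = trans (C.restrict u v) (trans
        (cong₂ (λ c b → alive c ∧ b) (sym (cong proj₂ (σ-ok u)))
          (cong₂ (λ c b → alive c ∧ b) (sym (cong proj₂ (σ-ok v))) (adjacent≡ u v)))
        (sym (C′.restrict (σ ⟨$⟩ʳ u) (σ ⟨$⟩ʳ v))))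

-- Pulling `Y` back along an isomorphism turns condensations of two isomorphic graphs into
-- condensations of one and the same graph, as `Compare` requires.
relabel : Permutation′ n → Coloured n k → Coloured n k
relabel π Y = record
  { adj        = λ u v → adj (graph Y) (π ⟨$⟩ʳ u) (π ⟨$⟩ʳ v)
  ; adj-sym    = λ u v → adj-sym (graph Y) _ _
  ; adj-irrefl = λ v → adj-irrefl (graph Y) _
  } ▷ λ v → colour Y (π ⟨$⟩ʳ v)

relabel-≃ : (π : Permutation′ n) (Y : Coloured n k) → relabel π Y ≃ Y
relabel-≃ π Y = π , (λ _ _ → refl) , (λ _ → refl)

module _ {X X′ : Coloured n k} (iso : X ≃ X′) where
  private
    π = proj₁ iso

    π⁻¹≡ : ∀ {u w} → π ⟨$⟩ˡ w ≡ u → w ≡ π ⟨$⟩ʳ u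
    π⁻¹≡ refl = sym (inverseʳ π)

  relabel-condenses : {Y : Coloured n (2 + k)} → Condenses i j X′ Y → Condenses i j X (relabel π Y)
  relabel-condenses {i} {j} {Y} C = record
    { root = root′
    ; kept = λ {v} r → trans (C.kept (nothing⁻ r)) (sym (proj₂ (proj₂ iso) v))
    ; killed = λ {v} r → let a , b = C.killed (just⁻ r) in a , trans (proj₂ (proj₂ iso) v) b
    ; block = λ r → [ (λ (c , s) → inj₁ (c , sibling-≃ {X = X} {X′} iso s)) ,
        (λ (c , l) → inj₂ (c , leafAt-≃ {X = X} {X′} iso l)) ]′ (C.block (just⁻ r))
    ; sizes = λ u → trans
        (trans (count-cong (λ v → root′ v ≟ᴹ just u) (λ v → C.root (π ⟨$⟩ʳ v) ≟ᴹ just (π ⟨$⟩ʳ u))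
            (λ _ → just⁻)
                 (λ v r → trans (cong (Maybe.map (π ⟨$⟩ˡ_)) r) (cong just (inverseˡ π))))
               (sym (count-permute π λ v → C.root v ≟ᴹ just (π ⟨$⟩ʳ u))))
        (C.sizes (π ⟨$⟩ʳ u))
    ; restrict = λ u v → trans (C.restrict (π ⟨$⟩ʳ u) (π ⟨$⟩ʳ v))
        (cong (λ b → alive (colour Y (π ⟨$⟩ʳ u)) ∧ alive (colour Y (π ⟨$⟩ʳ v)) ∧ b)
            (sym (proj₁ (proj₂ iso) u v)))
    }
    where
    module C = Condenses C

    root′ : Fin n → Maybe (Fin n)
    root′ v = Maybe.map (π ⟨$⟩ˡ_) (C.root (π ⟨$⟩ʳ v))

    just⁻ : ∀ {v u} → root′ v ≡ just u → C.root (π ⟨$⟩ʳ v) ≡ just (π ⟨$⟩ʳ u)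
    just⁻ {v} e with C.root (π ⟨$⟩ʳ v)
    just⁻ e | just w = cong just (π⁻¹≡ (case e of λ { refl → refl }))

    nothing⁻ : ∀ {v} → root′ v ≡ nothing → C.root (π ⟨$⟩ʳ v) ≡ nothing
    nothing⁻ {v} e with C.root (π ⟨$⟩ʳ v)
    nothing⁻ e | nothing = refl

condensation-unique : {X X′ : Coloured n k} {Y Y′ : Coloured n (2 + k)} → 1 ≤ i → 1 ≤ j →
  Condenses i j X Y → Condenses i j X′ Y′ → Valid X → ThirdVertex X →
  Good i j Y → Good i j Y′ → X ≃ X′ → Y ≃ Y′
condensation-unique {X = X} {X′} {Y} {Y′} 1≤i 1≤j C C′ X-ok third good good′ iso@(π , _) =
  ≃-trans {X = Y} {relabel π Y′} {Y′}
    (Compare.condensations-isomorphic X-ok third 1≤i 1≤j C (relabel-condenses {X = X} {X′} iso C′) good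
      (Good-≃ {X = Y′} {relabel π Y′} (≃-sym {X = relabel π Y′} {Y′} (relabel-≃ π Y′)) good′))
    (relabel-≃ π Y′)

-- Existence of expansions and condensations

does⁻ : (a? : Dec A) → T (does a?) → A
does⁻ (yes a) _ = a

does⁺ : (a? : Dec A) → A → T (does a?)
does⁺ a? a = ≡⇒T (dec-true a? a)

toGraph : (E : Fin n → Fin n → Set) → (∀ u v → Dec (E u v)) →
          (∀ {u v} → E u v → E v u) → (∀ {v} → ¬ E v v) → Graph n
toGraph E E? E-sym E-irrefl = record
  { adj        = λ u v → does (E? u v)
  ; adj-sym    = λ u v → T-ext
      (λ e → does⁺ (E? v u) (E-sym (does⁻ (E? u v) e)))
      (λ e → does⁺ (E? u v) (E-sym (does⁻ (E? v u) e)))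
  ; adj-irrefl = λ v → dec-false (E? v v) E-irrefl
  }

restrictTo : Graph n → (Fin n → Fin (suc k)) → Graph n
restrictTo G g = record
  { adj        = λ u v → alive (g u) ∧ alive (g v) ∧ adj G u v
  ; adj-sym    = λ u v → trans (cong (λ b → alive (g u) ∧ alive (g v) ∧ b) (adj-sym G u v))
      (∧-swap (alive (g u)) (alive (g v)) (adj G v u))
  ; adj-irrefl = λ v → trans (cong (λ b → alive (g v) ∧ alive (g v) ∧ b) (adj-irrefl G v))
      (∧-false (alive (g v)))
  }
  where
  ∧-swap : ∀ a b c → a ∧ b ∧ c ≡ b ∧ a ∧ c
  ∧-swap true  true  c = refl
  ∧-swap true  false c = refl
  ∧-swap false true  c = refl
  ∧-swap false false c = refl

  ∧-false : ∀ a → a ∧ a ∧ false ≡ false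
  ∧-false true  = refl
  ∧-false false = refl

module _ {X : Coloured n k} {Y : Coloured n (2 + k)} (C : Condenses i j X Y) where
  open Condenses C

  private
    base : Fin n → Fin n
    base v = Maybe.fromMaybe v (root v)

    base-killed : ∀ {v u} → root v ≡ just u → base v ≡ u
    base-killed {v} r = cong (Maybe.fromMaybe v) r

    base-alive : ∀ {v} → Alive Y v → base v ≡ v
    base-alive {v} a = cong (Maybe.fromMaybe v) (alive-kept a)

    alive-base : ∀ {v} → Alive X v → Alive Y (base v)
    alive-base {v} a with root v in r
    ... | just u  = root-alive r
    ... | nothing = kept-alive r a

  -- A walk between the bases in `Y` is a walk in `X`, and a removed vertex is adjacent to its base.
  Valid-expands : Valid Y → (∀ {u v} → Adjacent (graph X) u v → Alive X u) → Valid X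
  isolated  (Valid-expands Y-ok iso) = iso
  connected (Valid-expands Y-ok iso) u v a b = to-base u ◅◅ gmap id (λ e → proj₂ (proj₂ (adjacent⁻ e)))
    (connected Y-ok (base u) (base v) (alive-base a) (alive-base b)) ◅◅ from-base v
    where
    to-base : ∀ u → Star (Adjacent (graph X)) u (base u)
    to-base u with root u in r
    ... | just w  = Adjacent-sym (graph X) (root-adjacent r) ◅ ε
    ... | nothing = ε

    from-base : ∀ u → Star (Adjacent (graph X)) (base u) u
    from-base u with root u in r
    ... | just w  = root-adjacent r ◅ ε
    ... | nothing = ε

  -- A walk in `X` is projected by `base`. An edge may collapse to a single vertex, which is why
  -- `Step` admits equality.
  Valid-condenses : Valid X → Valid Y
  isolated  (Valid-condenses X-ok) e = proj₁ (adjacent⁻ e)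
  connected (Valid-condenses X-ok) u v a b = subst₂ (Star (Adjacent (graph Y))) (base-alive a) (base-alive b)
    (walk (connected X-ok u v (alive-alive a) (alive-alive b)))
    where
    Step : Fin n → Fin n → Set
    Step u v = u ≡ v ⊎ Adjacent (graph Y) u v

    Step-sym : ∀ {u v} → Step u v → Step v u
    Step-sym (inj₁ p) = inj₁ (sym p)
    Step-sym (inj₂ e) = inj₂ (Adjacent-sym (graph Y) e)

    data View (v : Fin n) : Set where
      stay : Alive Y v → base v ≡ v → View v
      lost : ∀ {u} → root v ≡ just u → base v ≡ u → View v

    view : ∀ {v} → Alive X v → View v
    view {v} a = go (root v) refl
      where
      go : ∀ r → root v ≡ r → View v
      go (just u) e = lost e (base-killed e)
      go nothing  e = stay (kept-alive e a) (base-alive (kept-alive e a))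

    lost-stay : ∀ {u v w} → root u ≡ just w → Alive Y v → Adjacent (graph X) u v → Step w v
    lost-stay {u} {v} r b e with block r
    ... | inj₂ (_ , _ , only) = inj₁ (sym (only v e))
    ... | inj₁ (_ , s) with sibling⁻ (graph X) s (inj₂ e)
    ...   | inj₁ v≡w = inj₁ (sym v≡w)
    ...   | inj₂ e′  = inj₂ (adjacent⁺ (root-alive r) b e′)

    step : ∀ {u v} → View u → View v → Adjacent (graph X) u v → Step (base u) (base v)
    step (stay a p) (stay b q) e rewrite p | q = inj₂ (adjacent⁺ a b e)
    step (lost r p) (stay b q) e rewrite p | q = lost-stay r b e
    step (stay a p) (lost s q) e rewrite p | q = Step-sym (lost-stay s a (Adjacent-sym (graph X) e))
    step {v = v} (lost r p) (lost s q) e rewrite p | q with block r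
    ... | inj₂ (_ , _ , only) = contradiction (proj₁ (killed s))
        (subst (Alive Y) (sym (only v e)) (root-alive r))
    ... | inj₁ (_ , t) with sibling⁻ (graph X) t (inj₂ e)
    ...   | inj₁ v≡w = contradiction (proj₁ (killed s)) (subst (Alive Y) (sym v≡w) (root-alive r))
    ...   | inj₂ e′  = Step-sym (lost-stay s (root-alive r) (Adjacent-sym (graph X) e′))

    walk : ∀ {u v} → Star (Adjacent (graph X)) u v → Star (Adjacent (graph Y)) (base u) (base v)
    walk ε = ε
    walk (e ◅ p) with step (view (isolated X-ok e)) (view (isolated X-ok (Adjacent-sym (graph X) e))) e
    ... | inj₁ q  = subst (λ w → Star (Adjacent (graph Y)) w _) (sym q) (walk p)
    ... | inj₂ e′ = e′ ◅ walk p

module _ {i j} (Y : Coloured n (2 + k)) (Y-ok : Valid Y)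
         (enough : i * count (λ v → colour Y v Fin.≟ twin) + j * count (λ v → colour Y v Fin.≟ tuft)
                   ≤ count (λ v → colour Y v Fin.≟ dead)) where

  private
    assignment = distribute (λ v → colour Y v Fin.≟ dead) (λ u → demand i j (colour Y u))
      (≤-trans (≤-reflexive (trans (sum-cong-≗ λ u → sym (*-identityˡ (demand i j (colour Y u))))
        (demand-sum {i = i} {j} (λ _ → yes tt) (colour Y)))) enough)

    ρ : Fin n → Maybe (Fin n)
    ρ = proj₁ assignment

    ρ-dead : ∀ {v u} → ρ v ≡ just u → colour Y v ≡ dead
    ρ-dead = proj₁ (proj₂ assignment)

    ρ-sizes : ∀ u → count (λ v → ρ v ≟ᴹ just u) ≡ demand i j (colour Y u)
    ρ-sizes = proj₂ (proj₂ assignment)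

    ρ-mark : ∀ {v u} → ρ v ≡ just u → colour Y u ≡ twin ⊎ colour Y u ≡ tuft
    ρ-mark {v} {u} r with colour Y u | subst (0 <_) (ρ-sizes u) (count-positive (λ v → ρ v ≟ᴹ just u) {v} r)
    ... | twin | _ = inj₁ refl
    ... | tuft | _ = inj₂ refl

    ρ-alive : ∀ {v u} → ρ v ≡ just u → Alive Y u
    ρ-alive r d = [ (λ c → case trans (sym c) d of λ ()) , (λ c → case trans (sym c) d of λ ()) ]′ (ρ-mark r)

    base : Fin n → Fin n
    base v = Maybe.fromMaybe v (ρ v)

    Pendant : Fin n → Set
    Pendant v = Killed ρ v × colour Y (base v) ≡ tuft

    data View (v : Fin n) : Set where
      stay : ρ v ≡ nothing → base v ≡ v → ¬ Pendant v → View v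
      sib  : ∀ {u} → ρ v ≡ just u → base v ≡ u → colour Y u ≡ twin → ¬ Pendant v → View v
      pend : ∀ {u} → ρ v ≡ just u → base v ≡ u → colour Y u ≡ tuft → Pendant v → View v

    view : ∀ v → View v
    view v = go (ρ v) refl
      where
      go : ∀ r → ρ v ≡ r → View v
      go nothing  e = stay e (cong (Maybe.fromMaybe v) e) λ ((_ , e′) , _) → case trans (sym e) e′ of λ ()
      go (just u) e with ρ-mark e
      ... | inj₁ c = sib e b c λ (_ , c′) → case trans (sym c) (trans (cong (colour Y) (sym b)) c′) of λ ()
        where b = cong (Maybe.fromMaybe v) e
      ... | inj₂ c = pend e b c ((u , e) , trans (cong (colour Y) b) c)
        where b = cong (Maybe.fromMaybe v) e

    -- Outside the pendant vertices, `Full` blows up each base to a clique whose members inherit the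
    -- neighbours of the base; this creates the twin blocks. Pendant vertices are those given to a
    -- tuft, and `Tied` joins each to its root only.
    Full Tied Edge : Fin n → Fin n → Set
    Full u v = ¬ Pendant u × ¬ Pendant v × (base u ≡ base v ⊎ Adjacent (graph Y) (base u) (base v))
    Tied u v = (Pendant u × v ≡ base u) ⊎ (Pendant v × u ≡ base v)
    Edge u v = u ≢ v × (Full u v ⊎ Tied u v)

    -- The graph is used only through `edge⁺` and `edge⁻`, so the decision procedure need not
    -- unfold.
    abstract
      edge? : ∀ u v → Dec (Edge u v)
      edge? u v = ¬? (u Fin.≟ v) ×-dec
        ((¬? (pendant? u) ×-dec (¬? (pendant? v) ×-dec
            ((base u Fin.≟ base v) ⊎-dec adjacent? (graph Y) (base u) (base v)))) ⊎-dec
         ((pendant? u ×-dec (v Fin.≟ base u)) ⊎-dec (pendant? v ×-dec (u Fin.≟ base v))))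
        where
        pendant? : ∀ v → Dec (Pendant v)
        pendant? v = killed? ρ v ×-dec (colour Y (base v) Fin.≟ tuft)

    Edge-sym : ∀ {u v} → Edge u v → Edge v u
    Edge-sym (u≢v , inj₁ (a , b , inj₁ p)) = ≢-sym u≢v , inj₁ (b , a , inj₁ (sym p))
    Edge-sym (u≢v , inj₁ (a , b , inj₂ e)) = ≢-sym u≢v , inj₁ (b , a , inj₂ (Adjacent-sym (graph Y) e))
    Edge-sym (u≢v , inj₂ (inj₁ t)) = ≢-sym u≢v , inj₂ (inj₂ t)
    Edge-sym (u≢v , inj₂ (inj₂ t)) = ≢-sym u≢v , inj₂ (inj₁ t)

    G : Graph n
    G = toGraph Edge edge? Edge-sym λ (v≢v , _) → v≢v refl

    edge⁺ : ∀ {u v} → Edge u v → Adjacent G u v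
    edge⁺ {u} {v} = does⁺ (edge? u v)

    edge⁻ : ∀ {u v} → Adjacent G u v → Edge u v
    edge⁻ {u} {v} = does⁻ (edge? u v)

    colour′ : Fin n → Fin (2 + k)
    colour′ v with ρ v
    ... | just _  = plain
    ... | nothing = unmark (colour Y v)

    X : Coloured n k
    X = G ▷ colour′

    kept′ : ∀ {v} → ρ v ≡ nothing → unmark (colour Y v) ≡ colour X v
    kept′ {v} r with ρ v
    kept′ refl | nothing = refl

    killed′ : ∀ {v u} → ρ v ≡ just u → Plain X v
    killed′ {v} r with ρ v
    killed′ refl | just _ = refl

    root-view : ∀ {u} → Alive Y u → base u ≡ u × ¬ Pendant u
    root-view {u} a with view u
    ... | stay _ b ¬p   = b , ¬p
    ... | sib r _ _ _   = contradiction (ρ-dead r) a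
    ... | pend r _ _ _  = contradiction (ρ-dead r) a

    -- `Full` depends only on the bases, so only pendant edges could tell `u` and `v` apart. The
    -- last hypothesis excludes them; at the root of a twin block there are none.
    same-base : ∀ {u v} → base u ≡ base v → ¬ Pendant u → ¬ Pendant v →
                (∀ {w} → Pendant w → u ≢ base w × v ≢ base w) → ∀ {w} → Near G u w → Near G v w
    same-base {u} {v} b ¬pu ¬pv ¬tied {w} near with w Fin.≟ v
    ... | yes w≡v = inj₁ w≡v
    same-base {u} {v} b ¬pu ¬pv ¬tied {w} (inj₁ refl) | no w≢v =
      inj₂ (edge⁺ (≢-sym w≢v , inj₁ (¬pv , ¬pu , inj₁ (sym b))))
    same-base {u} {v} b ¬pu ¬pv ¬tied {w} (inj₂ e) | no w≢v with edge⁻ e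
    ... | _ , inj₁ (_ , ¬pw , p) = inj₂ (edge⁺ (≢-sym w≢v , inj₁ (¬pv , ¬pw ,
            subst (λ z → z ≡ base w ⊎ Adjacent (graph Y) z (base w)) b p)))
    ... | _ , inj₂ (inj₁ (pu , _)) = contradiction pu ¬pu
    ... | _ , inj₂ (inj₂ (pw , u≡)) = contradiction u≡ (proj₁ (¬tied pw))

    block′ : ∀ {v u} → ρ v ≡ just u → Block X Y u v
    block′ {v} {u} r with view v
    ... | stay r′ _ _ = case trans (sym r) r′ of λ ()
    ... | sib r′ b c ¬p with trans (sym r) r′
    ...   | refl = inj₁ (c , sibling⁺ G
              (same-base b≡ ¬p ¬pu untied)
              (same-base (sym b≡) ¬pu ¬p λ pw → let x , y = untied pw in y , x))
      where
      ¬pu = proj₂ (root-view (ρ-alive r))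
      b≡ = trans b (sym (proj₁ (root-view (ρ-alive r))))
      untied : ∀ {w} → Pendant w → v ≢ base w × u ≢ base w
      untied (_ , c′) = (λ { refl → case trans (sym (ρ-dead r)) c′ of λ () })
                      , (λ { refl → case trans (sym c) c′ of λ () })
    block′ {v} {u} r | pend r′ b c p with trans (sym r) r′
    ...   | refl = inj₂ (c , edge⁺ ((λ { refl → ρ-alive r (ρ-dead r) }) , inj₂ (inj₂ (p , sym b))) , only)
      where
      only : ∀ w → Adjacent G v w → w ≡ u
      only w e with edge⁻ e
      ... | _ , inj₁ (¬p , _)           = contradiction p ¬p
      ... | _ , inj₂ (inj₁ (_ , w≡))    = trans w≡ b
      ... | _ , inj₂ (inj₂ ((_ , c′) , v≡)) = case trans (sym (ρ-dead r))
          (trans (cong (colour Y) v≡) c′) of λ ()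

    restrict′ : ∀ u v → adj (graph Y) u v ≡ alive (colour Y u) ∧ alive (colour Y v) ∧ adj G u v
    restrict′ u v = T-ext to from
      where
      to : Adjacent (graph Y) u v → T (alive (colour Y u) ∧ alive (colour Y v) ∧ adj G u v)
      to e with isolated Y-ok e | isolated Y-ok (Adjacent-sym (graph Y) e)
      ... | a | b = Equivalence.from Bool.T-∧ (alive⁺ a , Equivalence.from Bool.T-∧ (alive⁺ b ,
        edge⁺ ((λ { refl → Adjacent-irrefl (graph Y) e }) , inj₁ (proj₂ (root-view a) , proj₂ (root-view b) ,
          inj₂ (subst₂ (Adjacent (graph Y)) (sym (proj₁ (root-view a))) (sym (proj₁ (root-view b))) e)))))

      from : T (alive (colour Y u) ∧ alive (colour Y v) ∧ adj G u v) → Adjacent (graph Y) u v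
      from t with Equivalence.to (Bool.T-∧ {alive (colour Y u)}) t
      ... | a , t′ with Equivalence.to (Bool.T-∧ {alive (colour Y v)}) t′
      ...   | b , e with root-view (alive⁻ a) | root-view (alive⁻ b) | edge⁻ e
      ...     | bu , ¬pu | bv , ¬pv | u≢v , inj₁ (_ , _ , inj₁ p) = contradiction
          (trans (sym bu) (trans p bv)) u≢v
      ...     | bu , ¬pu | bv , ¬pv | u≢v , inj₁ (_ , _ , inj₂ e′) = subst₂ (Adjacent (graph Y)) bu bv e′
      ...     | bu , ¬pu | bv , ¬pv | u≢v , inj₂ (inj₁ (p , _)) = contradiction p ¬pu
      ...     | bu , ¬pu | bv , ¬pv | u≢v , inj₂ (inj₂ (p , _)) = contradiction p ¬pv

    C : Condenses i j X Y
    C = record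
      { root = ρ
      ; kept = kept′
      ; killed = λ r → ρ-dead r , killed′ r
      ; block = block′
      ; sizes = ρ-sizes
      ; restrict = restrict′
      }

    isolated′ : ∀ {u v} → Adjacent G u v → Alive X u
    isolated′ {u} {v} e d with view u
    ... | sib r _ _ _  = case trans (sym d) (killed′ r) of λ ()
    ... | pend r _ _ _ = case trans (sym d) (killed′ r) of λ ()
    ... | stay r b ¬p = absurd (edge⁻ e)
      where
      u-dead = unmark-dead (trans (kept′ r) d)

      -- An unassigned placeholder is its own base, and no other vertex has it as base, since roots
      -- are alive.
      base-dead : base v ≢ u
      base-dead refl with view v
      ... | stay _ b′ _   = proj₁ (edge⁻ e) b′
      ... | sib r′ b′ _ _  = ρ-alive r′ (trans (cong (colour Y) (sym b′)) u-dead)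
      ... | pend r′ b′ _ _ = ρ-alive r′ (trans (cong (colour Y) (sym b′)) u-dead)

      absurd : ¬ Edge u v
      absurd (_ , inj₁ (_ , _ , inj₁ p)) = base-dead (trans (sym p) b)
      absurd (_ , inj₁ (_ , _ , inj₂ e′)) = isolated Y-ok
          (subst (λ z → Adjacent (graph Y) z (base v)) b e′) u-dead
      absurd (_ , inj₂ (inj₁ (p , _))) = ¬p p
      absurd (_ , inj₂ (inj₂ (_ , p))) = base-dead (sym p)

  expansion-exists : ∃ λ X → Condenses i j X Y × Valid X
  expansion-exists = X , C , Valid-expands C Y-ok isolated′

-- Condensing by single collapses

module _ {X : Coloured n k} {Y : Coloured n (2 + k)} (X-ok : Valid X) (C : Condenses i j X Y) where
  open Condenses C

  plain-plain : ∀ {v} → Plain Y v → Plain X v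
  plain-plain p = kept-colour C p

  private
    alive-Y : ∀ {v} → Plain Y v → Alive Y v
    alive-Y p d = case trans (sym p) d of λ ()

    root-not-plain : ∀ {v u w} → root v ≡ just u → Plain Y w → u ≢ w
    root-not-plain r p refl with block r
    ... | inj₁ (c , _) = case trans (sym p) c of λ ()
    ... | inj₂ (c , _) = case trans (sym p) c of λ ()

    data Fate (w : Fin n) : Set where
      stay : Alive Y w → Fate w
      lost : ∀ {r} → root w ≡ just r → Fate w

    fate : ∀ {w} → Alive X w → Fate w
    fate {w} a = go (root w) refl
      where
      go : ∀ r → root w ≡ r → Fate w
      go (just u) e = lost e
      go nothing  e = stay (kept-alive e a)

  -- The neighbour `w` of `u` may have been removed. It is not a removed leaf, whose only neighbour
  -- would be marked while `u` is plain. So it is a sibling of its root, and the root carries the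
  -- adjacency over to `v`.
  near-extend : ∀ {u v} → Plain Y u → Plain Y v → Sibling (graph Y) u v →
                ∀ {w} → Near (graph X) u w → Near (graph X) v w
  near-extend {u} {v} pu pv s (inj₁ refl) = proj₂ (near-alive (alive-Y pv) (sibling⁻ (graph Y) s (inj₁ refl)))
  near-extend {u} {v} pu pv s {w} (inj₂ e) with fate (isolated X-ok (Adjacent-sym (graph X) e))
  ... | stay a = proj₂ (near-alive (alive-Y pv) (sibling⁻ (graph Y) s (inj₂ (adjacent⁺ (alive-Y pu) a e))))
  ... | lost r with block r
  ...   | inj₂ (_ , _ , only) = contradiction (sym (only u (Adjacent-sym (graph X) e))) (root-not-plain r pu)
  ...   | inj₁ (_ , t) with sibling⁻ (graph X) t (inj₂ (Adjacent-sym (graph X) e))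
  ...     | inj₁ u≡r = contradiction (sym u≡r) (root-not-plain r pu)
  ...     | inj₂ e′ with sibling⁻ (graph Y) s
      (inj₂ (adjacent⁺ (alive-Y pu) (root-alive r) (Adjacent-sym (graph X) e′)))
  ...       | inj₁ r≡v = contradiction r≡v (root-not-plain r pv)
  ...       | inj₂ e″ with sibling⁻ (graph X) (sym t)
      (inj₂ (Adjacent-sym (graph X) (proj₂ (proj₂ (adjacent⁻ e″)))))
  ...         | inj₁ v≡w = inj₁ (sym v≡w)
  ...         | inj₂ e‴  = inj₂ (Adjacent-sym (graph X) e‴)

  sibling-extend : ∀ {u v} → Plain Y u → Plain Y v → Sibling (graph Y) u v → Sibling (graph X) u v
  sibling-extend pu pv s = sibling⁺ (graph X) (near-extend pu pv s) (near-extend pv pu (sym s))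

  leafAt-extend : ∀ {v u} → Plain Y v → Plain Y u → LeafAt (graph Y) v u → LeafAt (graph X) v u
  leafAt-extend {v} {u} pv pu (e , only) = proj₂ (proj₂ (adjacent⁻ e)) , only′
    where
    only′ : ∀ w → Adjacent (graph X) u w → w ≡ v
    only′ w e′ with fate (isolated X-ok (Adjacent-sym (graph X) e′))
    ... | stay a = only w (adjacent⁺ (alive-Y pu) a e′)
    ... | lost r with block r
    ...   | inj₂ (_ , _ , only″) = contradiction (sym (only″ u (Adjacent-sym (graph X) e′)))
        (root-not-plain r pu)
    ...   | inj₁ (_ , t) with sibling⁻ (graph X) t (inj₂ (Adjacent-sym (graph X) e′))
    ...     | inj₁ u≡r = contradiction (sym u≡r) (root-not-plain r pu)
    ...     | inj₂ e″  = contradiction (only _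
        (adjacent⁺ (alive-Y pu) (root-alive r) (Adjacent-sym (graph X) e″)))
                           (root-not-plain r pv)

  Marking : Fin (4 + k) → Fin n → Fin n → Set
  Marking c u v = (c ≡ twin × Sibling (graph X) u v) ⊎ (c ≡ tuft × LeafAt (graph X) v u)

  -- One collapse, for both marks at once: `v` receives the mark `c` and the vertices in `S` become
  -- dead. As `v` and `S` are plain in `Y`, they meet no earlier block root, and all earlier blocks
  -- persist.
  module Mark {v : Fin n} (pv : Plain Y v) (S : Fin n → Bool) (c : Fin (4 + k))
              (S-plain : ∀ {u} → T (S u) → Plain Y u × u ≢ v)
              (S-block : ∀ {u} → T (S u) → Marking c u v)
              (c-mark : c ≡ twin ⊎ c ≡ tuft)
              (S-size : count (T? ∘ S) ≡ demand i j c) where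

    g : Fin n → Fin (4 + k)
    g w with w Fin.≟ v
    ... | yes _ = c
    ... | no _  = if S w then dead else colour Y w

    ρ : Fin n → Maybe (Fin n)
    ρ w = if S w then just v else root w

    private
      data View (w : Fin n) : Set where
        centre : w ≡ v → g w ≡ c → ρ w ≡ root w → ¬ T (S w) → View w
        kill   : w ≢ v → T (S w) → g w ≡ dead → ρ w ≡ just v → View w
        other  : w ≢ v → ¬ T (S w) → g w ≡ colour Y w → ρ w ≡ root w → View w

      view : ∀ w → View w
      view w = go (w Fin.≟ v) (S w) refl
        where
        S-centre : w ≡ v → ¬ T (S w)
        S-centre e s = proj₂ (S-plain s) e

        g-centre : w ≡ v → g w ≡ c
        g-centre e with w Fin.≟ v
        ... | yes _ = refl
        ... | no ¬e = contradiction e ¬e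

        g-other : w ≢ v → g w ≡ (if S w then dead else colour Y w)
        g-other w≢v with w Fin.≟ v
        ... | yes e = contradiction e w≢v
        ... | no _  = refl

        go : Dec (w ≡ v) → ∀ b → S w ≡ b → View w
        go (yes e) true  s = contradiction (≡⇒T s) (S-centre e)
        go (yes e) false s = centre e (g-centre e) (cong (λ b → if b then just v else root w) s) (S-centre e)
        go (no ¬e) true  s = kill ¬e (≡⇒T s)
          (trans (g-other ¬e) (cong (λ b → if b then dead else colour Y w) s))
          (cong (λ b → if b then just v else root w) s)
        go (no ¬e) false s = other ¬e (λ t → case trans (sym s) (T⇒≡ t) of λ ())
          (trans (g-other ¬e) (cong (λ b → if b then dead else colour Y w) s))
          (cong (λ b → if b then just v else root w) s)

      v-kept : ∀ {u} → root v ≢ just u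
      v-kept r = alive-Y pv (proj₁ (killed r))

    Y′ : Coloured n (2 + k)
    Y′ = restrictTo (graph X) g ▷ g

    kept′ : ∀ {w} → ρ w ≡ nothing → unmark (g w) ≡ colour X w
    kept′ {w} r with view w
    ... | kill _ _ _ ρ≡      = case trans (sym r) ρ≡ of λ ()
    ... | other _ _ g≡ ρ≡    = trans (cong unmark g≡) (kept (trans (sym ρ≡) r))
    ... | centre refl g≡ ρ≡ _ = trans (cong unmark g≡) (trans
      ([ (λ { refl → refl }) , (λ { refl → refl }) ]′ c-mark) (sym (plain-plain pv)))

    killed′ : ∀ {w u} → ρ w ≡ just u → g w ≡ dead × Plain X w
    killed′ {w} r with view w
    ... | kill _ s g≡ _      = g≡ , plain-plain (proj₁ (S-plain s))
    ... | other _ _ g≡ ρ≡    = let a , b = killed (trans (sym ρ≡) r) in trans g≡ a , b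
    ... | centre refl g≡ ρ≡ _ = contradiction (trans (sym ρ≡) r) v-kept

    old-root : ∀ {w u} → root w ≡ just u → g u ≡ colour Y u
    old-root {w} {u} r with view u
    ... | other _ _ g≡ _    = g≡
    ... | centre refl _ _ _ = contradiction refl (root-not-plain r pv)
    ... | kill _ s _ _      = contradiction refl (root-not-plain r (proj₁ (S-plain s)))

    g-v : g v ≡ c
    g-v with view v
    ... | centre _ g≡ _ _  = g≡
    ... | kill v≢v _ _ _   = contradiction refl v≢v
    ... | other v≢v _ _ _  = contradiction refl v≢v

    old-block : ∀ {w u} → root w ≡ just u → Block X Y′ u w
    old-block r with block r
    ... | inj₁ (c′ , s) = inj₁ (trans (old-root r) c′ , s)
    ... | inj₂ (c′ , l) = inj₂ (trans (old-root r) c′ , l)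

    block′ : ∀ {w u} → ρ w ≡ just u → Block X Y′ u w
    block′ {w} r with view w
    ... | centre refl _ ρ≡ _ = contradiction (trans (sym ρ≡) r) v-kept
    ... | other _ _ _ ρ≡     = old-block (trans (sym ρ≡) r)
    ... | kill _ s _ ρ≡ with trans (sym ρ≡) r
    ...   | refl = [ (λ (c≡ , t) → inj₁ (trans g-v c≡ , t)) , (λ (c≡ , l) → inj₂ (trans g-v c≡ , l)) ]′
        (S-block s)

    new-sizes : count (λ w → ρ w ≟ᴹ just v) ≡ demand i j c
    new-sizes = trans (count-cong (λ w → ρ w ≟ᴹ just v) (T? ∘ S) to from) S-size
      where
      to : ∀ w → ρ w ≡ just v → T (S w)
      to w r with view w
      ... | kill _ s _ _       = s
      ... | centre refl _ ρ≡ _ = contradiction (trans (sym ρ≡) r) v-kept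
      ... | other _ _ _ ρ≡     = contradiction refl (root-not-plain (trans (sym ρ≡) r) pv)

      from : ∀ w → T (S w) → ρ w ≡ just v
      from w s = cong (λ b → if b then just v else root w) (T⇒≡ s)

    old-sizes : ∀ {u} → u ≢ v → count (λ w → ρ w ≟ᴹ just u) ≡ demand i j (colour Y u)
    old-sizes {u} u≢v = trans (count-cong (λ w → ρ w ≟ᴹ just u) (λ w → root w ≟ᴹ just u) to from) (sizes u)
      where
      to : ∀ w → ρ w ≡ just u → root w ≡ just u
      to w r with view w
      ... | kill _ _ _ ρ≡    = case trans (sym ρ≡) r of λ { refl → contradiction refl u≢v }
      ... | centre _ _ ρ≡ _  = trans (sym ρ≡) r
      ... | other _ _ _ ρ≡   = trans (sym ρ≡) r

      from : ∀ w → root w ≡ just u → ρ w ≡ just u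
      from w r with view w
      ... | kill _ s _ _     = contradiction (proj₁ (killed r)) (alive-Y (proj₁ (S-plain s)))
      ... | centre _ _ ρ≡ _  = trans ρ≡ r
      ... | other _ _ _ ρ≡   = trans ρ≡ r

    sizes′ : ∀ u → count (λ w → ρ w ≟ᴹ just u) ≡ demand i j (g u)
    sizes′ u with view u
    ... | centre refl g≡ _ _ = trans new-sizes (cong (demand i j) (sym g≡))
    ... | other u≢v _ g≡ _   = trans (old-sizes u≢v) (cong (demand i j) (sym g≡))
    ... | kill u≢v s g≡ _    = trans (old-sizes u≢v)
      (trans (cong (demand i j) (proj₁ (S-plain s))) (cong (demand i j) (sym g≡)))

    condenses : Condenses i j X Y′
    condenses = record
      { root = ρ ; kept = kept′ ; killed = killed′ ; block = block′ ; sizes = sizes′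
      ; restrict = λ _ _ → refl }

    -- The vertex `v` itself ceases to be plain, so the decrease is strict whatever the size of `S`.
    fewer-plain : count (plain? Y′) < count (plain? Y)
    fewer-plain = ≤-trans
      (≤-reflexive (cong (_+ count (plain? Y′)) (sym (count-singleton v))))
      (≤-trans (≤-reflexive (sym (count-⊎ either? (Fin._≟ v) (plain? Y′)
        (λ _ → id) (λ _ → inj₁) (λ _ → inj₂) λ { w refl p →
            [ (λ c≡ → case trans (sym c≡) (trans (sym g-v) p) of λ ())
          , (λ c≡ → case trans (sym c≡) (trans (sym g-v) p) of λ ()) ]′ c-mark })))
        (count-mono either? (plain? Y) λ { w (inj₁ refl) → pv ; w (inj₂ p) → old-plain w p }))
      where
      either? = λ w → (w Fin.≟ v) ⊎-dec plain? Y′ w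

      old-plain : ∀ w → g w ≡ plain → Plain Y w
      old-plain w p with view w
      ... | centre refl _ _ _ = pv
      ... | kill _ _ g≡ _     = case trans (sym g≡) p of λ ()
      ... | other _ _ g≡ _    = trans (sym g≡) p

  mark-twin : ∀ {v} → Plain Y v → i < plainSiblings Y v →
              ∃ λ Y′ → Condenses i j X Y′ × count (plain? Y′) < count (plain? Y)
  -- One of the more than `i` plain siblings counted is `v`, which leaves at least `i` others to
  -- remove.
  mark-twin {v} pv i< with subset-of-size {m = i} other? (s≤s⁻¹ (≤-trans i< (≤-reflexive split)))
    where
    other? = λ u → (plain? Y u ×-dec sibling? (graph Y) u v) ×-dec ¬? (u Fin.≟ v)
    split : plainSiblings Y v ≡ suc (count other?)
    split = trans (count-⊎ (λ u → plain? Y u ×-dec sibling? (graph Y) u v) (Fin._≟ v) other?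
      (λ u p → case u Fin.≟ v of λ { (yes e) → inj₁ e ; (no ¬e) → inj₂ (p , ¬e) })
      (λ { u refl → pv , refl }) (λ _ → proj₁) (λ { u e (_ , ¬e) → ¬e e }))
      (cong (_+ count other?) (count-singleton v))
  ... | S , S⊆ , size = Y′ , condenses , fewer-plain
    where
    S-plain : ∀ {u} → T (S u) → Plain Y u × u ≢ v
    S-plain s with S⊆ _ s
    ... | (p , _) , u≢v = p , u≢v

    S-block : ∀ {u} → T (S u) → Marking twin u v
    S-block s with S⊆ _ s
    ... | (p , t) , _ = inj₁ (refl , sibling-extend p pv t)

    open Mark pv S twin S-plain S-block (inj₁ refl) size

  mark-tuft : ∀ {v} → Plain Y v → j ≤ plainLeaves Y v →
              ∃ λ Y′ → Condenses i j X Y′ × count (plain? Y′) < count (plain? Y)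
  mark-tuft {v} pv j≤ with subset-of-size {m = j} (λ u → plain? Y u ×-dec leafAt? (graph Y) v u) j≤
  ... | S , S⊆ , size = Y′ , condenses , fewer-plain
    where
    S-plain : ∀ {u} → T (S u) → Plain Y u × u ≢ v
    S-plain s with S⊆ _ s
    ... | p , e , _ = p , λ { refl → Adjacent-irrefl (graph Y) e }

    S-block : ∀ {u} → T (S u) → Marking tuft u v
    S-block s with S⊆ _ s
    ... | p , l = inj₂ (refl , leafAt-extend pv p l)

    open Mark pv S tuft S-plain S-block (inj₂ refl) size

  condense-step : ¬ Good i j Y → ∃ λ Y′ → Condenses i j X Y′ × count (plain? Y′) < count (plain? Y)
  condense-step bad with Fin.any? (λ v → plain? Y v ×-dec (i <? plainSiblings Y v))
  ... | yes (v , pv , i<) = mark-twin pv i<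
  ... | no ¬twin with Fin.any? (λ v → plain? Y v ×-dec (j ≤? plainLeaves Y v))
  ...   | yes (v , pv , j≤) = mark-tuft pv j≤
  ...   | no ¬tuft = contradiction
    (λ v pv → ≮⇒≥ (λ i< → ¬twin (v , pv , i<)) , ≰⇒> (λ j≤ → ¬tuft (v , pv , j≤))) bad

embed : Fin (2 + k) → Fin (4 + k)
embed dead          = dead
embed plain         = plain
embed (suc (suc c)) = inert c

unmark-embed : (c : Fin (2 + k)) → unmark (embed c) ≡ c
unmark-embed dead          = refl
unmark-embed plain         = refl
unmark-embed (suc (suc c)) = refl

demand-embed : (c : Fin (2 + k)) → demand i j (embed c) ≡ 0
demand-embed dead          = refl
demand-embed plain         = refl
demand-embed (suc (suc c)) = refl

condenses-trivial : (X : Coloured n k) → Condenses i j X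
    (restrictTo (graph X) (embed ∘ colour X) ▷ (embed ∘ colour X))
condenses-trivial {n} X = record
  { root     = λ _ → nothing
  ; kept     = λ {v} _ → unmark-embed (colour X v)
  ; killed   = λ ()
  ; block    = λ ()
  ; sizes    = λ u → trans (sum-zero {n} λ _ → refl) (sym (demand-embed (colour X u)))
  ; restrict = λ _ _ → refl
  }

condensation-exists : (X : Coloured n k) → Valid X → ∃ λ Y → Condenses i j X Y × Good i j Y
condensation-exists {n} {k} {i} {j} X X-ok = go _ (condenses-trivial X) (<-wellFounded _)
  where
  go : ∀ Y → Condenses i j X Y → Acc _<_ (count (plain? Y)) → ∃ λ Y → Condenses i j X Y × Good i j Y
  go Y C (acc rec) with good? i j Y
  ... | yes good = Y , C , good
  ... | no bad with condense-step X-ok C bad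
  ...   | Y′ , C′ , fewer = go Y′ C′ (rec fewer)

module _ {X : Coloured n k} {Y : Coloured n (2 + k)} (C : Condenses i j X Y) where
  open Condenses C

  Marked : Set
  Marked = ∃ λ u → colour Y u ≡ twin ⊎ colour Y u ≡ tuft

  -- The root of a twin block together with its `i` removed vertices forms `i + 1` plain siblings in
  -- `X`; a tuft had `j` plain leaves.
  marked⇒bad : Valid X → Marked → ¬ Good i j X
  marked⇒bad X-ok (u , inj₁ c) good = <⇒≱ {i} ≤-refl (≤-trans (≤-reflexive size) (≤-trans
    (count-mono block? (λ w → plain? X w ×-dec sibling? (graph X) w u) inside)
        (proj₁ (good u (kept-colour C c)))))
    where
    block? = λ w → (w Fin.≟ u) ⊎-dec (root w ≟ᴹ just u)

    size : suc i ≡ count block?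
    size = sym (trans (count-⊎ block? (Fin._≟ u) (λ w → root w ≟ᴹ just u) (λ _ → id) (λ _ → inj₁) (λ _ → inj₂)
      (λ { w refl r → killed≢root r refl }))
      (cong₂ _+_ (count-singleton u) (trans (sizes u) (cong (demand i j) c))))

    inside : ∀ w → w ≡ u ⊎ root w ≡ just u → Plain X w × Sibling (graph X) w u
    inside w (inj₁ refl) = kept-colour C c , refl
    inside w (inj₂ r) with block r
    ... | inj₁ (_ , s)  = proj₂ (killed r) , s
    ... | inj₂ (c′ , _) = case trans (sym c) c′ of λ ()
  marked⇒bad X-ok (u , inj₂ c) good = <⇒≱ (proj₂ (good u (kept-colour C c))) (≤-trans
    (≤-reflexive (sym (trans (sizes u) (cong (demand i j) c))))
    (count-mono (λ w → root w ≟ᴹ just u) (λ w → plain? X w ×-dec leafAt? (graph X) u w) inside))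
    where
    inside : ∀ w → root w ≡ just u → Plain X w × LeafAt (graph X) u w
    inside w r with block r
    ... | inj₁ (c′ , _) = case trans (sym c) c′ of λ ()
    ... | inj₂ (_ , l)  = proj₂ (killed r) , l

  -- Roots are marked, so without marks nothing was removed: plain vertices stay plain, and the
  -- goodness of `Y` carries over to `X`.
  bad⇒marked : Good i j Y → ¬ Good i j X → Marked
  bad⇒marked good bad with Fin.any? (λ u → (colour Y u Fin.≟ twin) ⊎-dec (colour Y u Fin.≟ tuft))
  ... | yes marked = marked
  ... | no ¬marked = contradiction X-good bad
    where
    still-plain : ∀ {v} → Plain X v → Plain Y v
    still-plain {v} p = go (root v) refl
      where
      go : ∀ r → root v ≡ r → Plain Y v
      go (just u) r with block r
      ... | inj₁ (c , _) = contradiction (u , inj₁ c) ¬marked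
      ... | inj₂ (c , _) = contradiction (u , inj₂ c) ¬marked
      go nothing r with colour Y v in c | kept r
      ... | dead    | e = case trans e p of λ ()
      ... | plain   | _ = refl
      ... | twin    | _ = contradiction (v , inj₁ c) ¬marked
      ... | tuft    | _ = contradiction (v , inj₂ c) ¬marked
      ... | inert _ | e = case trans e p of λ ()

    still-alive : ∀ {v} → Plain X v → Alive Y v
    still-alive p d = case trans (sym (still-plain p)) d of λ ()

    X-good : Good i j X
    X-good v p = let a , b = good v (still-plain p) in
      ≤-trans (count-mono (λ u → plain? X u ×-dec sibling? (graph X) u v)
          (λ u → plain? Y u ×-dec sibling? (graph Y) u v)
        λ u (q , s) → still-plain q , sibling-restrict (still-alive q) (still-alive p) s) a ,
      ≤-<-trans (count-mono (λ u → plain? X u ×-dec leafAt? (graph X) v u)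
          (λ u → plain? Y u ×-dec leafAt? (graph Y) v u)
        λ u (q , l) → still-plain q , leafAt-restrict (still-alive p) (still-alive q) l) b

-- Symmetry of the good graphs

Contents : ℕ → Set
Contents k = Vec ℕ (2 + k) → Bool

-- The good valid graphs with such contents are meant to be the condensations of the bad ones with
-- contents in `E`. The second conjunct makes the subtraction in `expandContent` exact.
markedContents : ℕ → ℕ → Contents k → Contents (2 + k)
markedContents i j E κ@(d ∷ _ ∷ s ∷ t ∷ _) =
  (0 <ᵇ s + t) ∧ (i * s + j * t ≤ᵇ d) ∧ E (expandContent i j κ)

markedContents⁻ : ∀ i j (E : Contents k) d p s t cs → T (markedContents i j E (d ∷ p ∷ s ∷ t ∷ cs)) →
  0 < s + t × i * s + j * t ≤ d × T (E (expandContent i j (d ∷ p ∷ s ∷ t ∷ cs)))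
markedContents⁻ i j E d p s t cs e
  with Equivalence.to (Bool.T-∧ {0 <ᵇ s + t}) e
... | some , e′ with Equivalence.to (Bool.T-∧ {i * s + j * t ≤ᵇ d}) e′
...   | enough , e″ = <ᵇ⇒< 0 (s + t) some , ≤ᵇ⇒≤ (i * s + j * t) d enough , e″

markedContents⁺ : ∀ i j (E : Contents k) d p s t cs →
  0 < s + t → i * s + j * t ≤ d → T (E (expandContent i j (d ∷ p ∷ s ∷ t ∷ cs))) →
  T (markedContents i j E (d ∷ p ∷ s ∷ t ∷ cs))
markedContents⁺ i j E d p s t cs some enough e =
  Equivalence.from Bool.T-∧ (<⇒<ᵇ some , Equivalence.from Bool.T-∧ (≤⇒≤ᵇ enough , e))

size : Coloured n k → Fin (2 + k) → ℕ
size X c = count (λ v → colour X v Fin.≟ c)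

inertSizes : Coloured n (2 + k) → Vec ℕ k
inertSizes Y = tabulate λ c → size Y (inert c)

In : Contents k → Coloured n k → Set
In E X = Valid X × T (E (content X))

in? : (E : Contents k) → Decidable (In {n = n} E)
in? E X = valid? X ×-dec T? (E (content X))

GoodIn BadIn : ℕ → ℕ → Contents k → Coloured n k → Set
GoodIn i j E X = In E X × Good i j X
BadIn  i j E X = In E X × ¬ Good i j X

goodIn? : ∀ i j (E : Contents k) → Decidable (GoodIn {n = n} i j E)
goodIn? i j E X = in? E X ×-dec good? i j X

badIn? : ∀ i j (E : Contents k) → Decidable (BadIn {n = n} i j E)
badIn? i j E X = in? E X ×-dec ¬? (good? i j X)

In-≃ : (E : Contents k) → Invariant (In {n = n} E)
In-≃ E {X} {Y} iso (ok , e) = Valid-≃ {X = X} {Y} iso ok , subst (T ∘ E) (content-≃ {X = X} {Y} iso) e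

GoodIn-≃ : ∀ i j (E : Contents k) → Invariant (GoodIn {n = n} i j E)
GoodIn-≃ i j E {X} {Y} iso (p , good) = In-≃ E {X} {Y} iso p , Good-≃ {X = X} {Y} iso good

BadIn-≃ : ∀ i j (E : Contents k) → Invariant (BadIn {n = n} i j E)
BadIn-≃ i j E {X} {Y} iso (p , bad) = In-≃ E {X} {Y} iso p , bad ∘ Good-≃ {X = Y} {X} (≃-sym {X = X} {Y} iso)

Markable : ℕ → Contents k → Set
Markable n E = ∀ (X : Coloured n _) → T (E (content X)) → ThirdVertex X

-- Condensations exist, and uniqueness of expansions makes the correspondence injective. Equal
-- contents of the expansions follow from those of the condensations.
bad-≤-marked : ∀ (E : Contents k) →
               card (badIn? {n = n} i j E) ≤ card (goodIn? {n = n} i j (markedContents i j E))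
bad-≤-marked {n = n} {i} {j} E = card-≤ {n} (badIn? i j E) (goodIn? i j (markedContents i j E))
  (λ {X} {Y} → GoodIn-≃ i j (markedContents i j E) {X} {Y}) (Condenses i j) total
  λ { {X} {X′} {Y} {Y′} ((X-ok , _) , _) ((X′-ok , _) , _) _ _ C C′ iso → expansion-unique C C′ X-ok X′-ok
      (trans (content-condenses C) (trans (cong (expandContent i j) (content-≃ {X = Y} {Y′} iso))
          (sym (content-condenses C′)))) iso }
  where
  total : ∀ X → BadIn i j E X → ∃ λ Y → GoodIn i j (markedContents i j E) Y × Condenses i j X Y
  total X ((X-ok , e) , bad) with condensation-exists {i = i} {j} X X-ok
  ... | Y , C , good = Y , ((Valid-condenses C X-ok ,
          markedContents⁺ i j E (size Y dead) (size Y plain) (size Y twin) (size Y tuft) (inertSizes Y)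
            marked (enough-dead C) (subst (T ∘ E) (content-condenses C) e)) , good) , C
    where
    marked : 0 < size Y twin + size Y tuft
    marked with bad⇒marked C good bad
    ... | v , inj₁ c = <-≤-trans (count-positive (λ v → colour Y v Fin.≟ twin) {v} c)
        (m≤m+n (size Y twin) (size Y tuft))
    ... | v , inj₂ c = <-≤-trans (count-positive (λ v → colour Y v Fin.≟ tuft) {v} c)
        (m≤n+m (size Y tuft) (size Y twin))

mark-exists : (Y : Coloured n (2 + k)) → 0 < size Y twin + size Y tuft →
              ∃ λ u → colour Y u ≡ twin ⊎ colour Y u ≡ tuft
mark-exists Y 0<s+t with count (λ v → colour Y v Fin.≟ twin) ℕ.≟ 0
... | no s≢0 = let v , c = 0<count (λ v → colour Y v Fin.≟ twin) (n≢0⇒n>0 s≢0) in v , inj₁ c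
... | yes s≡0 = let v , c = 0<count (λ v → colour Y v Fin.≟ tuft)
                      (≤-trans 0<s+t (≤-reflexive (cong (_+ count (λ v → colour Y v Fin.≟ tuft)) s≡0)))
  in v , inj₂ c

-- The opposite pair of facts: expansions exist, and uniqueness of condensations gives injectivity.
-- Only this direction must exclude K₂ and zero demands.
marked-≤-bad : 1 ≤ i → 1 ≤ j → (E : Contents k) → Markable n E →
               card (goodIn? {n = n} i j (markedContents i j E)) ≤ card (badIn? {n = n} i j E)
marked-≤-bad {i = i} {j} {n = n} 1≤i 1≤j E markable = card-≤ {n} (goodIn? i j (markedContents i j E))
    (badIn? i j E)
  (λ {X} {Y} → BadIn-≃ i j E {X} {Y}) (λ Y X → Condenses i j X Y) total
  λ { {X = Y} {Y′} {X} {X′} (_ , good) (_ , good′) ((X-ok , e) , _) _ C C′ iso →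
      condensation-unique 1≤i 1≤j C C′ X-ok (markable X e) good good′ iso }
  where
  total : ∀ Y → GoodIn i j (markedContents i j E) Y → ∃ λ X → BadIn i j E X × Condenses i j X Y
  total Y ((Y-ok , e) , good) with markedContents⁻ i j E (size Y dead) (size Y plain) (size Y twin)
      (size Y tuft) (inertSizes Y) e
  ... | some , enough , e′ with expansion-exists {i = i} {j} Y Y-ok enough
  ...   | X , C , X-ok = X , ((X-ok , subst (T ∘ E) (sym (content-condenses C)) e′) ,
          marked⇒bad C X-ok (mark-exists Y some)) , C

-- A marked vertex is alive and not plain, so it is itself the third vertex. Hence K₂ has to be
-- excluded only at the start of the induction.
marked-markable : (E : Contents k) → Markable n (markedContents i j E)
marked-markable {i = i} {j} E Y e u v pu pv with mark-exists Y
    (proj₁ (markedContents⁻ i j E (size Y dead) (size Y plain) (size Y twin) (size Y tuft) (inertSizes Y) e))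
... | x , inj₁ c = x , (λ d → case trans (sym c) d of λ ()) ,
  (λ { refl → case trans (sym c) pu of λ () }) , (λ { refl → case trans (sym c) pv of λ () })
... | x , inj₂ c = x , (λ d → case trans (sym c) d of λ ()) ,
  (λ { refl → case trans (sym c) pu of λ () }) , (λ { refl → case trans (sym c) pv of λ () })

swapMarks : Fin (4 + k) → Fin (4 + k)
swapMarks twin      = tuft
swapMarks tuft      = twin
swapMarks dead      = dead
swapMarks plain     = plain
swapMarks (inert c) = inert c

swapMarks-involutive : (c : Fin (4 + k)) → swapMarks (swapMarks c) ≡ c
swapMarks-involutive twin      = refl
swapMarks-involutive tuft      = refl
swapMarks-involutive dead      = refl
swapMarks-involutive plain     = refl
swapMarks-involutive (inert c) = refl

swapped : {c d : Fin (4 + k)} → swapMarks c ≡ d → c ≡ swapMarks d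
swapped {c = c} e = trans (sym (swapMarks-involutive c)) (cong swapMarks e)

recolour : Coloured n (2 + k) → Coloured n (2 + k)
recolour Y = graph Y ▷ (swapMarks ∘ colour Y)

swap-markedContents : ∀ i j (E : Contents k) d p s t cs →
  T (markedContents i j E (d ∷ p ∷ s ∷ t ∷ cs)) → T (markedContents j i E (d ∷ p ∷ t ∷ s ∷ cs))
swap-markedContents i j E d p s t cs e with markedContents⁻ i j E d p s t cs e
... | some , enough , e′ = markedContents⁺ j i E d p t s cs
  (subst (0 <_) (+-comm s t) some)
  (subst (_≤ d) i*s+j*t≡ enough)
  (subst (T ∘ E) (cong₂ _∷_ (cong (d ∸_) i*s+j*t≡) (cong (_∷ cs) (cong (p +_) (trans
    (sym (+-assoc s t _)) (trans (cong₂ _+_ (+-comm s t) i*s+j*t≡) (+-assoc t s _)))))) e′)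
  where
  i*s+j*t≡ : i * s + j * t ≡ j * t + i * s
  i*s+j*t≡ = +-comm (i * s) (j * t)

content-recolour : (Y : Coloured n (2 + k)) →
  content (recolour Y) ≡ size Y dead ∷ size Y plain ∷ size Y tuft ∷ size Y twin ∷ inertSizes Y
content-recolour Y = cong₂ _∷_ (by dead) (cong₂ _∷_ (by plain) (cong₂ _∷_ (by twin) (cong₂ _∷_ (by tuft)
  (tabulate-cong λ c → by (inert c)))))
  where
  by : ∀ c → size (recolour Y) c ≡ size Y (swapMarks c)
  by c = count-cong (λ v → swapMarks (colour Y v) Fin.≟ c) (λ v → colour Y v Fin.≟ swapMarks c)
    (λ v → swapped) (λ v e → trans (cong swapMarks e) (swapMarks-involutive c))

-- The bounds `a` and `b` are independent of the demands `i` and `j`: goodness ignores marked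
-- vertices, and the total demand is unchanged when the marks and their demands are exchanged
-- together.
swapped-marks-≤ : (E : Contents k) → ∀ i j a b →
  card (goodIn? {n = n} a b (markedContents i j E)) ≤ card (goodIn? {n = n} a b (markedContents j i E))
swapped-marks-≤ {k} {n} E i j a b = card-≤ {n} (goodIn? a b (markedContents i j E))
    (goodIn? a b (markedContents j i E))
  (λ {X} {Y} → GoodIn-≃ a b (markedContents j i E) {X} {Y}) (λ Y Z → recolour Y ≡ Z)
  (λ Y p → recolour Y , recolour-good Y p , refl)
  λ { _ _ _ _ refl refl (π , f , g) → π , f , λ v → trans (swapped (g v)) (swapMarks-involutive _) }
  where
  recolour-good : ∀ Y → GoodIn a b (markedContents i j E) Y → GoodIn a b (markedContents j i E) (recolour Y)
  recolour-good Y ((Y-ok , e) , good) = (record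
    { isolated  = λ e d → isolated Y-ok e (swapped d)
    ; connected = λ u v p q → connected Y-ok u v (p ∘ cong swapMarks) (q ∘ cong swapMarks)
    } , subst (T ∘ markedContents j i E) (sym (content-recolour Y))
          (swap-markedContents i j E (size Y dead) (size Y plain) (size Y twin) (size Y tuft)
              (inertSizes Y) e)) ,
    λ v p → let q , r = good v (swapped p) in
      ≤-trans (count-mono (λ u → plain? (recolour Y) u ×-dec sibling? (graph Y) u v)
          (λ u → plain? Y u ×-dec sibling? (graph Y) u v)
        λ u (c , s) → swapped c , s) q ,
      ≤-<-trans (count-mono (λ u → plain? (recolour Y) u ×-dec leafAt? (graph Y) v u)
          (λ u → plain? Y u ×-dec leafAt? (graph Y) v u)
        λ u (c , l) → swapped c , l) r

card-split : ∀ i j (E : Contents k) → card (in? {n = n} E) ≡ card (goodIn? {n = n} i j E) +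
    card (badIn? {n = n} i j E)
card-split {k} {n} i j E = length-filter-split (in? E) (goodIn? i j E) (badIn? i j E)
  (λ {X} p → case good? i j X of λ { (yes good) → inj₁ (p , good) ; (no bad) → inj₂ (p , bad) })
  proj₁ proj₁ (λ (_ , good) (_ , bad) → bad good) (classes n k)

PlainBelow : ℕ → Contents k → Set
PlainBelow b E = ∀ d p cs → T (E (d ∷ p ∷ cs)) → p < b

-- Good is compared through its complement: the bad graphs are encoded by good
-- graphs with fewer plain vertices, on which the induction hypothesis applies.
good-≤ : 1 ≤ i → 1 ≤ j → ∀ b (E : Contents k) → PlainBelow b E → Markable n E →
         card (goodIn? {n = n} i j E) ≤ card (goodIn? {n = n} j i E)
good-≤ {i} {j} {k} {n} 1≤i 1≤j zero E below markable =
  card-≤ {n} (goodIn? i j E) (goodIn? j i E) (λ {X} {Y} → GoodIn-≃ j i E {X} {Y}) (λ _ _ → ⊤)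
    (λ X ((_ , e) , _) → contradiction (below (size X dead) (size X plain) _ e) λ ())
    (λ {X} ((_ , e) , _) → contradiction (below (size X dead) (size X plain) _ e) λ ())
good-≤ {i} {j} {k} {n} 1≤i 1≤j (suc b) E below markable =
  +-cancelʳ-≤ (card (badIn? {n = n} i j E)) _ _ (begin
    card (goodIn? {n = n} i j E) + card (badIn? {n = n} i j E)  ≡⟨ card-split {n = n} i j E ⟨
    card (in? {n = n} E)                                        ≡⟨ card-split {n = n} j i E ⟩
    card (goodIn? {n = n} j i E) + card (badIn? {n = n} j i E)  ≤⟨
        +-monoʳ-≤ (card (goodIn? {n = n} j i E)) bad-≤ ⟩
    card (goodIn? {n = n} j i E) + card (badIn? {n = n} i j E)  ∎)
  where
  open ≤-Reasoning

  -- Expansion makes every mark plain again, so a condensed graph with at least one mark has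
  -- strictly fewer plain vertices.
  marked-below : PlainBelow b (markedContents i j E)
  marked-below d p (s ∷ t ∷ cs) e with markedContents⁻ i j E d p s t cs e
  ... | some , _ , e′ = <-≤-trans (m<m+n p some) (≤-trans
    (+-monoʳ-≤ p (+-monoʳ-≤ s (m≤m+n t _))) (s≤s⁻¹ (below _ _ cs e′)))

  bad-≤ : card (badIn? {n = n} j i E) ≤ card (badIn? {n = n} i j E)
  -- The four steps: condense for `(j , i)`, exchange the marks, exchange the bounds of goodness by
  -- induction, expand for `(i , j)`.
  bad-≤ = begin
    card (badIn? {n = n} j i E)                        ≤⟨ bad-≤-marked {n = n} {j} {i} E ⟩
    card (goodIn? {n = n} j i (markedContents j i E))  ≤⟨ swapped-marks-≤ {n = n} E j i j i ⟩
    card (goodIn? {n = n} j i (markedContents i j E))  ≤⟨ good-≤ {n = n} 1≤j 1≤i b (markedContents i j E)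
        marked-below (marked-markable {n = n} {i} {j} E) ⟩
    card (goodIn? {n = n} i j (markedContents i j E))  ≤⟨ marked-≤-bad 1≤i 1≤j E markable ⟩
    card (badIn? {n = n} i j E)                        ∎

-- Coefficients of the generating polynomial

maximum-≤⁺ : {f : Fin n → ℕ} {b : ℕ} → (∀ v → f v ≤ b) → maximum f ≤ b
maximum-≤⁺ {n} {f} f≤b = max≤v⁺ {xs = map f (allFin n)} z≤n (All.map⁺ (All.tabulate λ {v} _ → f≤b v))

maximum-≤⁻ : {f : Fin n → ℕ} {b : ℕ} → maximum f ≤ b → ∀ v → f v ≤ b
maximum-≤⁻ {n} {f} max≤b v = ≤-trans (All.lookup (All.map⁻ (xs≤max 0 (map f (allFin n)))) (∈-allFin v)) max≤b

allPlain : Graph n → Coloured n 0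
allPlain G = G ▷ λ _ → plain

leaf⇔leafAt : (G : Graph n) (v u : Fin n) → Leaf G u × Adjacent G v u → LeafAt G v u
leaf⇔leafAt G v u (leaf , e) = e , λ w a → case w Fin.≟ v of λ
  { (yes w≡v) → w≡v
  ; (no w≢v)  → contradiction (≤-trans (≤-reflexive (sym (two w w≢v))) (≤-trans
      (count-mono (pair? w) (λ x → adjacent? G u x)
        λ { x (inj₁ refl) → a ; x (inj₂ refl) → Adjacent-sym G e })
      (≤-reflexive (trans (sym (∣⟪⟫∣≡count (adjacent? G u))) leaf)))) λ { (s≤s ()) } }
  where
  pair? = λ w x → (x Fin.≟ w) ⊎-dec (x Fin.≟ v)

  two : ∀ w → w ≢ v → count (pair? w) ≡ 2
  two w w≢v = trans (count-⊎ (pair? w) (Fin._≟ w) (Fin._≟ v) (λ _ → id) (λ _ → inj₁) (λ _ → inj₂)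
    λ { x refl refl → w≢v refl }) (cong₂ _+_ (count-singleton w) (count-singleton v))

leafAt⇒leaf : (G : Graph n) (v u : Fin n) → LeafAt G v u → Leaf G u × Adjacent G v u
leafAt⇒leaf G v u (e , only) = trans (∣⟪⟫∣≡count (adjacent? G u)) (trans
  (count-cong (adjacent? G u) (Fin._≟ v) only λ { w refl → Adjacent-sym G e }) (count-singleton v)) , e

module _ (G : Graph n) where

  siblingClass≡ : ∀ v → ∣ ⟪ (λ u → ≡-dec Bool._≟_ (N[ G ] u) (N[ G ] v)) ⟫ ∣ ≡ plainSiblings (allPlain G) v
  siblingClass≡ v = trans (∣⟪⟫∣≡count (λ u → sibling? G u v))
    (count-cong (λ u → sibling? G u v) (λ u → plain? (allPlain G) u ×-dec sibling? G u v)
        (λ _ s → refl , s) (λ _ → proj₂))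

  tuft≡ : ∀ v → ∣ ⟪ (λ u → leaf? G u ×-dec adjacent? G v u) ⟫ ∣ ≡ plainLeaves (allPlain G) v
  tuft≡ v = trans (∣⟪⟫∣≡count (λ u → leaf? G u ×-dec adjacent? G v u))
    (count-cong (λ u → leaf? G u ×-dec adjacent? G v u) (λ u → plain? (allPlain G) u ×-dec leafAt? G v u)
      (λ u p → refl , leaf⇔leafAt G v u p) (λ u (_ , l) → leafAt⇒leaf G v u l))

  -- The classes counted in `siblingNumber` contain the vertex itself. The final `∸ 1` thus turns
  -- `siblingNumber G < suc i` into a bound `suc i` on class sizes, as in `Good`.
  small⇒good : siblingNumber G < suc i → tuftNumber G < suc j → Good (suc i) (suc j) (allPlain G)
  small⇒good {i} {j} s<i t<j v _ =
    ≤-trans (≤-reflexive (sym (siblingClass≡ v))) (maximum-≤⁻ (≤-trans (m≤n+m∸n _ 1) s<i) v) ,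
    s≤s (≤-trans (≤-reflexive (sym (tuft≡ v))) (maximum-≤⁻ (s≤s⁻¹ t<j) v))

  good⇒small : Good (suc i) (suc j) (allPlain G) → siblingNumber G < suc i × tuftNumber G < suc j
  good⇒small {i} {j} good =
    s≤s (m≤n+o⇒m∸n≤o _ 1 (maximum-≤⁺ λ v → ≤-trans (≤-reflexive (siblingClass≡ v)) (proj₁ (good v refl)))) ,
    s≤s (maximum-≤⁺ λ v → ≤-trans (≤-reflexive (tuft≡ v)) (s≤s⁻¹ (proj₂ (good v refl))))

-- The bound on the plain vertices is automatic, but makes PlainBelow provable
-- for contents that no graph has.
unmarked : ℕ → Contents 0
unmarked n (d ∷ p ∷ []) = (d ≡ᵇ 0) ∧ (p ≤ᵇ n)

unmarked⁻ : ∀ n d p → T (unmarked n (d ∷ p ∷ [])) → d ≡ 0 × p ≤ n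
unmarked⁻ n d p e with Equivalence.to (Bool.T-∧ {d ≡ᵇ 0}) e
... | a , b = ≡ᵇ⇒≡ d 0 a , ≤ᵇ⇒≤ p n b

unmarked⁺ : ∀ n d p → d ≡ 0 → p ≤ n → T (unmarked n (d ∷ p ∷ []))
unmarked⁺ n d p d≡0 p≤n = Equivalence.from (Bool.T-∧ {d ≡ᵇ 0}) (≡⇒≡ᵇ d 0 d≡0 , ≤⇒≤ᵇ p≤n)

count-≤ : {P : Pred (Fin n) 0ℓ} (P? : Decidable P) → count P? ≤ n
count-≤ {zero}  P? = z≤n
count-≤ {suc n} P? = +-mono-≤ (ind-≤1 (P? zero)) (count-≤ (P? ∘ suc))
  where
  ind-≤1 : (a? : Dec A) → ind a? ≤ 1
  ind-≤1 (yes _) = ≤-refl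
  ind-≤1 (no _)  = z≤n

unmarked⇒plain : (X : Coloured n 0) → T (unmarked n (content X)) → ∀ v → Plain X v
unmarked⇒plain {n} X e v with colour X v in c
... | plain = refl
... | dead  = contradiction (proj₁ (unmarked⁻ n (size X dead) (size X plain) e))
                (>⇒≢ (count-positive (λ v → colour X v Fin.≟ dead) {v} c))

distinct-third : 3 ≤ n → (u v : Fin n) → ∃ λ x → x ≢ u × x ≢ v
distinct-third (s≤s (s≤s (s≤s _))) zero          zero          = 1F , (λ ()) , (λ ())
distinct-third (s≤s (s≤s (s≤s _))) zero          (suc zero)    = 2F , (λ ()) , (λ ())
distinct-third (s≤s (s≤s (s≤s _))) zero          (suc (suc _)) = 1F , (λ ()) , (λ ())
distinct-third (s≤s (s≤s (s≤s _))) (suc zero)    zero          = 2F , (λ ()) , (λ ())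
distinct-third (s≤s (s≤s (s≤s _))) (suc (suc _)) zero          = 1F , (λ ()) , (λ ())
distinct-third (s≤s (s≤s (s≤s _))) (suc _)       (suc _)       = 0F , (λ ()) , (λ ())

-- Every vertex is plain here, so any vertex besides `u` and `v` will do; this is where `3 ≤ n` is
-- used to rule out K₂.
unmarked-markable : 3 ≤ n → Markable n (unmarked n)
unmarked-markable 3≤n X e u v _ _ with distinct-third 3≤n u v
... | x , x≢u , x≢v = x , (λ d → case trans (sym (unmarked⇒plain X e x)) d of λ ()) , x≢u , x≢v

-- Transfer between unlabeled graphs and coloured classes

small? : ∀ i j → Decidable (λ (G : Graph n) → siblingNumber G < i × tuftNumber G < j)
small? i j G = (siblingNumber G <? i) ×-dec (tuftNumber G <? j)

number : {P : Pred (Graph n) 0ℓ} → Decidable P → ℕ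
number {n} P? = length (filter P? (unlabeledConnectedGraphs n))

module _ (n i j : ℕ) where

  small-≤-good : number {n} (small? (suc i) (suc j)) ≤ card (goodIn? {n = n} (suc i) (suc j) (unmarked n))
  small-≤-good = length-≤ (λ {G} {H} → ≅-sym {G = G} {H}) (λ G Z → allPlain G ≃ Z)
    (AllPairs.filter⁺ (small? (suc i) (suc j)) (unlabeledConnectedGraphs-distinct n))
    total
    (λ { {G} {G′} {Z} iso iso′ → forget G G′ (≃-trans {X = allPlain G} {Z} {allPlain G′} iso
        (≃-sym {X = allPlain G′} {Z} iso′)) })
    where
    forget : ∀ G G′ → allPlain G ≃ allPlain G′ → G ≅ G′
    forget G G′ (π , f , _) = π , f

    total : ∀ {G} → G ∈ filter (small? (suc i) (suc j)) (unlabeledConnectedGraphs n) →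
            Any (allPlain G ≃_) (filter (goodIn? (suc i) (suc j) (unmarked n)) (classes n 0))
    total {G} G∈ with ∈-filter⁻ (small? (suc i) (suc j)) {xs = unlabeledConnectedGraphs n} G∈
    ... | G∈′ , s<i , t<j with find (classes-complete (allPlain G))
    ...   | Z , Z∈ , iso = lose (∈-filter⁺ (goodIn? (suc i) (suc j) (unmarked n)) Z∈
            (GoodIn-≃ (suc i) (suc j) (unmarked n) {allPlain G} {Z} iso
                ((valid , is-unmarked) , small⇒good G s<i t<j))) iso
      where
      valid : Valid (allPlain G)
      isolated  valid _ = λ ()
      connected valid u v _ _ = All.lookup (unlabeledConnectedGraphs-connected n) G∈′ u v

      is-unmarked : T (unmarked n (content (allPlain G)))
      is-unmarked = unmarked⁺ n (size (allPlain G) dead) (size (allPlain G) plain)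
        (sum-zero {n} λ _ → refl) (count-≤ (λ v → colour (allPlain G) v Fin.≟ plain))

  good-≤-small : card (goodIn? {n = n} (suc i) (suc j) (unmarked n)) ≤ number {n} (small? (suc i) (suc j))
  good-≤-small = length-≤ (λ {X} {Y} → ≃-sym {X = X} {Y}) (λ Z G → (∀ v → Plain Z v) × graph Z ≅ G)
    (AllPairs.filter⁺ (goodIn? (suc i) (suc j) (unmarked n)) (classes-distinct n 0))
    total
    λ { {Z} {Z′} {G} (p , iso) (p′ , iso′) → remember Z Z′ p p′
        (≅-trans {G = graph Z} {G} {graph Z′} iso (≅-sym {G = graph Z′} {G} iso′)) }
    where
    remember : ∀ Z Z′ → (∀ v → Plain Z v) → (∀ v → Plain Z′ v) → graph Z ≅ graph Z′ → Z ≃ Z′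
    remember Z Z′ p p′ (π , f) = π , f , λ v → trans (p v) (sym (p′ _))

    total : ∀ {Z} → Z ∈ filter (goodIn? (suc i) (suc j) (unmarked n)) (classes n 0) →
            Any (λ G → (∀ v → Plain Z v) × graph Z ≅ G)
                (filter (small? (suc i) (suc j)) (unlabeledConnectedGraphs n))
    total {Z} Z∈ with ∈-filter⁻ (goodIn? (suc i) (suc j) (unmarked n)) {xs = classes n 0} Z∈
    ... | _ , (valid , e) , good with find (unlabeledConnectedGraphs-complete (graph Z) connected-Z)
      where
      connected-Z : Connected (graph Z)
      connected-Z u v = connected valid u v
        (λ d → case trans (sym (unmarked⇒plain Z e u)) d of λ ())
        (λ d → case trans (sym (unmarked⇒plain Z e v)) d of λ ())
    ...   | G , G∈ , iso@(π , f) = lose (∈-filter⁺ (small? (suc i) (suc j)) G∈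
            (good⇒small G (Good-≃ {X = Z} {allPlain G} (π , f , unmarked⇒plain Z e) good)))
            (unmarked⇒plain Z e , iso)

number-none : {P : Pred (Graph n) 0ℓ} (P? : Decidable P) → (∀ G → ¬ P G) → number P? ≡ 0
number-none {n} P? none = cong length (filter-none P? (All.universal none (unlabeledConnectedGraphs n)))

small-symmetric-≤ : 3 ≤ n → ∀ i j → number {n} (small? i j) ≤ number {n} (small? j i)
small-symmetric-≤ {n} _ zero    j    = ≤-trans (≤-reflexive (number-none {n} (small? zero j) λ _ ())) z≤n
small-symmetric-≤ {n} _ (suc i) zero =
  ≤-trans (≤-reflexive (number-none {n} (small? (suc i) zero) λ _ ())) z≤n
small-symmetric-≤ {n} 3≤n (suc i) (suc j) = begin
  number {n} (small? (suc i) (suc j))                    ≤⟨ small-≤-good n i j ⟩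
  card (goodIn? {n = n} (suc i) (suc j) (unmarked n))
    ≤⟨ good-≤ {n = n} (s≤s z≤n) (s≤s z≤n) (suc n) (unmarked n) below (unmarked-markable 3≤n) ⟩
  card (goodIn? {n = n} (suc j) (suc i) (unmarked n))    ≤⟨ good-≤-small n j i ⟩
  number {n} (small? (suc j) (suc i))                    ∎
  where
  open ≤-Reasoning

  below : PlainBelow (suc n) (unmarked n)
  below d p [] e = s≤s (proj₂ (unmarked⁻ n d p e))

small-symmetric : 3 ≤ n → ∀ i j → number {n} (small? i j) ≡ number {n} (small? j i)
small-symmetric 3≤n i j = ≤-antisym (small-symmetric-≤ 3≤n i j) (small-symmetric-≤ 3≤n j i)

coefficient : ∀ n i j → generatingPolynomial n i j ≡
  number {n} (λ G → (siblingNumber G ℕ.≟ i) ×-dec (tuftNumber G ℕ.≟ j))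
coefficient n i j = go (unlabeledConnectedGraphs n)
  where
  go : ∀ Gs → ∑ (map (λ G → monomial (siblingNumber G) (tuftNumber G)) Gs) i j ≡
              length (filter (λ G → (siblingNumber G ℕ.≟ i) ×-dec (tuftNumber G ℕ.≟ j)) Gs)
  go [] = refl
  go (G ∷ Gs) with does (siblingNumber G ℕ.≟ i) ∧ does (tuftNumber G ℕ.≟ j)
  ... | true  = cong suc (go Gs)
  ... | false = go Gs

number-split : {P Q R : Pred (Graph n) 0ℓ} (P? : Decidable P) (Q? : Decidable Q) (R? : Decidable R) →
  (∀ {G} → P G → Q G ⊎ R G) → (∀ {G} → Q G → P G) → (∀ {G} → R G → P G) → (∀ {G} → Q G → ¬ R G) →
  number P? ≡ number Q? + number R?
number-split {n} P? Q? R? f q r disj = length-filter-split P? Q? R? f q r disj (unlabeledConnectedGraphs n)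

-- Coefficients as second differences

module _ (n : ℕ) where

  private
    below at-s at-t at : ℕ → ℕ → ℕ
    below i j = number {n} (small? i j)
    at-s  i j = number {n} (λ G → (siblingNumber G ℕ.≟ i) ×-dec (tuftNumber G <? j))
    at-t  i j = number {n} (λ G → (siblingNumber G <? i) ×-dec (tuftNumber G ℕ.≟ j))
    at    i j = number {n} (λ G → (siblingNumber G ℕ.≟ i) ×-dec (tuftNumber G ℕ.≟ j))

    <-suc : ∀ {m k} → m < suc k → m < k ⊎ m ≡ k
    <-suc p = m≤n⇒m<n∨m≡n (s≤s⁻¹ p)

    below-suc-s : ∀ i j → below (suc i) j ≡ below i j + at-s i j
    below-suc-s i j = number-split {n} (small? (suc i) j) (small? i j)
        (λ G → (siblingNumber G ℕ.≟ i) ×-dec (tuftNumber G <? j))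
      (λ (s , t) → [ (λ s′ → inj₁ (s′ , t)) , (λ s′ → inj₂ (s′ , t)) ]′ (<-suc s))
      (λ (s , t) → m<n⇒m<1+n s , t) (λ { (refl , t) → ≤-refl , t })
          (λ { (s , _) (refl , _) → <-irrefl refl s })

    below-suc-t : ∀ i j → below i (suc j) ≡ below i j + at-t i j
    below-suc-t i j = number-split {n} (small? i (suc j)) (small? i j)
        (λ G → (siblingNumber G <? i) ×-dec (tuftNumber G ℕ.≟ j))
      (λ (s , t) → [ (λ t′ → inj₁ (s , t′)) , (λ t′ → inj₂ (s , t′)) ]′ (<-suc t))
      (λ (s , t) → s , m<n⇒m<1+n t) (λ { (s , refl) → s , ≤-refl })
          (λ { (_ , t) (_ , refl) → <-irrefl refl t })

    at-s-suc : ∀ i j → at-s i (suc j) ≡ at-s i j + at i j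
    at-s-suc i j = number-split {n} (λ G → (siblingNumber G ℕ.≟ i) ×-dec (tuftNumber G <? suc j))
      (λ G → (siblingNumber G ℕ.≟ i) ×-dec (tuftNumber G <? j))
          (λ G → (siblingNumber G ℕ.≟ i) ×-dec (tuftNumber G ℕ.≟ j))
      (λ (s , t) → [ (λ t′ → inj₁ (s , t′)) , (λ t′ → inj₂ (s , t′)) ]′ (<-suc t))
      (λ (s , t) → s , m<n⇒m<1+n t) (λ { (s , refl) → s , ≤-refl })
          (λ { (_ , t) (_ , refl) → <-irrefl refl t })

    at-t-suc : ∀ i j → at-t (suc i) j ≡ at-t i j + at i j
    at-t-suc i j = number-split {n} (λ G → (siblingNumber G <? suc i) ×-dec (tuftNumber G ℕ.≟ j))
      (λ G → (siblingNumber G <? i) ×-dec (tuftNumber G ℕ.≟ j))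
          (λ G → (siblingNumber G ℕ.≟ i) ×-dec (tuftNumber G ℕ.≟ j))
      (λ (s , t) → [ (λ s′ → inj₁ (s′ , t)) , (λ s′ → inj₂ (s′ , t)) ]′ (<-suc s))
      (λ (s , t) → m<n⇒m<1+n s , t) (λ { (refl , t) → ≤-refl , t })
          (λ { (s , _) (refl , _) → <-irrefl refl s })

  symmetric-from-below : (∀ i j → number {n} (small? i j) ≡ number {n} (small? j i)) →
                         SymmetricPolynomial (generatingPolynomial n)
  symmetric-from-below symm i j = trans (coefficient n i j) (trans (at-sym i j) (sym (coefficient n j i)))
    where
    -- A first difference in the sibling number corresponds, after exchanging the arguments, to a
    -- first difference in the tuft number.
    at-s≡at-t : ∀ i j → at-s i j ≡ at-t j i
    at-s≡at-t i j = +-cancelˡ-≡ (below i j) _ _ (trans (sym (below-suc-s i j)) (trans (symm (suc i) j)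
      (trans (below-suc-t j i) (cong (_+ at-t j i) (symm j i)))))

    at-sym : ∀ i j → at i j ≡ at j i
    at-sym i j = +-cancelˡ-≡ (at-s i j) _ _ (trans (sym (at-s-suc i j)) (trans (at-s≡at-t i (suc j))
      (trans (at-t-suc j i) (cong (_+ at j i) (sym (at-s≡at-t i j))))))

-- Covers n ≤ 2, and in particular K₂.
symmetric-from-equal : ∀ n → All (λ G → siblingNumber G ≡ tuftNumber G) (unlabeledConnectedGraphs n) →
                       SymmetricPolynomial (generatingPolynomial n)
symmetric-from-equal n all i j = go all
  where
  go : ∀ {Gs : List (Graph n)} → All (λ G → siblingNumber G ≡ tuftNumber G) Gs →
       ∑ (map (λ G → monomial (siblingNumber G) (tuftNumber G)) Gs) i j ≡
       ∑ (map (λ G → monomial (siblingNumber G) (tuftNumber G)) Gs) j i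
  go {[]} All.[] = refl
  go {G ∷ _} (e All.∷ es) = cong₂ _+_
    (cong (if_then 1 else 0) (trans
      (cong (λ t → does (siblingNumber G ℕ.≟ i) ∧ does (t ℕ.≟ j)) (sym e))
      (trans (Bool.∧-comm (does (siblingNumber G ℕ.≟ i)) (does (siblingNumber G ℕ.≟ j)))
        (cong (λ t → does (siblingNumber G ℕ.≟ j) ∧ does (t ℕ.≟ i)) e))))
    (go es)

theorem1p1 : (n : ℕ) → 1 ≤ n → SymmetricPolynomial (generatingPolynomial n)
-- Decided by evaluation here and for two vertices: the only graphs are K₁, with both numbers 0, and
-- K₂, with both numbers 1.
theorem1p1 1 _ = symmetric-from-equal 1 (from-yes
    (All.all? (λ G → siblingNumber G ℕ.≟ tuftNumber G) (unlabeledConnectedGraphs 1)))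
theorem1p1 2 _ = symmetric-from-equal 2 (from-yes
    (All.all? (λ G → siblingNumber G ℕ.≟ tuftNumber G) (unlabeledConnectedGraphs 2)))
theorem1p1 n@(suc (suc (suc _))) _ = symmetric-from-below n (small-symmetric {n} (s≤s (s≤s (s≤s z≤n))))
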